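{- There exists a constant $K'$ such that for any finite set $X$, any increasing family $\mathcal F\subseteq 2^X$, and any integer $k\ge \ell(\mathcal F)$, we have \[ q_f(\mathcal F)\le p_c^k(\mathcal F)\le K'\, q_f(\mathcal F)\,\log \ell(\mathcal F). \]
   Context: A family $\mathcal F\subseteq 2^X$ is increasing if $B\supseteq A\in\mathcal F$ (with $B\subseteq X$) implies $B\in\mathcal F$. $\mathcal H_{\mathcal F}$ denotes the family of inclusion-minimal members of $\mathcal F$, and $\ell(\mathcal F)$ is the maximum size of a member of $\mathcal H_{\mathcal F}$. $\mathcal F$ is weakly $p$-small if there is a function $g:2^X\to\mathbb R^+=[0,\infty)$ such that $\sum_{S\subseteq T} g(S)\ge 1$ for all $T\in\mathcal F$ and $\sum_{S\subseteq X} g(S)p^{|S|}\le \frac12$. The fractional expectation-threshold is $q_f(\mathcal F):=\max\{p: \mathcal F\text{ is weakly }p\text{ -small}\}$. Let $[k]=\{1,\dots,k\}$ and $X'=X\times[k]$. For $S=\{(x_1,i_1),\dots,(x_t,i_t)\}\subseteq X'$ (with $|S|=t$), let $\mu_p^k(S)=(p/k)^t(1-p)^{|X|-t}$ if $x_1,\dots,x_t$ are distinct, and $\mu_p^k(S)=0$ otherwise; for $\mathcal F'\subseteq 2^{X'}$ let $\mu_p^k(\mathcal F')=\sum_{S\in\mathcal F'}\mu_p^k(S)$. (This is the law of the random colored subset obtained by giving each $x\in X$ an independent uniformly random color in $[k]$ and including each $x$ independently with probability $p$.) A rainbow edge of $\mathcal H_{\mathcal F}$ is a set $\{(x_1,i_1),\dots,(x_t,i_t)\}\subseteq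 X'$ with $x_1,\dots,x_t$ distinct, $\{x_1,\dots,x_t\}\in\mathcal H_{\mathcal F}$, and $i_1,\dots,i_t$ distinct. $\mathcal F^{\mathrm{rb}}\subseteq 2^{X'}$ is the increasing family generated by all rainbow edges of $\mathcal H_{\mathcal F}$, i.e. the family of all subsets of $X'$ that contain some rainbow edge of $\mathcal H_{\mathcal F}$. The $k$-color rainbow threshold $p_c^k(\mathcal F)$, for $k\ge\ell(\mathcal F)$, is the value of $p$ such that $\mu_p^k(\mathcal F^{\mathrm{rb}})=\frac12$.
   Formalization: The upper bound is asserted only for ℓ(F) ≥ 2: for ℓ(F) = 1 the right side is 0 since log 1 = 0, and the inequality fails (X a single point, F = {X}, k = 1 has p_c = q_f = 1/2). -}

module Defs where

open import Level using (0ℓ)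
open import Data.Bool.Base using (if_then_else_)
open import Data.Nat.Base as ℕ using (ℕ; zero; suc)
import Data.Nat.Properties as ℕ
open import Data.Nat.Logarithm using (⌊log₂_⌋; ⌊log₂⌋-mono-≤; ⌊log₂[2^n]⌋≡n)
open import Data.Nat.Logarithm.Core using (⌊log2⌋)
open import Data.Nat.Induction using (<-wellFounded)
open import Induction.WellFounded using (Acc; acc)
open import Data.Integer.Base as ℤ using (+_; +[1+_]; -[1+_])
import Data.Integer.Properties as ℤ
open import Data.Integer.Solver using () renaming (module +-*-Solver to ℤSolver)
open import Data.Rational.Base as ℚ using (ℚ; mkℚ; 0ℚ; 1ℚ; ½; toℚᵘ; fromℚᵘ)
import Data.Rational.Properties as ℚ
open import Data.Rational.Solver using (module +-*-Solver)
open import Data.Rational.Unnormalised.Base as ℚᵘ using (mkℚᵘ)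
import Data.Rational.Unnormalised.Properties as ℚᵘ
open import Data.Fin.Base using (Fin; combine)
import Data.Fin.Properties as Fin
open import Data.Fin.Subset using (Subset; inside; outside; _∈_; _⊆_; ∣_∣)
open import Data.Fin.Subset.Properties using (_∈?_; _⊆?_; anySubset?)
open import Data.Vec.Base using ([]; _∷_; tabulate)
open import Data.Vec.Properties using (≡-dec)
open import Data.Bool.Properties using () renaming (_≟_ to _≟ᵇ_)
open import Data.Product.Base using (∃-syntax; _×_; _,_)
open import Data.Sum.Base using (inj₁; inj₂)
open import Relation.Nullary using (Dec; does)
open import Relation.Nullary.Decidable using (_×-dec_; _→-dec_; ¬?; map′; decidable-stable)
open import Relation.Unary using (Pred; Decidable)
open import Relation.Binary.Core using (Rel)
open import Relation.Binary.PropositionalEquality using (_≡_; refl; sym; trans; cong; cong₂; subst; subst₂)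

------------------------------------------------------------------------
-- Real numbers as Cauchy sequences of rationals

IsCauchy : (ℕ → ℚ) → Set
IsCauchy x = ∀ ε → 0ℚ ℚ.< ε →
  ∃[ N ] (∀ m n → N ℕ.≤ m → N ℕ.≤ n → ℚ.∣ x m ℚ.- x n ∣ ℚ.≤ ε)

record ℝ : Set where
  constructor mkℝ
  field
    seq    : ℕ → ℚ
    cauchy : IsCauchy seq
open ℝ public

infix 4 _≤ℝ_ _≃ℝ_

_≤ℝ_ : Rel ℝ 0ℓ
x ≤ℝ y = ∀ ε → 0ℚ ℚ.< ε → ∃[ N ] (∀ n → N ℕ.≤ n → seq x n ℚ.≤ seq y n ℚ.+ ε)

-- ℝ carries no quotient: this relation is equality of real numbers.
_≃ℝ_ : Rel ℝ 0ℓ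
x ≃ℝ y = x ≤ℝ y × y ≤ℝ x

half-pos : ∀ {ε} → 0ℚ ℚ.< ε → 0ℚ ℚ.< ½ ℚ.* ε
half-pos 0<ε = ℚ.*-monoʳ-<-pos ½ 0<ε

half+half : ∀ ε → ½ ℚ.* ε ℚ.+ ½ ℚ.* ε ≡ ε
half+half ε = trans (sym (ℚ.*-distribʳ-+ ε ½ ½)) (ℚ.*-identityˡ ε)

-- Some tail of a Cauchy sequence is bounded.
tail-bound : ∀ (x : ℕ → ℚ) → IsCauchy x →
  ∃[ B ] (0ℚ ℚ.< B × ∃[ N ] (∀ n → N ℕ.≤ n → ℚ.∣ x n ∣ ℚ.≤ B))
tail-bound x cx with cx 1ℚ (ℚ.positive⁻¹ 1ℚ)
... | N , close = 1ℚ ℚ.+ ℚ.∣ x N ∣ , B>0 , N , bound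
  where
  open ℚ.≤-Reasoning
  open +-*-Solver
  B>0 : 0ℚ ℚ.< 1ℚ ℚ.+ ℚ.∣ x N ∣
  B>0 = ℚ.+-mono-<-≤ (ℚ.positive⁻¹ 1ℚ) (ℚ.0≤∣p∣ (x N))
  bound : ∀ n → N ℕ.≤ n → ℚ.∣ x n ∣ ℚ.≤ 1ℚ ℚ.+ ℚ.∣ x N ∣
  bound n N≤n = begin
    ℚ.∣ x n ∣                        ≡⟨ cong ℚ.∣_∣ (solve 2 (λ a b → a := (a :- b) :+ b) refl (x n) (x N)) ⟩
    ℚ.∣ (x n ℚ.- x N) ℚ.+ x N ∣      ≤⟨ ℚ.∣p+q∣≤∣p∣+∣q∣ (x n ℚ.- x N) (x N) ⟩
    ℚ.∣ x n ℚ.- x N ∣ ℚ.+ ℚ.∣ x N ∣  ≤⟨ ℚ.+-monoˡ-≤ ℚ.∣ x N ∣ (close n N N≤n ℕ.≤-refl) ⟩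
    1ℚ ℚ.+ ℚ.∣ x N ∣                 ∎

const-cauchy : ∀ q → IsCauchy (λ _ → q)
const-cauchy q ε 0<ε = 0 , λ _ _ _ _ →
  subst (ℚ._≤ ε) (sym (cong ℚ.∣_∣ (ℚ.+-inverseʳ q))) (ℚ.<⇒≤ 0<ε)

+-cauchy : ∀ x y → IsCauchy x → IsCauchy y → IsCauchy (λ n → x n ℚ.+ y n)
+-cauchy x y cx cy ε 0<ε with cx _ (half-pos 0<ε) | cy _ (half-pos 0<ε)
... | N₁ , p | N₂ , q = N₁ ℕ.⊔ N₂ , λ m n N≤m N≤n → begin
  ℚ.∣ (x m ℚ.+ y m) ℚ.- (x n ℚ.+ y n) ∣
    ≡⟨ cong ℚ.∣_∣ (solve 4 (λ a b c d → (a :+ b) :- (c :+ d) := (a :- c) :+ (b :- d)) refl (x m) (y m) (x n) (y n)) ⟩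
  ℚ.∣ (x m ℚ.- x n) ℚ.+ (y m ℚ.- y n) ∣
    ≤⟨ ℚ.∣p+q∣≤∣p∣+∣q∣ (x m ℚ.- x n) (y m ℚ.- y n) ⟩
  ℚ.∣ x m ℚ.- x n ∣ ℚ.+ ℚ.∣ y m ℚ.- y n ∣
    ≤⟨ ℚ.+-mono-≤ (p m n (ℕ.m⊔n≤o⇒m≤o N₁ N₂ N≤m) (ℕ.m⊔n≤o⇒m≤o N₁ N₂ N≤n))
                  (q m n (ℕ.m⊔n≤o⇒n≤o N₁ N₂ N≤m) (ℕ.m⊔n≤o⇒n≤o N₁ N₂ N≤n)) ⟩
  ½ ℚ.* ε ℚ.+ ½ ℚ.* ε
    ≡⟨ half+half ε ⟩
  ε ∎
  where
  open ℚ.≤-Reasoning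
  open +-*-Solver

neg-cauchy : ∀ x → IsCauchy x → IsCauchy (λ n → ℚ.- x n)
neg-cauchy x cx ε 0<ε with cx ε 0<ε
... | N , p = N , λ m n N≤m N≤n → subst (ℚ._≤ ε)
  (trans (sym (ℚ.∣-p∣≡∣p∣ (x m ℚ.- x n)))
         (cong ℚ.∣_∣ (solve 2 (λ a b → :- (a :- b) := (:- a) :- (:- b)) refl (x m) (x n))))
  (p m n N≤m N≤n)
  where open +-*-Solver

*-abs-mono : ∀ {a b} c d → 0ℚ ℚ.≤ b → ℚ.∣ c ∣ ℚ.≤ a → ℚ.∣ d ∣ ℚ.≤ b → ℚ.∣ c ℚ.* d ∣ ℚ.≤ a ℚ.* b
*-abs-mono {a} {b} c d 0≤b c≤a d≤b = begin
  ℚ.∣ c ℚ.* d ∣        ≡⟨ ℚ.∣p*q∣≡∣p∣*∣q∣ c d ⟩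
  ℚ.∣ c ∣ ℚ.* ℚ.∣ d ∣  ≤⟨ ℚ.*-monoˡ-≤-nonNeg ℚ.∣ c ∣ {{ℚ.nonNegative (ℚ.0≤∣p∣ c)}} d≤b ⟩
  ℚ.∣ c ∣ ℚ.* b        ≤⟨ ℚ.*-monoʳ-≤-nonNeg b {{ℚ.nonNegative 0≤b}} c≤a ⟩
  a ℚ.* b              ∎
  where open ℚ.≤-Reasoning

-- ε ↦ ε / (2B)
share : ∀ B ε → 0ℚ ℚ.< B → 0ℚ ℚ.< ε → ∃[ δ ] (0ℚ ℚ.< δ × B ℚ.* δ ≡ ½ ℚ.* ε)
share B ε 0<B 0<ε = 1/B ℚ.* (½ ℚ.* ε) , δ>0 , eq
  where
  instance
    B-pos = ℚ.positive 0<B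
    B≢0   = ℚ.pos⇒nonZero B
  1/B = ℚ.1/ B
  δ>0 : 0ℚ ℚ.< 1/B ℚ.* (½ ℚ.* ε)
  δ>0 = subst (ℚ._< 1/B ℚ.* (½ ℚ.* ε)) (ℚ.*-zeroʳ 1/B)
    (ℚ.*-monoʳ-<-pos 1/B {{ℚ.1/pos⇒pos B}} (half-pos 0<ε))
  eq : B ℚ.* (1/B ℚ.* (½ ℚ.* ε)) ≡ ½ ℚ.* ε
  eq = trans (sym (ℚ.*-assoc B 1/B (½ ℚ.* ε)))
    (trans (cong (ℚ._* (½ ℚ.* ε)) (ℚ.*-inverseʳ B)) (ℚ.*-identityˡ (½ ℚ.* ε)))

split-product : ∀ a b c d → a ℚ.* b ℚ.- c ℚ.* d ≡ a ℚ.* (b ℚ.- d) ℚ.+ d ℚ.* (a ℚ.- c)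
split-product = solve 4 (λ a b c d → a :* b :- c :* d := a :* (b :- d) :+ d :* (a :- c)) refl
  where open +-*-Solver

*-close : ∀ {A B δ η ε} a b c d → 0ℚ ℚ.≤ δ → 0ℚ ℚ.≤ η →
  A ℚ.* δ ≡ ½ ℚ.* ε → B ℚ.* η ≡ ½ ℚ.* ε →
  ℚ.∣ a ∣ ℚ.≤ A → ℚ.∣ d ∣ ℚ.≤ B → ℚ.∣ b ℚ.- d ∣ ℚ.≤ δ → ℚ.∣ a ℚ.- c ∣ ℚ.≤ η →
  ℚ.∣ a ℚ.* b ℚ.- c ℚ.* d ∣ ℚ.≤ ε
*-close {A} {B} {δ} {η} {ε} a b c d 0≤δ 0≤η Aδ Bη a≤A d≤B bd ac = begin
  ℚ.∣ a ℚ.* b ℚ.- c ℚ.* d ∣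
    ≡⟨ cong ℚ.∣_∣ (split-product a b c d) ⟩
  ℚ.∣ a ℚ.* (b ℚ.- d) ℚ.+ d ℚ.* (a ℚ.- c) ∣
    ≤⟨ ℚ.∣p+q∣≤∣p∣+∣q∣ (a ℚ.* (b ℚ.- d)) (d ℚ.* (a ℚ.- c)) ⟩
  ℚ.∣ a ℚ.* (b ℚ.- d) ∣ ℚ.+ ℚ.∣ d ℚ.* (a ℚ.- c) ∣
    ≤⟨ ℚ.+-mono-≤ (*-abs-mono a (b ℚ.- d) 0≤δ a≤A bd) (*-abs-mono d (a ℚ.- c) 0≤η d≤B ac) ⟩
  A ℚ.* δ ℚ.+ B ℚ.* η
    ≡⟨ cong₂ ℚ._+_ Aδ Bη ⟩
  ½ ℚ.* ε ℚ.+ ½ ℚ.* ε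
    ≡⟨ half+half ε ⟩
  ε ∎
  where open ℚ.≤-Reasoning

*-cauchy : ∀ x y → IsCauchy x → IsCauchy y → IsCauchy (λ n → x n ℚ.* y n)
*-cauchy x y cx cy ε 0<ε =
  let A , 0<A , N₁ , bx = tail-bound x cx
      B , 0<B , N₂ , by = tail-bound y cy
      δ , 0<δ , Aδ      = share A ε 0<A 0<ε
      η , 0<η , Bη      = share B ε 0<B 0<ε
      N₃ , p            = cy δ 0<δ
      N₄ , q            = cx η 0<η
      N₁₂               = N₁ ℕ.⊔ N₂
      N₃₄               = N₃ ℕ.⊔ N₄
  in N₁₂ ℕ.⊔ N₃₄ , λ m n N≤m N≤n →
    let m₁₂ = ℕ.m⊔n≤o⇒m≤o N₁₂ N₃₄ N≤m
        m₃₄ = ℕ.m⊔n≤o⇒n≤o N₁₂ N₃₄ N≤m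
        n₁₂ = ℕ.m⊔n≤o⇒m≤o N₁₂ N₃₄ N≤n
        n₃₄ = ℕ.m⊔n≤o⇒n≤o N₁₂ N₃₄ N≤n
    in *-close (x m) (y m) (x n) (y n) (ℚ.<⇒≤ 0<δ) (ℚ.<⇒≤ 0<η) Aδ Bη
      (bx m (ℕ.m⊔n≤o⇒m≤o N₁ N₂ m₁₂)) (by n (ℕ.m⊔n≤o⇒n≤o N₁ N₂ n₁₂))
      (p m n (ℕ.m⊔n≤o⇒m≤o N₃ N₄ m₃₄) (ℕ.m⊔n≤o⇒m≤o N₃ N₄ n₃₄))
      (q m n (ℕ.m⊔n≤o⇒n≤o N₃ N₄ m₃₄) (ℕ.m⊔n≤o⇒n≤o N₃ N₄ n₃₄))

fromℚ : ℚ → ℝ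
fromℚ q = mkℝ (λ _ → q) (const-cauchy q)

0ℝ 1ℝ ½ℝ : ℝ
0ℝ = fromℚ 0ℚ
1ℝ = fromℚ 1ℚ
½ℝ = fromℚ ½

infixl 6 _+ℝ_ _-ℝ_
infixl 7 _*ℝ_ _/ℝ_
infix  8 -ℝ_
infixr 8 _^ℝ_

_+ℝ_ : ℝ → ℝ → ℝ
x +ℝ y = mkℝ (λ n → seq x n ℚ.+ seq y n) (+-cauchy (seq x) (seq y) (cauchy x) (cauchy y))

-ℝ_ : ℝ → ℝ
-ℝ x = mkℝ (λ n → ℚ.- seq x n) (neg-cauchy (seq x) (cauchy x))

_-ℝ_ : ℝ → ℝ → ℝ
x -ℝ y = x +ℝ (-ℝ y)

_*ℝ_ : ℝ → ℝ → ℝ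
x *ℝ y = mkℝ (λ n → seq x n ℚ.* seq y n) (*-cauchy (seq x) (seq y) (cauchy x) (cauchy y))

_/ℝ_ : ℝ → (k : ℕ) .{{_ : ℕ.NonZero k}} → ℝ
x /ℝ k = x *ℝ fromℚ (+ 1 ℚ./ k)

_^ℝ_ : ℝ → ℕ → ℝ
x ^ℝ zero  = 1ℝ
x ^ℝ suc n = x *ℝ x ^ℝ n

------------------------------------------------------------------------
-- Logarithm of a natural number

2^⌊log2⌋≤ : ∀ n (a : Acc ℕ._<_ (suc n)) → 2 ℕ.^ ⌊log2⌋ (suc n) a ℕ.≤ suc n
2^⌊log2⌋≤ zero    _        = ℕ.≤-refl
2^⌊log2⌋≤ (suc n) (acc rs) = begin
  2 ℕ.* 2 ℕ.^ ⌊log2⌋ (suc ℕ.⌊ n /2⌋) _  ≤⟨ ℕ.*-monoʳ-≤ 2 (2^⌊log2⌋≤ ℕ.⌊ n /2⌋ _) ⟩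
  2 ℕ.* suc ℕ.⌊ n /2⌋                   ≡⟨ ℕ.*-suc 2 ℕ.⌊ n /2⌋ ⟩
  2 ℕ.+ 2 ℕ.* ℕ.⌊ n /2⌋                 ≡⟨ cong (λ z → 2 ℕ.+ (ℕ.⌊ n /2⌋ ℕ.+ z)) (ℕ.+-identityʳ ℕ.⌊ n /2⌋) ⟩
  2 ℕ.+ (ℕ.⌊ n /2⌋ ℕ.+ ℕ.⌊ n /2⌋)       ≤⟨ ℕ.+-monoʳ-≤ 2 (ℕ.+-monoʳ-≤ ℕ.⌊ n /2⌋ (ℕ.⌊n/2⌋≤⌈n/2⌉ n)) ⟩
  2 ℕ.+ (ℕ.⌊ n /2⌋ ℕ.+ ℕ.⌈ n /2⌉)       ≡⟨ cong (2 ℕ.+_) (ℕ.⌊n/2⌋+⌈n/2⌉≡n n) ⟩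
  suc (suc n)                           ∎
  where open ℕ.≤-Reasoning

2^⌊log₂n⌋≤n : ∀ n .{{_ : ℕ.NonZero n}} → 2 ℕ.^ ⌊log₂ n ⌋ ℕ.≤ n
2^⌊log₂n⌋≤n (suc n) = 2^⌊log2⌋≤ n (<-wellFounded (suc n))

n<2^[1+⌊log₂n⌋] : ∀ n → n ℕ.< 2 ℕ.^ suc ⌊log₂ n ⌋
n<2^[1+⌊log₂n⌋] n = ℕ.≰⇒> λ h → ℕ.1+n≰n
  (subst (ℕ._≤ ⌊log₂ n ⌋) (⌊log₂[2^n]⌋≡n (suc ⌊log₂ n ⌋)) (⌊log₂⌋-mono-≤ h))

2^-cancel-≤ : ∀ {a b} → 2 ℕ.^ a ℕ.≤ 2 ℕ.^ b → a ℕ.≤ b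
2^-cancel-≤ {a} {b} h = ℕ.≮⇒≥ λ b<a → ℕ.<⇒≱ (ℕ.^-monoʳ-< 2 (ℕ.s≤s (ℕ.s≤s ℕ.z≤n)) b<a) h

-- 2^a ≤ n^s and n^t ≤ 2^b give a/s ≤ b/t.
cross : ∀ n s t a b → 2 ℕ.^ a ℕ.≤ n ℕ.^ s → n ℕ.^ t ℕ.≤ 2 ℕ.^ b → a ℕ.* t ℕ.≤ b ℕ.* s
cross n s t a b lo hi = 2^-cancel-≤ (begin
  2 ℕ.^ (a ℕ.* t)    ≡⟨ ℕ.^-*-assoc 2 a t ⟨
  (2 ℕ.^ a) ℕ.^ t    ≤⟨ ℕ.^-monoˡ-≤ t lo ⟩
  (n ℕ.^ s) ℕ.^ t    ≡⟨ ℕ.^-*-assoc n s t ⟩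
  n ℕ.^ (s ℕ.* t)    ≡⟨ cong (n ℕ.^_) (ℕ.*-comm s t) ⟩
  n ℕ.^ (t ℕ.* s)    ≡⟨ ℕ.^-*-assoc n t s ⟨
  (n ℕ.^ t) ℕ.^ s    ≤⟨ ℕ.^-monoˡ-≤ s hi ⟩
  (2 ℕ.^ b) ℕ.^ s    ≡⟨ ℕ.^-*-assoc 2 b s ⟩
  2 ℕ.^ (b ℕ.* s)    ∎)
  where open ℕ.≤-Reasoning

frac-mono : ∀ a b s t → a ℕ.* suc t ℕ.≤ b ℕ.* suc s → + a ℚ./ suc s ℚ.≤ + b ℚ./ suc t
frac-mono a b s t h = ℚ.toℚᵘ-cancel-≤ (begin
  toℚᵘ (fromℚᵘ (mkℚᵘ (+ a) s))  ≃⟨ ℚ.toℚᵘ-fromℚᵘ (mkℚᵘ (+ a) s) ⟩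
  mkℚᵘ (+ a) s                  ≤⟨ ℚᵘ.*≤* (subst₂ ℤ._≤_ (ℤ.pos-* a (suc t)) (ℤ.pos-* b (suc s)) (ℤ.+≤+ h)) ⟩
  mkℚᵘ (+ b) t                  ≃⟨ ℚ.toℚᵘ-fromℚᵘ (mkℚᵘ (+ b) t) ⟨
  toℚᵘ (fromℚᵘ (mkℚᵘ (+ b) t))  ∎)
  where open ℚᵘ.≤-Reasoning

frac-suc : ∀ b t → + suc b ℚ./ suc t ≡ + b ℚ./ suc t ℚ.+ + 1 ℚ./ suc t
frac-suc b t = ℚ.toℚᵘ-injective (begin-equality
  toℚᵘ (fromℚᵘ (mkℚᵘ (+ suc b) t))                     ≃⟨ ℚ.toℚᵘ-fromℚᵘ (mkℚᵘ (+ suc b) t) ⟩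
  mkℚᵘ (+ suc b) t                                     ≃⟨ ℚᵘ.*≡* num ⟩
  mkℚᵘ (+ b) t ℚᵘ.+ mkℚᵘ (+ 1) t                       ≃⟨ ℚᵘ.+-cong (ℚ.toℚᵘ-fromℚᵘ (mkℚᵘ (+ b) t)) (ℚ.toℚᵘ-fromℚᵘ (mkℚᵘ (+ 1) t)) ⟨
  toℚᵘ (+ b ℚ./ suc t) ℚᵘ.+ toℚᵘ (+ 1 ℚ./ suc t)       ≃⟨ ℚ.toℚᵘ-homo-+ (+ b ℚ./ suc t) (+ 1 ℚ./ suc t) ⟨
  toℚᵘ (+ b ℚ./ suc t ℚ.+ + 1 ℚ./ suc t)               ∎)
  where
  open ℚᵘ.≤-Reasoning
  open ℤSolver using (solve; _:+_; _:*_; _:=_; con)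
  num : + suc b ℤ.* + (suc t ℕ.* suc t) ≡ (+ b ℤ.* + suc t ℤ.+ + 1 ℤ.* + suc t) ℤ.* + suc t
  num = trans (cong (+ suc b ℤ.*_) (ℤ.pos-* (suc t) (suc t)))
    (trans (cong (ℤ._* (+ suc t ℤ.* + suc t)) (ℤ.pos-+ 1 b))
      (solve 2 (λ x y → (con (+ 1) :+ x) :* (y :* y) := (x :* y :+ con (+ 1) :* y) :* y) refl (+ b) (+ suc t)))

1/suc≤ε : ∀ ε → 0ℚ ℚ.< ε → ∃[ N ] (∀ n → N ℕ.≤ n → + 1 ℚ./ suc n ℚ.≤ ε)
1/suc≤ε ε@(mkℚ +[1+ a ] d _) _ = d , λ n d≤n →
  subst (+ 1 ℚ./ suc n ℚ.≤_) (ℚ.fromℚᵘ-toℚᵘ ε)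
    (frac-mono 1 (suc a) n d (ℕ.*-mono-≤ {1} {suc a} (ℕ.s≤s ℕ.z≤n) (ℕ.s≤s d≤n)))
1/suc≤ε (mkℚ (+ 0) _ _) (ℚ.*<* (ℤ.+<+ ()))
1/suc≤ε (mkℚ -[1+ _ ] _ _) (ℚ.*<* ())

∣p-q∣≤ε : ∀ {p q ε} → p ℚ.≤ q ℚ.+ ε → q ℚ.≤ p ℚ.+ ε → ℚ.∣ p ℚ.- q ∣ ℚ.≤ ε
∣p-q∣≤ε {p} {q} {ε} p≤ q≤ with ℚ.∣p∣≡p∨∣p∣≡-p (p ℚ.- q)
... | inj₁ eq = begin
  ℚ.∣ p ℚ.- q ∣        ≡⟨ eq ⟩
  p ℚ.- q              ≤⟨ ℚ.+-monoˡ-≤ (ℚ.- q) p≤ ⟩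
  (q ℚ.+ ε) ℚ.- q      ≡⟨ solve 2 (λ b e → (b :+ e) :- b := e) refl q ε ⟩
  ε                    ∎
  where
  open ℚ.≤-Reasoning
  open +-*-Solver
... | inj₂ eq = begin
  ℚ.∣ p ℚ.- q ∣        ≡⟨ eq ⟩
  ℚ.- (p ℚ.- q)        ≡⟨ solve 2 (λ a b → :- (a :- b) := b :- a) refl p q ⟩
  q ℚ.- p              ≤⟨ ℚ.+-monoˡ-≤ (ℚ.- p) q≤ ⟩
  (p ℚ.+ ε) ℚ.- p      ≡⟨ solve 2 (λ b e → (b :+ e) :- b := e) refl p ε ⟩
  ε                    ∎
  where
  open ℚ.≤-Reasoning
  open +-*-Solver

log₂-seq : ℕ → ℕ → ℚ
log₂-seq n m = + ⌊log₂ (n ℕ.^ suc m) ⌋ ℚ./ suc m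

below-log₂ : ∀ n a b → 2 ℕ.^ a ℕ.≤ n ℕ.^ suc b →
  ∀ m → + a ℚ./ suc b ℚ.≤ log₂-seq n m ℚ.+ + 1 ℚ./ suc m
below-log₂ n a b h m = subst (+ a ℚ./ suc b ℚ.≤_) (frac-suc L m)
  (frac-mono a (suc L) b m (cross n (suc b) (suc m) a (suc L) h (ℕ.<⇒≤ (n<2^[1+⌊log₂n⌋] (n ℕ.^ suc m)))))
  where L = ⌊log₂ (n ℕ.^ suc m) ⌋

2^⌊log₂n^m⌋≤n^m : ∀ n .{{_ : ℕ.NonZero n}} m → 2 ℕ.^ ⌊log₂ (n ℕ.^ m) ⌋ ℕ.≤ n ℕ.^ m
2^⌊log₂n^m⌋≤n^m n m = 2^⌊log₂n⌋≤n (n ℕ.^ m) {{ℕ.m^n≢0 n m}}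

log₂-cauchy : ∀ n .{{_ : ℕ.NonZero n}} → IsCauchy (log₂-seq n)
log₂-cauchy n ε 0<ε with 1/suc≤ε ε 0<ε
... | N , small = N , λ m m′ N≤m N≤m′ → ∣p-q∣≤ε (step m m′ N≤m′) (step m′ m N≤m)
  where
  step : ∀ m m′ → N ℕ.≤ m′ → log₂-seq n m ℚ.≤ log₂-seq n m′ ℚ.+ ε
  step m m′ N≤m′ = ℚ.≤-trans
    (below-log₂ n ⌊log₂ (n ℕ.^ suc m) ⌋ m (2^⌊log₂n^m⌋≤n^m n (suc m)) m′)
    (ℚ.+-monoʳ-≤ (log₂-seq n m′) (small m′ N≤m′))

-- log₂ n = lim ⌊log₂ (nᵐ)⌋ / m.
log₂ : ℕ → ℝ
log₂ zero      = 0ℝ   -- arbitrary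
log₂ n@(suc _) = mkℝ (log₂-seq n) (log₂-cauchy n)

-- These two facts say that log₂ n is the real logarithm: its position relative
-- to every rational a / b is that of nᵇ relative to 2ᵃ.
log₂-lower : ∀ n .{{_ : ℕ.NonZero n}} a b → 2 ℕ.^ a ℕ.≤ n ℕ.^ suc b → fromℚ (+ a ℚ./ suc b) ≤ℝ log₂ n
log₂-lower n@(suc _) a b h ε 0<ε with 1/suc≤ε ε 0<ε
... | N , small = N , λ m N≤m → ℚ.≤-trans (below-log₂ n a b h m) (ℚ.+-monoʳ-≤ (log₂-seq n m) (small m N≤m))

log₂-upper : ∀ n .{{_ : ℕ.NonZero n}} a b → n ℕ.^ suc b ℕ.≤ 2 ℕ.^ a → log₂ n ≤ℝ fromℚ (+ a ℚ./ suc b)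
log₂-upper n@(suc _) a b h ε 0<ε = 0 , λ m _ → ℚ.≤-trans
  (frac-mono (L m) a m b (cross n (suc m) (suc b) (L m) a (2^⌊log₂n^m⌋≤n^m n (suc m)) h))
  (subst (ℚ._≤ + a ℚ./ suc b ℚ.+ ε) (ℚ.+-identityʳ (+ a ℚ./ suc b)) (ℚ.+-monoʳ-≤ (+ a ℚ./ suc b) (ℚ.<⇒≤ 0<ε)))
  where
  L : ℕ → ℕ
  L m = ⌊log₂ (n ℕ.^ suc m) ⌋

------------------------------------------------------------------------
-- Families of subsets of X = Fin n

IsMaximum : {A : Set} → Rel A 0ℓ → Pred A 0ℓ → A → Set
IsMaximum _≤_ P m = P m × (∀ a → P a → a ≤ m)

Family : ℕ → Set₁
Family n = Pred (Subset n) 0ℓ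

Increasing : ∀ {n} → Family n → Set
Increasing F = ∀ {A B} → A ⊆ B → F A → F B

ℋ : ∀ {n} → Family n → Family n
ℋ F A = F A × (∀ B → F B → B ⊆ A → B ≡ A)

-- ℓ = ℓ(F)
IsMaxMinimalSize : ∀ {n} → Family n → ℕ → Set
IsMaxMinimalSize F ℓ = IsMaximum ℕ._≤_ (λ m → ∃[ A ] (ℋ F A × ∣ A ∣ ≡ m)) ℓ

∑ : ∀ {n} → (Subset n → ℝ) → ℝ
∑ {zero}  f = f []
∑ {suc n} f = ∑ (λ S → f (outside ∷ S)) +ℝ ∑ (λ S → f (inside ∷ S))

∑-over : ∀ {n} {F : Family n} → Decidable F → (Subset n → ℝ) → ℝ
∑-over F? f = ∑ (λ S → if does (F? S) then f S else 0ℝ)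

IsProbability : ℝ → Set
IsProbability p = 0ℝ ≤ℝ p × p ≤ℝ 1ℝ

WeaklySmall : ∀ {n} → Family n → ℝ → Set
WeaklySmall {n} F p = ∃[ g ]
  ( (∀ S → 0ℝ ≤ℝ g S)
  × (∀ T → F T → 1ℝ ≤ℝ ∑-over (_⊆? T) g)
  × ∑ {n} (λ S → g S *ℝ p ^ℝ ∣ S ∣) ≤ℝ ½ℝ )

-- q = q_f(F)
IsFracExpectationThreshold : ∀ {n} → Family n → ℝ → Set
IsFracExpectationThreshold F q = IsMaximum _≤ℝ_ (λ p → IsProbability p × WeaklySmall F p) q

------------------------------------------------------------------------
-- Coloured sets: a subset of X′ = X × [k] is a Subset (n * k), where combine
-- identifies Fin n × Fin k with Fin (n * k)

module _ {n k : ℕ} where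

  infix 4 _∈′_ _∈′?_

  _∈′_ : Fin n × Fin k → Subset (n ℕ.* k) → Set
  (x , i) ∈′ S = combine x i ∈ S

  _∈′?_ : ∀ c S → Dec (c ∈′ S)
  (x , i) ∈′? S = combine x i ∈? S

  DistinctElements : Pred (Subset (n ℕ.* k)) 0ℓ
  DistinctElements S = ∀ x i j → (x , i) ∈′ S → (x , j) ∈′ S → i ≡ j

  DistinctColours : Pred (Subset (n ℕ.* k)) 0ℓ
  DistinctColours S = ∀ i x y → (x , i) ∈′ S → (y , i) ∈′ S → x ≡ y

  -- {x₁ , … , xₜ} for S = {(x₁ , i₁) , … , (xₜ , iₜ)}
  elements : Subset (n ℕ.* k) → Subset n
  elements S = tabulate (λ x → does (Fin.any? (λ i → (x , i) ∈′? S)))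

  distinctElements? : Decidable DistinctElements
  distinctElements? S = Fin.all? λ x → Fin.all? λ i → Fin.all? λ j →
    ((x , i) ∈′? S) →-dec (((x , j) ∈′? S) →-dec (i Fin.≟ j))

  distinctColours? : Decidable DistinctColours
  distinctColours? S = Fin.all? λ i → Fin.all? λ x → Fin.all? λ y →
    ((x , i) ∈′? S) →-dec (((y , i) ∈′? S) →-dec (x Fin.≟ y))

μ : ∀ {n} k .{{_ : ℕ.NonZero k}} → ℝ → Subset (n ℕ.* k) → ℝ
μ {n} k p S =
  if does (distinctElements? {n} {k} S)
  then (p /ℝ k) ^ℝ ∣ S ∣ *ℝ (1ℝ -ℝ p) ^ℝ (n ℕ.∸ ∣ S ∣)
  else 0ℝ

μ-family : ∀ {n} k .{{_ : ℕ.NonZero k}} → ℝ → {F′ : Family (n ℕ.* k)} → Decidable F′ → ℝ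
μ-family {n} k p F′? = ∑-over F′? (μ {n} k p)

RainbowEdge : ∀ {n} k → Family n → Family (n ℕ.* k)
RainbowEdge {n} k F E =
  DistinctElements {n} {k} E × ℋ F (elements {n} {k} E) × DistinctColours {n} {k} E

-- ℱ^rb
Rainbow : ∀ {n} k → Family n → Family (n ℕ.* k)
Rainbow k F S = ∃[ E ] (RainbowEdge k F E × E ⊆ S)

allSubsets? : ∀ {n} {P : Family n} → Decidable P → Dec (∀ S → P S)
allSubsets? P? = map′
  (λ ¬∃ S → decidable-stable (P? S) (λ ¬p → ¬∃ (S , ¬p)))
  (λ ∀P (S , ¬p) → ¬p (∀P S))
  (¬? (anySubset? (λ S → ¬? (P? S))))

ℋ? : ∀ {n} {F : Family n} → Decidable F → Decidable (ℋ F)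
ℋ? F? A = F? A ×-dec allSubsets? (λ B → F? B →-dec ((B ⊆? A) →-dec ≡-dec _≟ᵇ_ B A))

rainbow? : ∀ {n} k {F : Family n} → Decidable F → Decidable (Rainbow k F)
rainbow? {n} k F? S = anySubset? λ E →
  (distinctElements? {n} {k} E ×-dec (ℋ? F? (elements {n} {k} E) ×-dec distinctColours? {n} {k} E))
  ×-dec (E ⊆? S)

-- p = p_c^k(F)
IsRainbowThreshold : ∀ {n} k .{{_ : ℕ.NonZero k}} {F : Family n} → Decidable F → ℝ → Set
IsRainbowThreshold {n} k F? p = IsProbability p × μ-family {n} k p (rainbow? k F?) ≃ℝ ½ℝ

{-# OPTIONS --safe #-}
module Submission where

-- Upper bound.  Sampling every point of X × [k] independently with probability p/k makes ℱ^rb less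
-- likely than μ_p^k does, by a union bound in each row {x} × [k].  For the product measure we follow
-- Park and Pham: expose the random set in 1 + ⌊log₂ ℓ⌋ rounds; given the set W of a round, put the
-- minimal fragments S ∖ W of at least half the current size bound into a cover and go on with the
-- smaller ones.  Such a fragment T is determined by W ∪ T up to 2^ℓ choices, because it lies in any
-- prescribed edge contained in W ∪ T, so the expected cost of a round is small.  The cover, averaged
-- over the event that no edge appears, is a fractional cover of the rainbow edges.  Averaging it once
-- more over the injective colourings of a set T, whose s-point restrictions have probability
-- (k - s)!/k! ≤ (4/k)^s, turns it into a fractional cover of ℱ.
--
-- Lower bound.  A fractional cover bounds μ_p^k(ℱ^rb) by its cost at p, which is less than 1/2
-- by a definite amount as soon as p < q.
--
-- Real numbers enter only through the terms of their sequences: all operations are defined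
-- termwise, so every estimate is an estimate between rationals.

open import Defs
open import Level using (0ℓ)
open import Data.Bool.Base using (true; false; if_then_else_)
open import Data.Bool.Properties using () renaming (_≟_ to _≟ᵇ_)
import Data.Empty as Empty
open import Data.Fin.Base using (Fin; zero; suc; _↑ˡ_; _↑ʳ_)
import Data.Fin.Properties as Fin
open import Data.Fin.Subset using (Subset; inside; outside; _∈_; _⊆_; ∣_∣; ⊥; ⁅_⁆; _∪_; _∩_; _─_)
import Data.Fin.Subset.Properties as Sub
open Sub using (_⊆?_; _∈?_; anySubset?; drop-∷-⊆; out⊆; in⊆in)
open import Data.Integer.Base as ℤ using ()
import Data.Integer.Properties as ℤ
open import Data.List.Base using (List; []; _∷_; length; allFin)
import Data.List.Properties as List
open import Data.List.Membership.Propositional using () renaming (_∈_ to _∈ˡ_)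
open import Data.List.Relation.Binary.Permutation.Propositional using (_↭_; ↭-sym; ↭-refl; ↭-prep; ↭-swap; ↭-trans; ↭⇒↭ₛ)
open import Data.List.Relation.Binary.Permutation.Propositional.Properties using (∈-resp-↭; ↭-length)
import Data.List.Relation.Binary.Permutation.Setoid.Properties as Permutation
open import Data.List.Relation.Unary.All using () renaming (lookup to All-lookup)
open import Data.List.Relation.Unary.AllPairs using ([]; _∷_)
open import Data.List.Relation.Unary.Any using (here; there)
open import Data.List.Relation.Unary.Unique.Propositional using (Unique)
open import Data.List.Relation.Unary.Unique.Propositional.Properties using (allFin⁺)
open import Data.Nat.Base as ℕ using (ℕ; zero; suc; NonZero; _≤_)
open import Data.Nat.Induction using (<-wellFounded)
open import Data.Nat.Logarithm using (⌊log₂_⌋; ⌊log₂⌋-mono-≤)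
import Data.Nat.Properties as ℕ
open import Data.Product.Base using (Σ-syntax; ∃-syntax; _×_; _,_; proj₁; proj₂)
open import Data.Rational.Base as ℚ using (ℚ; 0ℚ; 1ℚ; ½; _+_; _*_; _-_; -_) renaming (_≤_ to _≤ᵠ_; _<_ to _<ᵠ_)
import Data.Rational.Properties as ℚ
open import Data.Rational.Solver using (module +-*-Solver)
open import Data.Rational.Unnormalised.Base as ℚᵘ using (mkℚᵘ)
open import Data.Sum.Base using (inj₁; inj₂; [_,_]′)
open import Data.Vec.Base as Vec using ([]; _∷_; _++_)
open import Data.Vec.Properties using (≡-dec; lookup-++ˡ; lookup-++ʳ; []=⇒lookup; lookup⇒[]=; tabulate-cong; lookup∘tabulate)
open import Function.Base using (_∘_; id)
open import Function.Bundles using (mk⇔)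
open import Induction.WellFounded using (Acc; acc)
open import Relation.Binary.PropositionalEquality using (_≡_; _≢_; refl; sym; trans; cong; cong₂; subst; subst₂; setoid; module ≡-Reasoning)
open import Relation.Nullary using (Dec; yes; no; ¬_; does; contradiction)
open import Relation.Nullary.Decidable using (_×-dec_; ¬?; decidable-stable; does-⇔; dec-true; dec-false)
open import Relation.Unary using (Pred; Decidable)
open +-*-Solver using (solve; con; _:=_; _:+_; _:*_; _:-_; :-_)

-- The rounds need a law under which the points of X × [k] are independent, since adding T to W must
-- cost one factor of the density per point. Under μ_p^k the points of a row exclude each other,
-- hence the comparison with the product law.
--
-- The obstacle is the number of colours. A cover of the rainbow edges is cheap at density of order
-- p/(k m) for m rounds, while the cover of ℱ must be cheap at order p/m, with no k left. A set S
-- has k^|S| coloured copies, and the factor (4/k)^s of the random colouring takes back exactly this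
-- number.
--
-- The constant is 2^9. A round uses 2^6 per point: with fragments of at least s points, the
-- exponent 6 s pays 2 s for the subsets of an edge and 4 s for a cost that is summable over the
-- rounds. The colouring uses 2^2, and the last 2 comes from 1 + t ≤ 2 t for t = ⌊log₂ ℓ⌋. The cover
-- of the rainbow edges costs at most 1/8 and reaches the failure probability, at least 1/4;
-- normalising by 4 gives the cost 1/2.

infixr 8 _^_

_^_ : ℚ → ℕ → ℚ
x ^ zero  = 1ℚ
x ^ suc n = x * x ^ n

≤-respˡ : ∀ {a b c} → a ≡ b → b ≤ᵠ c → a ≤ᵠ c
≤-respˡ refl h = h

≤-respʳ : ∀ {a b c} → b ≤ᵠ c → c ≡ a → b ≤ᵠ a
≤-respʳ h refl = h

*-monoʳ-≤ : ∀ {c a b} → 0ℚ ≤ᵠ c → a ≤ᵠ b → c * a ≤ᵠ c * b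
*-monoʳ-≤ {c} 0≤c = ℚ.*-monoˡ-≤-nonNeg c {{ℚ.nonNegative 0≤c}}

*-monoˡ-≤ : ∀ {c a b} → 0ℚ ≤ᵠ c → a ≤ᵠ b → a * c ≤ᵠ b * c
*-monoˡ-≤ {c} 0≤c = ℚ.*-monoʳ-≤-nonNeg c {{ℚ.nonNegative 0≤c}}

*-mono-≤ : ∀ {a b c d} → 0ℚ ≤ᵠ a → 0ℚ ≤ᵠ d → a ≤ᵠ b → c ≤ᵠ d → a * c ≤ᵠ b * d
*-mono-≤ 0≤a 0≤d a≤b c≤d = ℚ.≤-trans (*-monoʳ-≤ 0≤a c≤d) (*-monoˡ-≤ 0≤d a≤b)

*-nonneg : ∀ {a b} → 0ℚ ≤ᵠ a → 0ℚ ≤ᵠ b → 0ℚ ≤ᵠ a * b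
*-nonneg {a} 0≤a 0≤b = ≤-respˡ (sym (ℚ.*-zeroʳ a)) (*-monoʳ-≤ 0≤a 0≤b)

+-nonneg : ∀ {a b} → 0ℚ ≤ᵠ a → 0ℚ ≤ᵠ b → 0ℚ ≤ᵠ a + b
+-nonneg 0≤a 0≤b = ℚ.+-mono-≤ 0≤a 0≤b

0≤1 : 0ℚ ≤ᵠ 1ℚ
0≤1 = ℚ.nonNegative⁻¹ 1ℚ

0≤½ : 0ℚ ≤ᵠ ½
0≤½ = ℚ.nonNegative⁻¹ ½

½≤1 : ½ ≤ᵠ 1ℚ
½≤1 = ℚ.≤ᵇ⇒≤ _

p≤p+q : ∀ {p q} → 0ℚ ≤ᵠ q → p ≤ᵠ p + q
p≤p+q {p} 0≤q = ≤-respˡ (sym (ℚ.+-identityʳ p)) (ℚ.+-monoʳ-≤ p 0≤q)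

q≤p+q : ∀ {p q} → 0ℚ ≤ᵠ p → q ≤ᵠ p + q
q≤p+q {_} {q} 0≤p = ≤-respˡ (sym (ℚ.+-identityˡ q)) (ℚ.+-monoˡ-≤ q 0≤p)

≤⇒0≤- : ∀ {a b} → a ≤ᵠ b → 0ℚ ≤ᵠ b - a
≤⇒0≤- {a} {b} a≤b = ≤-respˡ (sym (ℚ.+-inverseʳ a)) (ℚ.+-monoˡ-≤ (- a) a≤b)

0≤-⇒≤ : ∀ {a b} → 0ℚ ≤ᵠ b - a → a ≤ᵠ b
0≤-⇒≤ {a} {b} h = ≤-respʳ (q≤p+q h) (solve 2 (λ a b → b :- a :+ a := b) refl a b)

p*q≤q : ∀ {p q} → p ≤ᵠ 1ℚ → 0ℚ ≤ᵠ q → p * q ≤ᵠ q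
p*q≤q {p} {q} p≤1 0≤q = ≤-respʳ (*-monoˡ-≤ 0≤q p≤1) (ℚ.*-identityˡ q)

^-nonneg : ∀ {x} n → 0ℚ ≤ᵠ x → 0ℚ ≤ᵠ x ^ n
^-nonneg zero    0≤x = 0≤1
^-nonneg (suc n) 0≤x = *-nonneg 0≤x (^-nonneg n 0≤x)

^-monoˡ-≤ : ∀ {x y} n → 0ℚ ≤ᵠ x → x ≤ᵠ y → x ^ n ≤ᵠ y ^ n
^-monoˡ-≤ zero    0≤x x≤y = ℚ.≤-refl
^-monoˡ-≤ (suc n) 0≤x x≤y =
  *-mono-≤ 0≤x (^-nonneg n (ℚ.≤-trans 0≤x x≤y)) x≤y (^-monoˡ-≤ n 0≤x x≤y)

^-≤1 : ∀ {x} n → 0ℚ ≤ᵠ x → x ≤ᵠ 1ℚ → x ^ n ≤ᵠ 1ℚ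
^-≤1 zero    0≤x x≤1 = ℚ.≤-refl
^-≤1 (suc n) 0≤x x≤1 = ℚ.≤-trans (p*q≤q x≤1 (^-nonneg n 0≤x)) (^-≤1 n 0≤x x≤1)

^-antitone : ∀ {x m n} → 0ℚ ≤ᵠ x → x ≤ᵠ 1ℚ → m ≤ n → x ^ n ≤ᵠ x ^ m
^-antitone {n = n} 0≤x x≤1 ℕ.z≤n       = ^-≤1 n 0≤x x≤1
^-antitone         0≤x x≤1 (ℕ.s≤s m≤n) = *-monoʳ-≤ 0≤x (^-antitone 0≤x x≤1 m≤n)

^-distribˡ-+ : ∀ x m n → x ^ (m ℕ.+ n) ≡ x ^ m * x ^ n
^-distribˡ-+ x zero    n = sym (ℚ.*-identityˡ _)
^-distribˡ-+ x (suc m) n = trans (cong (x *_) (^-distribˡ-+ x m n)) (sym (ℚ.*-assoc x _ _))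

^-distribʳ-* : ∀ x y n → (x * y) ^ n ≡ x ^ n * y ^ n
^-distribʳ-* x y zero    = refl
^-distribʳ-* x y (suc n) = trans (cong (x * y *_) (^-distribʳ-* x y n))
  (solve 4 (λ x y a b → x :* y :* (a :* b) := x :* a :* (y :* b)) refl x y (x ^ n) (y ^ n))

^-*-assoc : ∀ x m n → (x ^ m) ^ n ≡ x ^ (m ℕ.* n)
^-*-assoc x m zero    = cong (x ^_) (sym (ℕ.*-zeroʳ m))
^-*-assoc x m (suc n) = trans (cong (x ^ m *_) (^-*-assoc x m n))
  (trans (sym (^-distribˡ-+ x m (m ℕ.* n))) (cong (x ^_) (sym (ℕ.*-suc m n))))

-- Indicators of decidable statements

module _ {P : Set} where

  ⟦_⟧ : Dec P → ℚ
  ⟦ P? ⟧ = if does P? then 1ℚ else 0ℚ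

  ⟦⟧-yes : ∀ (P? : Dec P) → P → ⟦ P? ⟧ ≡ 1ℚ
  ⟦⟧-yes (yes _) _ = refl
  ⟦⟧-yes (no ¬p) p = contradiction p ¬p

  ⟦⟧-no : ∀ (P? : Dec P) → ¬ P → ⟦ P? ⟧ ≡ 0ℚ
  ⟦⟧-no (yes p) ¬p = contradiction p ¬p
  ⟦⟧-no (no _)  _  = refl

  ⟦⟧-nonneg : ∀ (P? : Dec P) → 0ℚ ≤ᵠ ⟦ P? ⟧
  ⟦⟧-nonneg (yes _) = 0≤1
  ⟦⟧-nonneg (no _)  = ℚ.≤-refl

  ⟦⟧≤1 : ∀ (P? : Dec P) → ⟦ P? ⟧ ≤ᵠ 1ℚ
  ⟦⟧≤1 (yes _) = ℚ.≤-refl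
  ⟦⟧≤1 (no _)  = 0≤1

  ⟦⟧-≤ : ∀ (P? : Dec P) {c} → 0ℚ ≤ᵠ c → (P → 1ℚ ≤ᵠ c) → ⟦ P? ⟧ ≤ᵠ c
  ⟦⟧-≤ (yes p) 0≤c h = h p
  ⟦⟧-≤ (no _)  0≤c h = 0≤c

  ⟦⟧*-≤ : ∀ (P? : Dec P) {x c} → 0ℚ ≤ᵠ c → (P → x ≤ᵠ c) → ⟦ P? ⟧ * x ≤ᵠ c
  ⟦⟧*-≤ (yes p) {x} 0≤c h = ≤-respˡ (ℚ.*-identityˡ x) (h p)
  ⟦⟧*-≤ (no _)  {x} 0≤c h = ≤-respˡ (ℚ.*-zeroˡ x) 0≤c

⟦⟧*-cong : ∀ {P : Set} (P? : Dec P) {x y} → (P → x ≡ y) → ⟦ P? ⟧ * x ≡ ⟦ P? ⟧ * y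
⟦⟧*-cong (yes p) h = cong (1ℚ *_) (h p)
⟦⟧*-cong (no _) {x} {y} h = trans (ℚ.*-zeroˡ x) (sym (ℚ.*-zeroˡ y))

⟦⟧-mono : ∀ {P Q : Set} (P? : Dec P) (Q? : Dec Q) → (P → Q) → ⟦ P? ⟧ ≤ᵠ ⟦ Q? ⟧
⟦⟧-mono P? Q? f = ⟦⟧-≤ P? (⟦⟧-nonneg Q?) (λ p → ℚ.≤-reflexive (sym (⟦⟧-yes Q? (f p))))

⟦⟧-cong : ∀ {P Q : Set} (P? : Dec P) (Q? : Dec Q) → (P → Q) → (Q → P) → ⟦ P? ⟧ ≡ ⟦ Q? ⟧
⟦⟧-cong P? Q? f g = ℚ.≤-antisym (⟦⟧-mono P? Q? f) (⟦⟧-mono Q? P? g)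

-- Positive linear functionals

-- Sums, expectations, products of row laws and averages over colourings are all functionals of this
-- kind, so exchanges of order and termwise estimates are proved once for all of them.
record IsPositive {Ω : Set} (Φ : (Ω → ℚ) → ℚ) : Set where
  field
    mono  : ∀ {f g} → (∀ ω → f ω ≤ᵠ g ω) → Φ f ≤ᵠ Φ g
    +-hom : ∀ f g → Φ (λ ω → f ω + g ω) ≡ Φ f + Φ g
    *-hom : ∀ c f → Φ (λ ω → c * f ω) ≡ c * Φ f

  ≗-cong : ∀ {f g} → (∀ ω → f ω ≡ g ω) → Φ f ≡ Φ g
  ≗-cong f≗g = ℚ.≤-antisym (mono λ ω → ℚ.≤-reflexive (f≗g ω)) (mono λ ω → ℚ.≤-reflexive (sym (f≗g ω)))

  zero-hom : Φ (λ _ → 0ℚ) ≡ 0ℚ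
  zero-hom = trans (≗-cong λ _ → sym (ℚ.*-zeroˡ 0ℚ)) (trans (*-hom 0ℚ (λ _ → 0ℚ)) (ℚ.*-zeroˡ (Φ λ _ → 0ℚ)))

  nonneg : ∀ {f} → (∀ ω → 0ℚ ≤ᵠ f ω) → 0ℚ ≤ᵠ Φ f
  nonneg 0≤f = ≤-respˡ (sym zero-hom) (mono 0≤f)

  *-homʳ : ∀ f c → Φ (λ ω → f ω * c) ≡ Φ f * c
  *-homʳ f c = trans (≗-cong λ ω → ℚ.*-comm (f ω) c) (trans (*-hom c f) (ℚ.*-comm c (Φ f)))

  const-hom : Φ (λ _ → 1ℚ) ≡ 1ℚ → ∀ c → Φ (λ _ → c) ≡ c
  const-hom one c = trans (≗-cong λ _ → sym (ℚ.*-identityʳ c))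
    (trans (*-hom c (λ _ → 1ℚ)) (trans (cong (c *_) one) (ℚ.*-identityʳ c)))

open IsPositive

private
  variable
    Ω Ω′ : Set

eval-positive : ∀ (ω : Ω) → IsPositive (λ f → f ω)
eval-positive ω = record { mono = λ h → h ω ; +-hom = λ _ _ → refl ; *-hom = λ _ _ → refl }

zero-positive : IsPositive {Ω} (λ _ → 0ℚ)
zero-positive = record
  { mono = λ _ → ℚ.≤-refl ; +-hom = λ _ _ → refl ; *-hom = λ c _ → sym (ℚ.*-zeroʳ c) }

+-positive : ∀ {Φ Ψ : (Ω → ℚ) → ℚ} → IsPositive Φ → IsPositive Ψ → IsPositive (λ f → Φ f + Ψ f)
+-positive {Φ = Φ} {Ψ} φ ψ = record
  { mono  = λ h → ℚ.+-mono-≤ (mono φ h) (mono ψ h)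
  ; +-hom = λ f g → trans (cong₂ _+_ (+-hom φ f g) (+-hom ψ f g))
      (solve 4 (λ a b c d → a :+ b :+ (c :+ d) := a :+ c :+ (b :+ d)) refl (Φ f) (Φ g) (Ψ f) (Ψ g))
  ; *-hom = λ c f → trans (cong₂ _+_ (*-hom φ c f) (*-hom ψ c f)) (sym (ℚ.*-distribˡ-+ c (Φ f) (Ψ f)))
  }

*-positive : ∀ {Φ : (Ω → ℚ) → ℚ} {c} → 0ℚ ≤ᵠ c → IsPositive Φ → IsPositive (λ f → c * Φ f)
*-positive {Φ = Φ} {c} 0≤c φ = record
  { mono  = λ h → *-monoʳ-≤ 0≤c (mono φ h)
  ; +-hom = λ f g → trans (cong (c *_) (+-hom φ f g)) (ℚ.*-distribˡ-+ c (Φ f) (Φ g))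
  ; *-hom = λ d f → trans (cong (c *_) (*-hom φ d f))
      (solve 3 (λ c d x → c :* (d :* x) := d :* (c :* x)) refl c d (Φ f))
  }

iterate-positive : ∀ {Φ : (Ω → ℚ) → ℚ} {Ψ : Ω → (Ω′ → ℚ) → ℚ} →
  IsPositive Φ → (∀ ω → IsPositive (Ψ ω)) → IsPositive (λ f → Φ (λ ω → Ψ ω f))
iterate-positive {Ψ = Ψ} φ ψ = record
  { mono  = λ h → mono φ (λ ω → mono (ψ ω) h)
  ; +-hom = λ f g → trans (≗-cong φ λ ω → +-hom (ψ ω) f g) (+-hom φ (λ ω → Ψ ω f) (λ ω → Ψ ω g))
  ; *-hom = λ c f → trans (≗-cong φ λ ω → *-hom (ψ ω) c f) (*-hom φ c (λ ω → Ψ ω f))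
  }

pullback-positive : ∀ {Φ : (Ω → ℚ) → ℚ} (h : Ω → Ω′) → IsPositive Φ → IsPositive (λ f → Φ (λ ω → f (h ω)))
pullback-positive h φ = iterate-positive φ (λ ω → eval-positive (h ω))

-- Weighted sums over colours and over subsets

opaque

  ∑ᶠ : ∀ {k} → (Fin k → ℚ) → ℚ
  ∑ᶠ {zero}  f = 0ℚ
  ∑ᶠ {suc k} f = f zero + ∑ᶠ (λ i → f (suc i))

  ∑ᶠ-zero : ∀ (f : Fin 0 → ℚ) → ∑ᶠ f ≡ 0ℚ
  ∑ᶠ-zero f = refl

  ∑ᶠ-suc : ∀ {k} (f : Fin (suc k) → ℚ) → ∑ᶠ f ≡ f zero + ∑ᶠ (λ i → f (suc i))
  ∑ᶠ-suc f = refl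

  ∑ᶠ-positive : ∀ {k} → IsPositive (∑ᶠ {k})
  ∑ᶠ-positive {zero}  = zero-positive
  ∑ᶠ-positive {suc k} = +-positive (eval-positive zero) (pullback-positive suc ∑ᶠ-positive)

  ∑ᶠ-swap : ∀ {k} {Φ : (Ω → ℚ) → ℚ} → IsPositive Φ → ∀ (F : Fin k → Ω → ℚ) →
    Φ (λ ω → ∑ᶠ (λ i → F i ω)) ≡ ∑ᶠ (λ i → Φ (F i))
  ∑ᶠ-swap {k = zero}  φ F = zero-hom φ
  ∑ᶠ-swap {k = suc k} {Φ} φ F = trans (+-hom φ (F zero) (λ ω → ∑ᶠ (λ i → F (suc i) ω)))
    (cong (Φ (F zero) +_) (∑ᶠ-swap φ (λ i → F (suc i))))

opaque

  -- ∑ʷ u v f is the sum of u^(n - |S|) v^|S| f(S) over the subsets S.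
  ∑ʷ : ∀ {n} → ℚ → ℚ → (Subset n → ℚ) → ℚ
  ∑ʷ {zero}  u v f = f []
  ∑ʷ {suc n} u v f = u * ∑ʷ u v (λ S → f (outside ∷ S)) + v * ∑ʷ u v (λ S → f (inside ∷ S))

  ∑ʷ-zero : ∀ {u v} (f : Subset 0 → ℚ) → ∑ʷ u v f ≡ f []
  ∑ʷ-zero f = refl

  ∑ʷ-suc : ∀ {n u v} (f : Subset (suc n) → ℚ) →
    ∑ʷ u v f ≡ u * ∑ʷ u v (λ S → f (outside ∷ S)) + v * ∑ʷ u v (λ S → f (inside ∷ S))
  ∑ʷ-suc f = refl

  ∑ʷ-positive : ∀ {n u v} → 0ℚ ≤ᵠ u → 0ℚ ≤ᵠ v → IsPositive (∑ʷ {n} u v)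
  ∑ʷ-positive {zero}  0≤u 0≤v = eval-positive []
  ∑ʷ-positive {suc n} 0≤u 0≤v = +-positive
    (*-positive 0≤u (pullback-positive (outside ∷_) (∑ʷ-positive 0≤u 0≤v)))
    (*-positive 0≤v (pullback-positive (inside ∷_) (∑ʷ-positive 0≤u 0≤v)))

  -- Fubini's theorem, by linearity of Φ along the recursion; Φ is later a sum, an expectation over
  -- W, a row law or an average over colourings.
  ∑ʷ-swap : ∀ {n u v} {Φ : (Ω → ℚ) → ℚ} → IsPositive Φ → ∀ (F : Subset n → Ω → ℚ) →
    Φ (λ ω → ∑ʷ u v (λ S → F S ω)) ≡ ∑ʷ u v (λ S → Φ (F S))
  ∑ʷ-swap {n = zero}  φ F = refl
  ∑ʷ-swap {n = suc n} {u} {v} {Φ} φ F = trans (+-hom φ _ _) (cong₂ _+_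
    (trans (*-hom φ u _) (cong (u *_) (∑ʷ-swap φ (λ S → F (outside ∷ S)))))
    (trans (*-hom φ v _) (cong (v *_) (∑ʷ-swap φ (λ S → F (inside ∷ S))))))

  ∑ʷ-++ : ∀ m {n u v} (f : Subset (m ℕ.+ n) → ℚ) →
    ∑ʷ u v f ≡ ∑ʷ {m} u v (λ b → ∑ʷ {n} u v (λ r → f (b ++ r)))
  ∑ʷ-++ zero    f = refl
  ∑ʷ-++ (suc m) {u = u} {v} f = cong₂ _+_ (cong (u *_) (∑ʷ-++ m (λ S → f (outside ∷ S))))
                                          (cong (v *_) (∑ʷ-++ m (λ S → f (inside ∷ S))))

∑ᵠ : ∀ {n} → (Subset n → ℚ) → ℚ
∑ᵠ = ∑ʷ 1ℚ 1ℚ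

-- Expectation over a random subset containing each point independently with probability a.
𝔼 : ∀ {n} → ℚ → (Subset n → ℚ) → ℚ
𝔼 a = ∑ʷ (1ℚ - a) a

∑ᵠ-positive : ∀ {n} → IsPositive (∑ᵠ {n})
∑ᵠ-positive = ∑ʷ-positive 0≤1 0≤1

𝔼-positive : ∀ {n a} → 0ℚ ≤ᵠ a → a ≤ᵠ 1ℚ → IsPositive (𝔼 {n} a)
𝔼-positive 0≤a a≤1 = ∑ʷ-positive (≤⇒0≤- a≤1) 0≤a

𝔼-one : ∀ {n} a → 𝔼 {n} a (λ _ → 1ℚ) ≡ 1ℚ
𝔼-one {zero}  a = ∑ʷ-zero _
𝔼-one {suc n} a = trans (∑ʷ-suc _) (trans (cong (λ x → (1ℚ - a) * x + a * x) (𝔼-one {n} a))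
  (solve 1 (λ a → (con 1ℚ :- a) :* con 1ℚ :+ a :* con 1ℚ := con 1ℚ) refl a))

𝔼-const : ∀ {n a} → 0ℚ ≤ᵠ a → a ≤ᵠ 1ℚ → ∀ c → 𝔼 {n} a (λ _ → c) ≡ c
𝔼-const {n} {a} 0≤a a≤1 = const-hom (𝔼-positive {n} 0≤a a≤1) (𝔼-one {n} a)

-- Minimal members and sums over subsets

minimal-below : ∀ {n} {F : Family n} → Decidable F → ∀ A → F A → ∃[ B ] (ℋ F B × B ⊆ A)
minimal-below {n} {F} F? A = go A (<-wellFounded ∣ A ∣)
  where
  go : ∀ A → Acc ℕ._<_ ∣ A ∣ → F A → ∃[ B ] (ℋ F B × B ⊆ A)
  go A (acc rec) FA with anySubset? (λ B → F? B ×-dec (B Sub.⊂? A))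
  ... | yes (B , FB , B⊂A) =
    let C , minC , C⊆B = go B (rec (Sub.p⊂q⇒∣p∣<∣q∣ B⊂A)) FB
    in C , minC , λ x∈C → proj₁ B⊂A (C⊆B x∈C)
  ... | no ∄B = A , (FA , minimal) , id
    where
    minimal : ∀ B → F B → B ⊆ A → B ≡ A
    minimal B FB B⊆A = Sub.⊆-antisym B⊆A λ {x} x∈A →
      decidable-stable (x ∈? B) λ x∉B → ∄B (B , FB , B⊆A , x , x∈A , x∉B)

∑ᵠ-suc : ∀ {n} (f : Subset (suc n) → ℚ) → ∑ᵠ f ≡ ∑ᵠ (λ S → f (outside ∷ S)) + ∑ᵠ (λ S → f (inside ∷ S))
∑ᵠ-suc f = trans (∑ʷ-suc f)
  (cong₂ _+_ (ℚ.*-identityˡ (∑ᵠ (λ S → f (outside ∷ S)))) (ℚ.*-identityˡ (∑ᵠ (λ S → f (inside ∷ S)))))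

term≤∑ᵠ : ∀ {n} (f : Subset n → ℚ) → (∀ S → 0ℚ ≤ᵠ f S) → ∀ T → f T ≤ᵠ ∑ᵠ f
term≤∑ᵠ f 0≤f []            = ℚ.≤-reflexive (sym (∑ʷ-zero f))
term≤∑ᵠ f 0≤f (outside ∷ T) = ≤-respʳ
  (ℚ.≤-trans (term≤∑ᵠ (λ S → f (outside ∷ S)) (λ S → 0≤f _) T) (p≤p+q (nonneg ∑ᵠ-positive λ S → 0≤f _)))
  (sym (∑ᵠ-suc f))
term≤∑ᵠ f 0≤f (inside ∷ T)  = ≤-respʳ
  (ℚ.≤-trans (term≤∑ᵠ (λ S → f (inside ∷ S)) (λ S → 0≤f _) T) (q≤p+q (nonneg ∑ᵠ-positive λ S → 0≤f _)))
  (sym (∑ᵠ-suc f))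

-- A set A has 2^|A| subsets. Writing the count with powers of ½ lets it combine with the weights of
-- the fragments.
∑-⊆-½ : ∀ {n} (A : Subset n) → ∑ᵠ (λ T → ⟦ T ⊆? A ⟧ * ½ ^ ∣ A ∣) ≤ᵠ 1ℚ
∑-⊆-½ []            = ℚ.≤-reflexive (∑ʷ-zero _)
∑-⊆-½ {suc n} (outside ∷ A) = begin
  ∑ᵠ (λ T → ⟦ T ⊆? (outside ∷ A) ⟧ * ½ ^ ∣ A ∣)
    ≡⟨ ∑ᵠ-suc _ ⟩
  ∑ᵠ (λ T → ⟦ (outside ∷ T) ⊆? (outside ∷ A) ⟧ * ½ ^ ∣ A ∣) + ∑ᵠ (λ T → ⟦ (inside ∷ T) ⊆? (outside ∷ A) ⟧ * ½ ^ ∣ A ∣)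
    ≤⟨ ℚ.+-mono-≤ (mono ∑ᵠ-positive λ T → *-monoˡ-≤ ½^-nonneg (⟦⟧-mono (outside ∷ T ⊆? outside ∷ A) (T ⊆? A) drop-∷-⊆))
                  (mono ∑ᵠ-positive λ T → ℚ.≤-reflexive (trans (cong (_* ½ ^ ∣ A ∣) (⟦⟧-no (inside ∷ T ⊆? outside ∷ A) (λ h → contradiction (h Vec.here) λ ()))) (ℚ.*-zeroˡ (½ ^ ∣ A ∣)))) ⟩
  ∑ᵠ (λ T → ⟦ T ⊆? A ⟧ * ½ ^ ∣ A ∣) + ∑ᵠ {n} (λ T → 0ℚ)
    ≡⟨ cong (∑ᵠ (λ T → ⟦ T ⊆? A ⟧ * ½ ^ ∣ A ∣) +_) (zero-hom (∑ᵠ-positive {n})) ⟩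
  ∑ᵠ (λ T → ⟦ T ⊆? A ⟧ * ½ ^ ∣ A ∣) + 0ℚ
    ≡⟨ ℚ.+-identityʳ _ ⟩
  ∑ᵠ (λ T → ⟦ T ⊆? A ⟧ * ½ ^ ∣ A ∣)
    ≤⟨ ∑-⊆-½ A ⟩
  1ℚ ∎
  where
  open ℚ.≤-Reasoning
  ½^-nonneg = ^-nonneg ∣ A ∣ 0≤½
∑-⊆-½ {suc n} (inside ∷ A) = begin
  ∑ᵠ (λ T → ⟦ T ⊆? (inside ∷ A) ⟧ * (½ * ½ ^ ∣ A ∣))
    ≡⟨ ∑ᵠ-suc _ ⟩
  ∑ᵠ (λ T → ⟦ (outside ∷ T) ⊆? (inside ∷ A) ⟧ * (½ * ½ ^ ∣ A ∣)) + ∑ᵠ (λ T → ⟦ (inside ∷ T) ⊆? (inside ∷ A) ⟧ * (½ * ½ ^ ∣ A ∣))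
    ≤⟨ ℚ.+-mono-≤ (mono ∑ᵠ-positive λ T → *-monoˡ-≤ ½^-nonneg (⟦⟧-mono (outside ∷ T ⊆? inside ∷ A) (T ⊆? A) drop-∷-⊆))
                  (mono ∑ᵠ-positive λ T → *-monoˡ-≤ ½^-nonneg (⟦⟧-mono (inside ∷ T ⊆? inside ∷ A) (T ⊆? A) drop-∷-⊆)) ⟩
  ∑ᵠ (λ T → ⟦ T ⊆? A ⟧ * (½ * ½ ^ ∣ A ∣)) + ∑ᵠ (λ T → ⟦ T ⊆? A ⟧ * (½ * ½ ^ ∣ A ∣))
    ≡⟨ cong (λ x → x + x) (trans (≗-cong ∑ᵠ-positive λ T → *-swap ⟦ T ⊆? A ⟧ ½ (½ ^ ∣ A ∣)) (*-hom ∑ᵠ-positive ½ _)) ⟩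
  ½ * ∑ᵠ (λ T → ⟦ T ⊆? A ⟧ * ½ ^ ∣ A ∣) + ½ * ∑ᵠ (λ T → ⟦ T ⊆? A ⟧ * ½ ^ ∣ A ∣)
    ≡⟨ half+half _ ⟩
  ∑ᵠ (λ T → ⟦ T ⊆? A ⟧ * ½ ^ ∣ A ∣)
    ≤⟨ ∑-⊆-½ A ⟩
  1ℚ ∎
  where
  open ℚ.≤-Reasoning
  ½^-nonneg = *-nonneg 0≤½ (^-nonneg ∣ A ∣ 0≤½)
  *-swap : ∀ x y z → x * (y * z) ≡ y * (x * z)
  *-swap = solve 3 (λ x y z → x :* (y :* z) := y :* (x :* z)) refl

-- Indicator of disjointness with rational values, by recursion so that it splits off one point at a
-- time in `𝔼-union-shift`.
disjoint : ∀ {n} → Subset n → Subset n → ℚ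
disjoint []           []           = 1ℚ
disjoint (inside ∷ W) (inside ∷ T) = 0ℚ
disjoint (_ ∷ W)      (_ ∷ T)      = disjoint W T

disjoint-≡1 : ∀ {n} (W T : Subset n) → T ─ W ≡ T → disjoint W T ≡ 1ℚ
disjoint-≡1 []            []            eq = refl
disjoint-≡1 (outside ∷ W) (outside ∷ T) eq = disjoint-≡1 W T (cong Vec.tail eq)
disjoint-≡1 (outside ∷ W) (inside ∷ T)  eq = disjoint-≡1 W T (cong Vec.tail eq)
disjoint-≡1 (inside ∷ W)  (outside ∷ T) eq = disjoint-≡1 W T (cong Vec.tail eq)
disjoint-≡1 (inside ∷ W)  (inside ∷ T)  ()

disjoint-nonneg : ∀ {n} (W T : Subset n) → 0ℚ ≤ᵠ disjoint W T
disjoint-nonneg []            []            = 0≤1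
disjoint-nonneg (outside ∷ W) (outside ∷ T) = disjoint-nonneg W T
disjoint-nonneg (outside ∷ W) (inside ∷ T)  = disjoint-nonneg W T
disjoint-nonneg (inside ∷ W)  (outside ∷ T) = disjoint-nonneg W T
disjoint-nonneg (inside ∷ W)  (inside ∷ T)  = ℚ.≤-refl

module _ {a : ℚ} (0≤a : 0ℚ ≤ᵠ a) (a≤1 : a ≤ᵠ 1ℚ) where

  private
    𝔼∑ : ∀ {n} → (Subset n → Subset n → ℚ) → ℚ
    𝔼∑ F = 𝔼 a (λ W → ∑ᵠ (F W))

    𝔼∑-suc : ∀ {n} (F : Subset (suc n) → Subset (suc n) → ℚ) → 𝔼∑ F ≡
      (1ℚ - a) * (𝔼∑ (λ W T → F (outside ∷ W) (outside ∷ T)) + 𝔼∑ (λ W T → F (outside ∷ W) (inside ∷ T))) +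
      a * (𝔼∑ (λ W T → F (inside ∷ W) (outside ∷ T)) + 𝔼∑ (λ W T → F (inside ∷ W) (inside ∷ T)))
    𝔼∑-suc F = trans (∑ʷ-suc _) (cong₂ (λ x y → (1ℚ - a) * x + a * y) (split outside) (split inside))
      where
      split : ∀ s → 𝔼 a (λ W → ∑ᵠ (F (s ∷ W))) ≡ 𝔼∑ (λ W T → F (s ∷ W) (outside ∷ T)) + 𝔼∑ (λ W T → F (s ∷ W) (inside ∷ T))
      split s = trans (≗-cong (𝔼-positive 0≤a a≤1) λ W → ∑ᵠ-suc (F (s ∷ W))) (+-hom (𝔼-positive 0≤a a≤1) _ _)

    𝔼∑-zero : ∀ {n} (F : Subset n → Subset n → ℚ) → (∀ W T → F W T ≡ 0ℚ) → 𝔼∑ F ≡ 0ℚ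
    𝔼∑-zero {n} F F≡0 = trans (≗-cong (𝔼-positive 0≤a a≤1) λ W →
      trans (≗-cong ∑ᵠ-positive (F≡0 W)) (zero-hom (∑ᵠ-positive {n}))) (zero-hom (𝔼-positive {n} 0≤a a≤1))

  -- A point set T disjoint from W costs a factor a per point when W is enlarged to W ∪ T.
  𝔼-union-shift : ∀ {n} (h : Subset n → Subset n → ℚ) → (∀ Z T → 0ℚ ≤ᵠ h Z T) →
    𝔼 a (λ W → ∑ᵠ (λ T → disjoint W T * a ^ ∣ T ∣ * h (T ∪ W) T)) ≤ᵠ 𝔼 a (λ Z → ∑ᵠ (h Z))
  𝔼-union-shift {zero} h 0≤h = ℚ.≤-reflexive
    (trans (trans (∑ʷ-zero _) (∑ʷ-zero _)) (trans (ℚ.*-identityˡ (h [] [])) (sym (trans (∑ʷ-zero _) (∑ʷ-zero _)))))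
  𝔼-union-shift {suc n} h 0≤h = begin
    𝔼∑ F
      ≡⟨ 𝔼∑-suc F ⟩
    (1ℚ - a) * (𝔼∑ F₀₀ + 𝔼∑ F₀₁) + a * (𝔼∑ F₁₀ + 𝔼∑ F₁₁)
      -- Of the four cases for the first point, `F₁₁` vanishes by disjointness, and `F₀₁` turns into
      -- `h₁₁` because T ∪ W contains the point; its weight (1 - a) a is at most the weight a of
      -- `h₁₁`.
      ≤⟨ ℚ.+-mono-≤ (*-monoʳ-≤ 0≤1-a (ℚ.+-mono-≤ (𝔼-union-shift h₀₀ λ Z T → 0≤h _ _) F₀₁≤))
                    (*-monoʳ-≤ 0≤a (ℚ.+-mono-≤ (𝔼-union-shift h₁₀ λ Z T → 0≤h _ _) (ℚ.≤-reflexive F₁₁≡0))) ⟩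
    (1ℚ - a) * (𝔼∑ h₀₀ + a * 𝔼∑ h₁₁) + a * (𝔼∑ h₁₀ + 0ℚ)
      ≤⟨ p≤p+q (+-nonneg (*-nonneg 0≤1-a (𝔼∑-nonneg h₀₁ λ Z T → 0≤h _ _)) (*-nonneg (*-nonneg 0≤a 0≤a) (𝔼∑-nonneg h₁₁ λ Z T → 0≤h _ _))) ⟩
    (1ℚ - a) * (𝔼∑ h₀₀ + a * 𝔼∑ h₁₁) + a * (𝔼∑ h₁₀ + 0ℚ) + ((1ℚ - a) * 𝔼∑ h₀₁ + a * a * 𝔼∑ h₁₁)
      ≡⟨ solve 5 (λ a x y z w → (con 1ℚ :- a) :* (x :+ a :* w) :+ a :* (z :+ con 0ℚ) :+ ((con 1ℚ :- a) :* y :+ a :* a :* w)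
                              := (con 1ℚ :- a) :* (x :+ y) :+ a :* (z :+ w))
               refl a (𝔼∑ h₀₀) (𝔼∑ h₀₁) (𝔼∑ h₁₀) (𝔼∑ h₁₁) ⟩
    (1ℚ - a) * (𝔼∑ h₀₀ + 𝔼∑ h₀₁) + a * (𝔼∑ h₁₀ + 𝔼∑ h₁₁)
      ≡⟨ 𝔼∑-suc h ⟨
    𝔼∑ h ∎
    where
    open ℚ.≤-Reasoning
    0≤1-a = ≤⇒0≤- a≤1
    F : Subset (suc n) → Subset (suc n) → ℚ
    F W T = disjoint W T * a ^ ∣ T ∣ * h (T ∪ W) T
    h₀₀ h₀₁ h₁₀ h₁₁ F₀₀ F₀₁ F₁₀ F₁₁ : Subset n → Subset n → ℚ
    h₀₀ Z T = h (outside ∷ Z) (outside ∷ T)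
    h₀₁ Z T = h (outside ∷ Z) (inside ∷ T)
    h₁₀ Z T = h (inside ∷ Z) (outside ∷ T)
    h₁₁ Z T = h (inside ∷ Z) (inside ∷ T)
    F₀₀ W T = F (outside ∷ W) (outside ∷ T)
    F₀₁ W T = F (outside ∷ W) (inside ∷ T)
    F₁₀ W T = F (inside ∷ W) (outside ∷ T)
    F₁₁ W T = F (inside ∷ W) (inside ∷ T)
    𝔼∑-nonneg : ∀ {n} (f : Subset n → Subset n → ℚ) → (∀ Z T → 0ℚ ≤ᵠ f Z T) → 0ℚ ≤ᵠ 𝔼∑ f
    𝔼∑-nonneg f 0≤f = nonneg (𝔼-positive 0≤a a≤1) λ Z → nonneg ∑ᵠ-positive (0≤f Z)
    F₁₁≡0 : 𝔼∑ F₁₁ ≡ 0ℚ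
    F₁₁≡0 = 𝔼∑-zero F₁₁ λ W T → trans (cong (_* h₁₁ (T ∪ W) T) (ℚ.*-zeroˡ (a ^ ∣ inside ∷ T ∣))) (ℚ.*-zeroˡ (h₁₁ (T ∪ W) T))
    F₀₁≤ : 𝔼∑ F₀₁ ≤ᵠ a * 𝔼∑ h₁₁
    F₀₁≤ = begin
      𝔼∑ F₀₁
        ≡⟨ ≗-cong (𝔼-positive 0≤a a≤1) (λ W → trans (≗-cong ∑ᵠ-positive λ T →
             solve 4 (λ d a x y → d :* (a :* x) :* y := a :* (d :* x :* y)) refl (disjoint W T) a (a ^ ∣ T ∣) (h₁₁ (T ∪ W) T))
             (*-hom ∑ᵠ-positive a _)) ⟩
      𝔼 a (λ W → a * ∑ᵠ (λ T → disjoint W T * a ^ ∣ T ∣ * h₁₁ (T ∪ W) T))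
        ≡⟨ *-hom (𝔼-positive 0≤a a≤1) a _ ⟩
      a * 𝔼 a (λ W → ∑ᵠ (λ T → disjoint W T * a ^ ∣ T ∣ * h₁₁ (T ∪ W) T))
        ≤⟨ *-monoʳ-≤ 0≤a (𝔼-union-shift h₁₁ λ Z T → 0≤h _ _) ⟩
      a * 𝔼∑ h₁₁ ∎

-- Iterated random restriction

S⊆[S∩T]∪W : ∀ {n} {S T W : Subset n} → S ⊆ T ∪ W → S ⊆ (S ∩ T) ∪ W
S⊆[S∩T]∪W {S = S} {T} {W} S⊆ x∈S with Sub.x∈p∪q⁻ T W (S⊆ x∈S)
... | inj₁ x∈T = Sub.x∈p∪q⁺ (inj₁ (Sub.x∈p∩q⁺ (x∈S , x∈T)))
... | inj₂ x∈W = Sub.x∈p∪q⁺ (inj₂ x∈W)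

S⊆[T─W]∪W : ∀ {n} {S T W : Subset n} → S ⊆ T ∪ W → S ⊆ (T ─ W) ∪ W
S⊆[T─W]∪W {S = S} {T} {W} S⊆ {x} x∈S with Sub.x∈p∪q⁻ T W (S⊆ x∈S) | x ∈? W
... | _        | yes x∈W = Sub.x∈p∪q⁺ (inj₂ x∈W)
... | inj₂ x∈W | _       = Sub.x∈p∪q⁺ (inj₂ x∈W)
... | inj₁ x∈T | no x∉W  = Sub.x∈p∪q⁺ (inj₁ (Sub.x∈p∧x∉q⇒x∈p─q x∈T x∉W))

∣T∣<1⇒T⊆ : ∀ {n} {T V : Subset n} → ∣ T ∣ ℕ.< 1 → T ⊆ V
∣T∣<1⇒T⊆ {T = T} ∣T∣<1 {x} x∈T = contradiction ∣T∣<1 (ℕ.≤⇒≯ (begin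
  1          ≡⟨ Sub.∣⁅x⁆∣≡1 x ⟨
  ∣ ⁅ x ⁆ ∣  ≤⟨ Sub.p⊆q⇒∣p∣≤∣q∣ (λ y∈ → subst (_∈ T) (sym (Sub.x∈⁅y⁆⇒x≡y x y∈)) x∈T) ⟩
  ∣ T ∣      ∎))
  where open ℕ.≤-Reasoning

module _ {n : ℕ} where

  Contains : Family n → Family n
  Contains H V = ∃[ S ] (H S × S ⊆ V)

  contains? : ∀ {H} → Decidable H → Decidable (Contains H)
  contains? H? V = anySubset? (λ S → H? S ×-dec (S ⊆? V))

  avoids : ∀ {H} → Decidable H → Subset n → ℚ
  avoids H? V = ⟦ ¬? (contains? H? V) ⟧

  -- The minimal fragments S ∖ W of the members S of H.
  Fragment : Family n → Subset n → Family n
  Fragment H W = ℋ (λ A → Contains H (A ∪ W))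

  fragment? : ∀ {H} → Decidable H → ∀ W → Decidable (Fragment H W)
  fragment? H? W = ℋ? (λ A → contains? H? (A ∪ W))

  -- An edge inside V that is chosen by V alone. The default `⊥` satisfies every size bound.
  witness : ∀ {H} → Decidable H → Subset n → Subset n
  witness H? V with contains? H? V
  ... | yes (S , _) = S
  ... | no _        = ⊥

  witness-size : ∀ {H} (H? : Decidable H) {s} → (∀ S → H S → ∣ S ∣ ≤ s) → ∀ V → ∣ witness H? V ∣ ≤ s
  witness-size H? {s} bound V with contains? H? V
  ... | yes (S , HS , _) = bound S HS
  ... | no _             = subst (_≤ s) (sym (Sub.∣⊥∣≡0 n)) ℕ.z≤n

  -- The member of H found inside W ∪ T depends on W ∪ T only, yet contains T.
  fragment⊆witness : ∀ {H} (H? : Decidable H) W T → Fragment H W T → T ⊆ witness H? (T ∪ W)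
  fragment⊆witness H? W T (HT , minimal) with contains? H? (T ∪ W)
  ... | no ¬HT           = contradiction HT ¬HT
  -- S ∩ T already completes W to a superset of S, so minimality gives S ∩ T ≡ T.
  ... | yes (S , HS , S⊆) = subst (_⊆ S) (minimal (S ∩ T) (S , HS , S⊆[S∩T]∪W S⊆) (Sub.p∩q⊆q S T)) (Sub.p∩q⊆p S T)

  -- Points of W are wasted in a fragment: T ─ W completes W to the same edge, so minimality gives T
  -- ─ W ≡ T.
  fragment-disjoint : ∀ {H} W T → Fragment H W T → disjoint W T ≡ 1ℚ
  fragment-disjoint W T ((S , HS , S⊆) , minimal) =
    disjoint-≡1 W T (minimal (T ─ W) (S , HS , S⊆[T─W]∪W S⊆) (Sub.p─q⊆p T W))

-- With s = 2^m, an exponent 6 s can pay 2 s for the subsets of an edge and still leave m + 4, the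
-- exponent of the cost of a round.
m+4≤4*2^m : ∀ m → m ℕ.+ 4 ≤ 4 ℕ.* 2 ℕ.^ m
m+4≤4*2^m m = begin
  m ℕ.+ 4          ≤⟨ ℕ.+-monoˡ-≤ 4 (ℕ.m≤n*m m 4) ⟩
  4 ℕ.* m ℕ.+ 4    ≡⟨ ℕ.+-comm (4 ℕ.* m) 4 ⟩
  4 ℕ.+ 4 ℕ.* m    ≡⟨ ℕ.*-suc 4 m ⟨
  4 ℕ.* suc m      ≤⟨ ℕ.*-monoʳ-≤ 4 (m<2^m m) ⟩
  4 ℕ.* 2 ℕ.^ m    ∎
  where
  open ℕ.≤-Reasoning
  m<2^m : ∀ m → m ℕ.< 2 ℕ.^ m
  m<2^m zero    = ℕ.≤-refl
  m<2^m (suc m) = begin-strict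
    1 ℕ.+ m                      ≤⟨ ℕ.s≤s (ℕ.m≤m+n m 0) ⟩
    1 ℕ.+ (m ℕ.+ 0)              <⟨ ℕ.+-mono-≤-< (ℕ.m^n>0 2 m) (ℕ.+-monoˡ-< 0 (m<2^m m)) ⟩
    2 ℕ.^ m ℕ.+ (2 ℕ.^ m ℕ.+ 0)  ∎

module _ {n : ℕ} {a : ℚ} (0≤a : 0ℚ ≤ᵠ a) (a≤1 : a ≤ᵠ 1ℚ) where

  private
    E⁺ : IsPositive (𝔼 {n} a)
    E⁺ = 𝔼-positive 0≤a a≤1
    S⁺ : IsPositive (∑ᵠ {n})
    S⁺ = ∑ᵠ-positive
    q = a * ½ ^ 6
    0≤q : 0ℚ ≤ᵠ q
    0≤q = *-nonneg 0≤a (^-nonneg 6 0≤½)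

  -- Expected value of f at V together with m independent random sets of density a. V is an argument
  -- so that sets already exposed can be held fixed.
  rounds : ℕ → (Subset n → ℚ) → Subset n → ℚ
  rounds zero    f V = f V
  rounds (suc m) f V = 𝔼 a (λ W → rounds m f (V ∪ W))

  rounds-≤1 : ∀ m {f} → (∀ V → f V ≤ᵠ 1ℚ) → ∀ V → rounds m f V ≤ᵠ 1ℚ
  rounds-≤1 zero    f≤1 V = f≤1 V
  rounds-≤1 (suc m) f≤1 V = ≤-respʳ (mono E⁺ λ W → rounds-≤1 m f≤1 (V ∪ W)) (𝔼-one a)

  -- Absorbs an exposed round W into the function: avoiding the edges is replaced by avoiding their
  -- small fragments.
  rounds-shift : ∀ m {f f′} W → (∀ V → f (W ∪ V) ≤ᵠ f′ V) → ∀ V → rounds m f (W ∪ V) ≤ᵠ rounds m f′ V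
  rounds-shift zero    W h V = h V
  rounds-shift (suc m) {f} W h V = mono E⁺ λ X →
    ≤-respˡ (cong (rounds m f) (Sub.∪-assoc W V X)) (rounds-shift m W h (V ∪ X))

  private
    module Round {H : Family n} (H? : Decidable H) (m : ℕ) where

      s = 2 ℕ.^ m

      Large Small : Subset n → Family n
      Large W T = Fragment H W T × s ≤ ∣ T ∣
      Small W T = Fragment H W T × ∣ T ∣ ℕ.< s

      large? : ∀ W → Decidable (Large W)
      large? W T = fragment? H? W T ×-dec (s ℕ.≤? ∣ T ∣)

      small? : ∀ W → Decidable (Small W)
      small? W T = fragment? H? W T ×-dec (∣ T ∣ ℕ.<? s)

      -- Majorant for the large fragments that sees W only through Z = T ∪ W, the form that
      -- `𝔼-union-shift` requires.
      bound : Subset n → Subset n → ℚ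
      bound Z T = ⟦ (s ℕ.≤? ∣ T ∣) ×-dec (T ⊆? witness H? Z) ⟧ * (½ ^ 6) ^ ∣ T ∣

      bound-nonneg : ∀ Z T → 0ℚ ≤ᵠ bound Z T
      bound-nonneg Z T = *-nonneg (⟦⟧-nonneg ((s ℕ.≤? ∣ T ∣) ×-dec (T ⊆? witness H? Z))) (^-nonneg ∣ T ∣ (^-nonneg 6 0≤½))

      -- Of the two factors of q, a pays for the passage from W to T ∪ W, and ½ ^ 6 is kept for
      -- counting the fragments.
      large≤bound : ∀ W T → ⟦ large? W T ⟧ * q ^ ∣ T ∣ ≤ᵠ disjoint W T * a ^ ∣ T ∣ * bound (T ∪ W) T
      large≤bound W T = ⟦⟧*-≤ (large? W T)
        (*-nonneg (*-nonneg (disjoint-nonneg W T) (^-nonneg ∣ T ∣ 0≤a)) (bound-nonneg (T ∪ W) T))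
        λ (frag , s≤T) → ℚ.≤-reflexive (begin
          q ^ ∣ T ∣
            ≡⟨ ^-distribʳ-* a (½ ^ 6) ∣ T ∣ ⟩
          a ^ ∣ T ∣ * (½ ^ 6) ^ ∣ T ∣
            ≡⟨ cong₂ _*_ (ℚ.*-identityˡ (a ^ ∣ T ∣)) (ℚ.*-identityˡ ((½ ^ 6) ^ ∣ T ∣)) ⟨
          1ℚ * a ^ ∣ T ∣ * (1ℚ * (½ ^ 6) ^ ∣ T ∣)
            ≡⟨ cong₂ (λ x y → x * a ^ ∣ T ∣ * (y * (½ ^ 6) ^ ∣ T ∣)) (fragment-disjoint W T frag)
                 (⟦⟧-yes ((s ℕ.≤? ∣ T ∣) ×-dec (T ⊆? witness H? (T ∪ W))) (s≤T , fragment⊆witness H? W T frag)) ⟨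
          disjoint W T * a ^ ∣ T ∣ * bound (T ∪ W) T ∎)
        where open ≡-Reasoning

      module _ (H-size : ∀ S → H S → ∣ S ∣ ℕ.< 2 ℕ.^ suc m) where

        open ℚ.≤-Reasoning

        -- All T with a nonzero term are subsets of one witness A with at most 2 s points, so there
        -- are at most 2^(2 s) of them, while each weighs at most ½^(6 s).
        ∑bound : ∀ Z → ∑ᵠ (bound Z) ≤ᵠ ½ ^ (m ℕ.+ 4)
        ∑bound Z = begin
          ∑ᵠ (bound Z)
            ≤⟨ mono S⁺ pointwise ⟩
          ∑ᵠ (λ T → ⟦ T ⊆? A ⟧ * ½ ^ ∣ A ∣ * ½ ^ (m ℕ.+ 4))
            ≡⟨ *-homʳ S⁺ (λ T → ⟦ T ⊆? A ⟧ * ½ ^ ∣ A ∣) (½ ^ (m ℕ.+ 4)) ⟩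
          ∑ᵠ (λ T → ⟦ T ⊆? A ⟧ * ½ ^ ∣ A ∣) * ½ ^ (m ℕ.+ 4)
            ≤⟨ p*q≤q (∑-⊆-½ A) (^-nonneg (m ℕ.+ 4) 0≤½) ⟩
          ½ ^ (m ℕ.+ 4) ∎
          where
          A = witness H? Z
          size : ∀ t → s ≤ t → ∣ A ∣ ℕ.+ (m ℕ.+ 4) ≤ 6 ℕ.* t
          size t s≤t = ℕR.begin
            ∣ A ∣ ℕ.+ (m ℕ.+ 4)      ℕR.≤⟨ ℕ.+-mono-≤ (witness-size H? (λ S HS → ℕ.<⇒≤ (H-size S HS)) Z) (m+4≤4*2^m m) ⟩
            2 ℕ.* s ℕ.+ 4 ℕ.* s      ℕR.≡⟨ ℕ.*-distribʳ-+ s 2 4 ⟨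
            6 ℕ.* s                  ℕR.≤⟨ ℕ.*-monoʳ-≤ 6 s≤t ⟩
            6 ℕ.* t                  ℕR.∎
            where module ℕR = ℕ.≤-Reasoning
          pointwise : ∀ T → bound Z T ≤ᵠ ⟦ T ⊆? A ⟧ * ½ ^ ∣ A ∣ * ½ ^ (m ℕ.+ 4)
          pointwise T = ⟦⟧*-≤ ((s ℕ.≤? ∣ T ∣) ×-dec (T ⊆? A))
            (*-nonneg (*-nonneg (⟦⟧-nonneg (T ⊆? A)) (^-nonneg ∣ A ∣ 0≤½)) (^-nonneg (m ℕ.+ 4) 0≤½))
            λ (s≤T , T⊆A) → begin
              (½ ^ 6) ^ ∣ T ∣                              ≡⟨ ^-*-assoc ½ 6 ∣ T ∣ ⟩
              ½ ^ (6 ℕ.* ∣ T ∣)                            ≤⟨ ^-antitone 0≤½ ½≤1 (size ∣ T ∣ s≤T) ⟩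
              ½ ^ (∣ A ∣ ℕ.+ (m ℕ.+ 4))                    ≡⟨ ^-distribˡ-+ ½ ∣ A ∣ (m ℕ.+ 4) ⟩
              ½ ^ ∣ A ∣ * ½ ^ (m ℕ.+ 4)                    ≡⟨ cong (_* ½ ^ (m ℕ.+ 4)) (ℚ.*-identityˡ (½ ^ ∣ A ∣)) ⟨
              1ℚ * ½ ^ ∣ A ∣ * ½ ^ (m ℕ.+ 4)               ≡⟨ cong (λ x → x * ½ ^ ∣ A ∣ * ½ ^ (m ℕ.+ 4)) (⟦⟧-yes (T ⊆? A) T⊆A) ⟨
              ⟦ T ⊆? A ⟧ * ½ ^ ∣ A ∣ * ½ ^ (m ℕ.+ 4)       ∎

        large-cost : 𝔼 a (λ W → ∑ᵠ (λ T → ⟦ large? W T ⟧ * q ^ ∣ T ∣)) ≤ᵠ ½ ^ (m ℕ.+ 4)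
        large-cost = begin
          𝔼 a (λ W → ∑ᵠ (λ T → ⟦ large? W T ⟧ * q ^ ∣ T ∣))
            ≤⟨ mono E⁺ (λ W → mono S⁺ (large≤bound W)) ⟩
          𝔼 a (λ W → ∑ᵠ (λ T → disjoint W T * a ^ ∣ T ∣ * bound (T ∪ W) T))
            ≤⟨ 𝔼-union-shift 0≤a a≤1 bound bound-nonneg ⟩
          𝔼 a (λ Z → ∑ᵠ (bound Z))
            ≤⟨ mono E⁺ ∑bound ⟩
          𝔼 a (λ _ → ½ ^ (m ℕ.+ 4))
            ≡⟨ 𝔼-const 0≤a a≤1 (½ ^ (m ℕ.+ 4)) ⟩
          ½ ^ (m ℕ.+ 4) ∎

  -- A fragment inside V, together with W, contains an edge inside W ∪ V.
  avoids-small : ∀ {H} (H? : Decidable H) m W V →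
    avoids H? (W ∪ V) ≤ᵠ avoids (Round.small? H? m W) V
  avoids-small {H} H? m W V = ⟦⟧-mono (¬? (contains? H? (W ∪ V))) (¬? (contains? (Round.small? H? m W) V))
    λ ¬H (T , ((( S , HS , S⊆) , _) , _) , T⊆V) → ¬H (S , HS , λ x∈S →
      [ (λ x∈T → Sub.x∈p∪q⁺ (inj₂ (T⊆V x∈T))) , (λ x∈W → Sub.x∈p∪q⁺ (inj₁ x∈W)) ]′ (Sub.x∈p∪q⁻ T W (S⊆ x∈S)))

  -- Sets have to be covered only to the extent of the failure probability; this can be averaged
  -- over W without conditioning on failure. The bound on the cost is the geometric sum ½^4 + ... +
  -- ½^(m + 3), one term per round.
  IsCover : ℕ → {H : Family n} → Decidable H → (Subset n → ℚ) → Set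
  IsCover m {H} H? g =
      (∀ S → 0ℚ ≤ᵠ g S)
    × (∀ T → H T → rounds m (avoids H?) ⊥ ≤ᵠ ∑ᵠ (λ S → ⟦ S ⊆? T ⟧ * g S))
    × ∑ᵠ (λ S → g S * q ^ ∣ S ∣) ≤ᵠ ½ ^ 3 * (1ℚ - ½ ^ m)

  -- The cover consists of the fragments of at least half the current size bound 2^(m+1), averaged
  -- over W, together with the covers of the families of smaller fragments.
  cover-step : ∀ m {H} (H? : Decidable H) → (∀ S → H S → ∣ S ∣ ℕ.< 2 ℕ.^ suc m) →
    (∀ W → ∃[ g ] IsCover m (Round.small? H? m W) g) → ∃[ g ] IsCover (suc m) H? g
  cover-step m {H} H? H-size rec = g , g-nonneg , covers , cost
    where
    open Round H? m
    g′ : Subset n → Subset n → ℚ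
    g′ W = proj₁ (rec W)
    g′-nonneg : ∀ W S → 0ℚ ≤ᵠ g′ W S
    g′-nonneg W = proj₁ (proj₂ (rec W))
    g : Subset n → ℚ
    g S = 𝔼 a (λ W → ⟦ large? W S ⟧ + g′ W S)
    summand-nonneg : ∀ W S → 0ℚ ≤ᵠ ⟦ large? W S ⟧ + g′ W S
    summand-nonneg W S = +-nonneg (⟦⟧-nonneg (large? W S)) (g′-nonneg W S)
    g-nonneg : ∀ S → 0ℚ ≤ᵠ g S
    g-nonneg S = nonneg E⁺ λ W → summand-nonneg W S
    open ℚ.≤-Reasoning

    module _ (T : Subset n) (HT : H T) where

      covers-W : ∀ W → rounds m (avoids H?) (⊥ ∪ W) ≤ᵠ ∑ᵠ (λ S → ⟦ S ⊆? T ⟧ * (⟦ large? W S ⟧ + g′ W S))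
      covers-W W = [ covers-small , covers-large ]′ (ℕ.<-≤-connex ∣ T₀ ∣ s)
        where
        -- T completes W to a superset of the edge T, so some minimal fragment lies inside T.
        below = minimal-below (λ A → contains? H? (A ∪ W)) T (T , HT , Sub.p⊆p∪q W)
        T₀ = proj₁ below
        frag = proj₁ (proj₂ below)
        T₀⊆T : T₀ ⊆ T
        T₀⊆T = proj₂ (proj₂ below)
        -- A large `T₀` is in the cover itself, so T is covered with weight 1, whatever the later
        -- rounds bring.
        covers-large : s ≤ ∣ T₀ ∣ → _ ≤ᵠ _
        covers-large s≤T₀ = begin
          rounds m (avoids H?) (⊥ ∪ W)
            ≤⟨ rounds-≤1 m (λ V → ⟦⟧≤1 (¬? (contains? H? V))) (⊥ ∪ W) ⟩
          1ℚ
            ≤⟨ p≤p+q (g′-nonneg W T₀) ⟩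
          1ℚ + g′ W T₀
            ≡⟨ cong (_+ g′ W T₀) (⟦⟧-yes (large? W T₀) (frag , s≤T₀)) ⟨
          ⟦ large? W T₀ ⟧ + g′ W T₀
            ≡⟨ ℚ.*-identityˡ (⟦ large? W T₀ ⟧ + g′ W T₀) ⟨
          1ℚ * (⟦ large? W T₀ ⟧ + g′ W T₀)
            ≡⟨ cong (_* (⟦ large? W T₀ ⟧ + g′ W T₀)) (⟦⟧-yes (T₀ ⊆? T) T₀⊆T) ⟨
          ⟦ T₀ ⊆? T ⟧ * (⟦ large? W T₀ ⟧ + g′ W T₀)
            ≤⟨ term≤∑ᵠ _ (λ S → *-nonneg (⟦⟧-nonneg (S ⊆? T)) (summand-nonneg W S)) T₀ ⟩
          ∑ᵠ (λ S → ⟦ S ⊆? T ⟧ * (⟦ large? W S ⟧ + g′ W S)) ∎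
        -- A small `T₀` is an edge of the next family, and whatever covers it also covers the larger
        -- set T.
        covers-small : ∣ T₀ ∣ ℕ.< s → _ ≤ᵠ _
        covers-small T₀<s = begin
          rounds m (avoids H?) (⊥ ∪ W)
            ≡⟨ cong (rounds m (avoids H?)) (trans (Sub.∪-identityˡ W) (sym (Sub.∪-identityʳ W))) ⟩
          rounds m (avoids H?) (W ∪ ⊥)
            ≤⟨ rounds-shift m W (avoids-small H? m W) ⊥ ⟩
          rounds m (avoids (small? W)) ⊥
            ≤⟨ proj₁ (proj₂ (proj₂ (rec W))) T₀ (frag , T₀<s) ⟩
          ∑ᵠ (λ S → ⟦ S ⊆? T₀ ⟧ * g′ W S)
            ≤⟨ mono S⁺ (λ S → *-mono-≤ (⟦⟧-nonneg (S ⊆? T₀)) (summand-nonneg W S)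
                 (⟦⟧-mono (S ⊆? T₀) (S ⊆? T) (λ S⊆T₀ {_} x∈S → T₀⊆T (S⊆T₀ x∈S))) (q≤p+q (⟦⟧-nonneg (large? W S)))) ⟩
          ∑ᵠ (λ S → ⟦ S ⊆? T ⟧ * (⟦ large? W S ⟧ + g′ W S)) ∎

      covers : rounds (suc m) (avoids H?) ⊥ ≤ᵠ ∑ᵠ (λ S → ⟦ S ⊆? T ⟧ * g S)
      covers = begin
        𝔼 a (λ W → rounds m (avoids H?) (⊥ ∪ W))
          ≤⟨ mono E⁺ covers-W ⟩
        𝔼 a (λ W → ∑ᵠ (λ S → ⟦ S ⊆? T ⟧ * (⟦ large? W S ⟧ + g′ W S)))
          ≡⟨ ∑ʷ-swap E⁺ (λ S W → ⟦ S ⊆? T ⟧ * (⟦ large? W S ⟧ + g′ W S)) ⟩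
        ∑ᵠ (λ S → 𝔼 a (λ W → ⟦ S ⊆? T ⟧ * (⟦ large? W S ⟧ + g′ W S)))
          ≡⟨ ≗-cong S⁺ (λ S → *-hom E⁺ ⟦ S ⊆? T ⟧ (λ W → ⟦ large? W S ⟧ + g′ W S)) ⟩
        ∑ᵠ (λ S → ⟦ S ⊆? T ⟧ * g S) ∎

    cost : ∑ᵠ (λ S → g S * q ^ ∣ S ∣) ≤ᵠ ½ ^ 3 * (1ℚ - ½ ^ suc m)
    cost = begin
      ∑ᵠ (λ S → g S * q ^ ∣ S ∣)
        ≡⟨ ≗-cong S⁺ (λ S → *-homʳ E⁺ (λ W → ⟦ large? W S ⟧ + g′ W S) (q ^ ∣ S ∣)) ⟨
      ∑ᵠ (λ S → 𝔼 a (λ W → (⟦ large? W S ⟧ + g′ W S) * q ^ ∣ S ∣))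
        ≡⟨ ∑ʷ-swap E⁺ (λ S W → (⟦ large? W S ⟧ + g′ W S) * q ^ ∣ S ∣) ⟨
      𝔼 a (λ W → ∑ᵠ (λ S → (⟦ large? W S ⟧ + g′ W S) * q ^ ∣ S ∣))
        ≡⟨ ≗-cong E⁺ (λ W → trans (≗-cong S⁺ λ S → ℚ.*-distribʳ-+ (q ^ ∣ S ∣) ⟦ large? W S ⟧ (g′ W S))
             (+-hom S⁺ (λ S → ⟦ large? W S ⟧ * q ^ ∣ S ∣) (λ S → g′ W S * q ^ ∣ S ∣))) ⟩
      𝔼 a (λ W → ∑ᵠ (λ S → ⟦ large? W S ⟧ * q ^ ∣ S ∣) + ∑ᵠ (λ S → g′ W S * q ^ ∣ S ∣))
        ≡⟨ +-hom E⁺ (λ W → ∑ᵠ (λ S → ⟦ large? W S ⟧ * q ^ ∣ S ∣)) (λ W → ∑ᵠ (λ S → g′ W S * q ^ ∣ S ∣)) ⟩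
      𝔼 a (λ W → ∑ᵠ (λ S → ⟦ large? W S ⟧ * q ^ ∣ S ∣)) + 𝔼 a (λ W → ∑ᵠ (λ S → g′ W S * q ^ ∣ S ∣))
        ≤⟨ ℚ.+-mono-≤ (large-cost H-size) (≤-respʳ (mono E⁺ λ W → proj₂ (proj₂ (proj₂ (rec W)))) (𝔼-const 0≤a a≤1 (½ ^ 3 * (1ℚ - ½ ^ m)))) ⟩
      ½ ^ (m ℕ.+ 4) + ½ ^ 3 * (1ℚ - ½ ^ m)
        ≡⟨ cong (_+ ½ ^ 3 * (1ℚ - ½ ^ m)) (^-distribˡ-+ ½ m 4) ⟩
      ½ ^ m * ½ ^ 4 + ½ ^ 3 * (1ℚ - ½ ^ m)
        ≡⟨ solve 1 (λ x → x :* con (½ ^ 4) :+ con (½ ^ 3) :* (con 1ℚ :- x) := con (½ ^ 3) :* (con 1ℚ :- con ½ :* x)) refl (½ ^ m) ⟩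
      ½ ^ 3 * (1ℚ - ½ ^ suc m) ∎

  -- The size bound halves from round to round. At m = 0 an edge has no points, so every set
  -- contains it, the failure probability is 0 and the zero cover will do.
  fractional-cover : ∀ m {H} (H? : Decidable H) → (∀ S → H S → ∣ S ∣ ℕ.< 2 ℕ.^ m) → ∃[ g ] IsCover m H? g
  fractional-cover zero H? H-size = (λ _ → 0ℚ) , (λ _ → ℚ.≤-refl) ,
    (λ T HT → ≤-respˡ (⟦⟧-no (¬? (contains? H? ⊥)) (λ ¬H → ¬H (T , HT , ∣T∣<1⇒T⊆ (H-size T HT))))
                      (nonneg S⁺ λ S → *-nonneg (⟦⟧-nonneg (S ⊆? T)) ℚ.≤-refl)) ,
    ℚ.≤-reflexive (trans (≗-cong S⁺ λ S → ℚ.*-zeroˡ (q ^ ∣ S ∣)) (zero-hom S⁺))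
  fractional-cover (suc m) H? H-size =
    cover-step m H? H-size (λ W → fractional-cover m (Round.small? H? m W) (λ T → proj₂))

-- Natural multiples and reciprocals

infixr 8 _·_

_·_ : ℕ → ℚ → ℚ
zero  · x = 0ℚ
suc m · x = x + m · x

·-nonneg : ∀ m {x} → 0ℚ ≤ᵠ x → 0ℚ ≤ᵠ m · x
·-nonneg zero    0≤x = ℚ.≤-refl
·-nonneg (suc m) 0≤x = +-nonneg 0≤x (·-nonneg m 0≤x)

*-·-comm : ∀ m x y → x * m · y ≡ m · (x * y)
*-·-comm zero    x y = ℚ.*-zeroʳ x
*-·-comm (suc m) x y = trans (ℚ.*-distribˡ-+ x y (m · y)) (cong (x * y +_) (*-·-comm m x y))

∑ᶠ-const : ∀ {k} c → ∑ᶠ {k} (λ _ → c) ≡ k · c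
∑ᶠ-const {zero}  c = ∑ᶠ-zero _
∑ᶠ-const {suc k} c = trans (∑ᶠ-suc {k} _) (cong (c +_) (∑ᶠ-const {k} c))

opaque

  1/ : ∀ k .{{_ : NonZero k}} → ℚ
  1/ k = ℤ.+ 1 ℚ./ k

  1/≡ : ∀ k .{{_ : NonZero k}} → 1/ k ≡ ℤ.+ 1 ℚ./ k
  1/≡ k = refl

  k·1/k≡1 : ∀ k .{{_ : NonZero k}} → k · 1/ k ≡ 1ℚ
  k·1/k≡1 (suc k) = trans (j·1/k (suc k)) (ℚ.fromℚᵘ-cong {mkℚᵘ (ℤ.+ suc k) k} {mkℚᵘ (ℤ.+ 1) 0} (ℚᵘ.*≡* (ℤ.*-comm (ℤ.+ suc k) (ℤ.+ 1))))
    where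
    j·1/k : ∀ j → j · 1/ (suc k) ≡ ℤ.+ j ℚ./ suc k
    j·1/k zero    = sym (ℚ.0/n≡0 (suc k))
    j·1/k (suc j) = trans (cong (1/ (suc k) +_) (j·1/k j))
      (trans (ℚ.+-comm (1/ (suc k)) (ℤ.+ j ℚ./ suc k)) (sym (frac-suc j k)))

  1/k-nonneg : ∀ k .{{_ : NonZero k}} → 0ℚ ≤ᵠ 1/ k
  1/k-nonneg k = ℚ.nonNegative⁻¹ (1/ k) {{ℚ.normalize-nonNeg 1 k}}

1/k≤1 : ∀ k .{{_ : NonZero k}} → 1/ k ≤ᵠ 1ℚ
1/k≤1 (suc k) = ≤-respʳ (p≤p+q (·-nonneg k (1/k-nonneg (suc k)))) (k·1/k≡1 (suc k))

-- One exposure against several rounds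

Antitone : ∀ {n} → (Subset n → ℚ) → Set
Antitone f = ∀ {A B} → A ⊆ B → f B ≤ᵠ f A

∪-monoʳ-⊆ : ∀ {n} (V : Subset n) {A B} → A ⊆ B → V ∪ A ⊆ V ∪ B
∪-monoʳ-⊆ V {A} A⊆B x∈ = Sub.x∈p∪q⁺ ([ inj₁ , inj₂ ∘ A⊆B ]′ (Sub.x∈p∪q⁻ V A x∈))

-- The union of independent sets of densities a and b has density a + b - a b, which is at most a +
-- b, and f is antitone. The term `a * b * (Y₀ - Y₁)` is this difference at the first point.
𝔼-union : ∀ {n a b} → 0ℚ ≤ᵠ a → 0ℚ ≤ᵠ b → a + b ≤ᵠ 1ℚ → ∀ (f : Subset n → ℚ) → Antitone f →
  𝔼 (a + b) f ≤ᵠ 𝔼 a (λ W → 𝔼 b (λ V → f (W ∪ V)))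
𝔼-union {zero} 0≤a 0≤b a+b≤1 f anti = ℚ.≤-reflexive (trans (∑ʷ-zero _) (sym (trans (∑ʷ-zero _) (∑ʷ-zero _))))
𝔼-union {suc n} {a} {b} 0≤a 0≤b a+b≤1 f anti = begin
  𝔼 (a + b) f
    ≡⟨ ∑ʷ-suc f ⟩
  (1ℚ - (a + b)) * Y₀ + (a + b) * Y₁
    ≤⟨ p≤p+q (*-nonneg (*-nonneg 0≤a 0≤b) (≤⇒0≤- Y₁≤Y₀)) ⟩
  (1ℚ - (a + b)) * Y₀ + (a + b) * Y₁ + a * b * (Y₀ - Y₁)
    ≡⟨ solve 4 (λ a b x y → (con 1ℚ :- (a :+ b)) :* x :+ (a :+ b) :* y :+ a :* b :* (x :- y)
         := (con 1ℚ :- a) :* ((con 1ℚ :- b) :* x :+ b :* y) :+ a :* ((con 1ℚ :- b) :* y :+ b :* y)) refl a b Y₀ Y₁ ⟩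
  (1ℚ - a) * ((1ℚ - b) * Y₀ + b * Y₁) + a * ((1ℚ - b) * Y₁ + b * Y₁)
    ≤⟨ ℚ.+-mono-≤ (*-monoʳ-≤ 0≤1-a (ℚ.+-mono-≤ (*-monoʳ-≤ 0≤1-b Y₀≤Z₀) (*-monoʳ-≤ 0≤b Y₁≤Z₁)))
                  (*-monoʳ-≤ 0≤a (ℚ.+-mono-≤ (*-monoʳ-≤ 0≤1-b Y₁≤Z₁) (*-monoʳ-≤ 0≤b Y₁≤Z₁))) ⟩
  (1ℚ - a) * ((1ℚ - b) * Z₀ + b * Z₁) + a * ((1ℚ - b) * Z₁ + b * Z₁)
    ≡⟨ cong₂ (λ x y → (1ℚ - a) * x + a * y) (inner f₀ f₁) (inner f₁ f₁) ⟩
  (1ℚ - a) * 𝔼 a (λ W → (1ℚ - b) * 𝔼 b (λ V → f₀ (W ∪ V)) + b * 𝔼 b (λ V → f₁ (W ∪ V))) +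
  a * 𝔼 a (λ W → (1ℚ - b) * 𝔼 b (λ V → f₁ (W ∪ V)) + b * 𝔼 b (λ V → f₁ (W ∪ V)))
    ≡⟨ cong₂ (λ x y → (1ℚ - a) * x + a * y)
         (≗-cong a⁺ λ W → ∑ʷ-suc (λ V → f ((outside ∷ W) ∪ V))) (≗-cong a⁺ λ W → ∑ʷ-suc (λ V → f ((inside ∷ W) ∪ V))) ⟨
  (1ℚ - a) * 𝔼 a (λ W → 𝔼 b (λ V → f ((outside ∷ W) ∪ V))) + a * 𝔼 a (λ W → 𝔼 b (λ V → f ((inside ∷ W) ∪ V)))
    ≡⟨ ∑ʷ-suc (λ W → 𝔼 b (λ V → f (W ∪ V))) ⟨
  𝔼 a (λ W → 𝔼 b (λ V → f (W ∪ V))) ∎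
  where
  open ℚ.≤-Reasoning
  a≤1 = ℚ.≤-trans (p≤p+q 0≤b) a+b≤1
  b≤1 = ℚ.≤-trans (q≤p+q 0≤a) a+b≤1
  0≤1-a = ≤⇒0≤- a≤1
  0≤1-b = ≤⇒0≤- b≤1
  a⁺ : IsPositive (𝔼 {n} a)
  a⁺ = 𝔼-positive 0≤a a≤1
  f₀ f₁ : Subset n → ℚ
  f₀ S = f (outside ∷ S)
  f₁ S = f (inside ∷ S)
  Y₀ = 𝔼 (a + b) f₀
  Y₁ = 𝔼 (a + b) f₁
  Z₀ = 𝔼 a (λ W → 𝔼 b (λ V → f₀ (W ∪ V)))
  Z₁ = 𝔼 a (λ W → 𝔼 b (λ V → f₁ (W ∪ V)))
  Y₀≤Z₀ : Y₀ ≤ᵠ Z₀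
  Y₀≤Z₀ = 𝔼-union 0≤a 0≤b a+b≤1 f₀ (λ A⊆B → anti (out⊆ A⊆B))
  Y₁≤Z₁ : Y₁ ≤ᵠ Z₁
  Y₁≤Z₁ = 𝔼-union 0≤a 0≤b a+b≤1 f₁ (λ A⊆B → anti (in⊆in A⊆B))
  Y₁≤Y₀ : Y₁ ≤ᵠ Y₀
  Y₁≤Y₀ = mono (𝔼-positive (+-nonneg 0≤a 0≤b) a+b≤1) λ S → anti (out⊆ id)
  inner : ∀ (g h : Subset n → ℚ) → (1ℚ - b) * 𝔼 a (λ W → 𝔼 b (λ V → g (W ∪ V))) + b * 𝔼 a (λ W → 𝔼 b (λ V → h (W ∪ V)))
    ≡ 𝔼 a (λ W → (1ℚ - b) * 𝔼 b (λ V → g (W ∪ V)) + b * 𝔼 b (λ V → h (W ∪ V)))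
  inner g h = sym (trans (+-hom a⁺ (λ W → (1ℚ - b) * 𝔼 b (λ V → g (W ∪ V))) (λ W → b * 𝔼 b (λ V → h (W ∪ V))))
    (cong₂ _+_ (*-hom a⁺ (1ℚ - b) (λ W → 𝔼 b (λ V → g (W ∪ V)))) (*-hom a⁺ b (λ W → 𝔼 b (λ V → h (W ∪ V))))))

-- Iterates `𝔼-union`. With a = p/(k m) it splits the exposure of density p/k into m rounds without
-- lowering the failure probability.
𝔼≤rounds : ∀ {n a} (0≤a : 0ℚ ≤ᵠ a) (a≤1 : a ≤ᵠ 1ℚ) m → m · a ≤ᵠ 1ℚ → ∀ (f : Subset n → ℚ) → Antitone f →
  ∀ V → 𝔼 (m · a) (λ W → f (V ∪ W)) ≤ᵠ rounds 0≤a a≤1 m f V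
𝔼≤rounds 0≤a a≤1 zero _ f anti V =
  ≤-respʳ (mono (𝔼-positive ℚ.≤-refl 0≤1) λ W → anti (Sub.p⊆p∪q W)) (𝔼-const ℚ.≤-refl 0≤1 (f V))
𝔼≤rounds {a = a} 0≤a a≤1 (suc m) ma≤1 f anti V = begin
  𝔼 (a + m · a) (λ W → f (V ∪ W))
    ≤⟨ 𝔼-union 0≤a (·-nonneg m 0≤a) ma≤1 (λ W → f (V ∪ W)) (λ A⊆B → anti (∪-monoʳ-⊆ V A⊆B)) ⟩
  𝔼 a (λ W → 𝔼 (m · a) (λ X → f (V ∪ (W ∪ X))))
    ≤⟨ mono (𝔼-positive 0≤a a≤1) (λ W → ≤-respˡ
         (≗-cong (𝔼-positive (·-nonneg m 0≤a) m·a≤1) λ X → cong f (sym (Sub.∪-assoc V W X)))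
         (𝔼≤rounds 0≤a a≤1 m m·a≤1 f anti (V ∪ W))) ⟩
  𝔼 a (λ W → rounds 0≤a a≤1 m f (V ∪ W)) ∎
  where
  open ℚ.≤-Reasoning
  m·a≤1 = ℚ.≤-trans (q≤p+q 0≤a) ma≤1

-- Coloured sets, row by row

-- A row is void, carries exactly one colour, or violates `DistinctElements` through two explicit
-- points.
data Row {k} : Subset k → Set where
  empty  : Row ⊥
  single : ∀ i → Row ⁅ i ⁆
  many   : ∀ {b} i j → i ≢ j → i ∈ b → j ∈ b → Row b

row : ∀ {k} (b : Subset k) → Row b
row []            = empty
row (outside ∷ b) with row b
... | empty               = empty
... | single i            = single (suc i)
... | many i j i≢j i∈b j∈b = many (suc i) (suc j) (i≢j ∘ Fin.suc-injective) (Vec.there i∈b) (Vec.there j∈b)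
row (inside ∷ b) with row b
... | empty               = single zero
... | single i            = many zero (suc i) (λ ()) Vec.here (Vec.there (Sub.x∈⁅x⁆ i))
... | many i j i≢j i∈b j∈b = many (suc i) (suc j) (i≢j ∘ Fin.suc-injective) (Vec.there i∈b) (Vec.there j∈b)

module _ {m n : ℕ} {b : Subset m} {r : Subset n} where

  ∈-++⁺ˡ : ∀ {i} → i ∈ b → i ↑ˡ n ∈ b ++ r
  ∈-++⁺ˡ {i} i∈b = lookup⇒[]= (i ↑ˡ n) (b ++ r) (trans (lookup-++ˡ b r i) ([]=⇒lookup i∈b))

  ∈-++⁻ˡ : ∀ {i} → i ↑ˡ n ∈ b ++ r → i ∈ b
  ∈-++⁻ˡ {i} i∈ = lookup⇒[]= i b (trans (sym (lookup-++ˡ b r i)) ([]=⇒lookup i∈))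

  ∈-++⁺ʳ : ∀ {i} → i ∈ r → m ↑ʳ i ∈ b ++ r
  ∈-++⁺ʳ {i} i∈r = lookup⇒[]= (m ↑ʳ i) (b ++ r) (trans (lookup-++ʳ b r i) ([]=⇒lookup i∈r))

  ∈-++⁻ʳ : ∀ {i} → m ↑ʳ i ∈ b ++ r → i ∈ r
  ∈-++⁻ʳ {i} i∈ = lookup⇒[]= i r (trans (sym (lookup-++ʳ b r i)) ([]=⇒lookup i∈))

∣++∣ : ∀ {m n} (b : Subset m) (r : Subset n) → ∣ b ++ r ∣ ≡ ∣ b ∣ ℕ.+ ∣ r ∣
∣++∣ []            r = refl
∣++∣ (outside ∷ b) r = ∣++∣ b r
∣++∣ (inside ∷ b)  r = cong suc (∣++∣ b r)

++⁺-⊆ : ∀ {m n} {b b′ : Subset m} {r r′ : Subset n} → b ⊆ b′ → r ⊆ r′ → b ++ r ⊆ b′ ++ r′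
++⁺-⊆ {b = []}          {[]}          b⊆ r⊆ = r⊆
++⁺-⊆ {b = outside ∷ b} {_ ∷ b′}      b⊆ r⊆ = out⊆ (++⁺-⊆ (drop-∷-⊆ b⊆) r⊆)
++⁺-⊆ {b = inside ∷ b}  {inside ∷ b′} b⊆ r⊆ = in⊆in (++⁺-⊆ (drop-∷-⊆ b⊆) r⊆)
++⁺-⊆ {b = inside ∷ b}  {outside ∷ b′} b⊆ r⊆ = contradiction (b⊆ Vec.here) λ ()

++⁻ˡ-⊆ : ∀ {m n} {b b′ : Subset m} {r r′ : Subset n} → b ++ r ⊆ b′ ++ r′ → b ⊆ b′
++⁻ˡ-⊆ h i∈b = ∈-++⁻ˡ (h (∈-++⁺ˡ i∈b))

++⁻ʳ-⊆ : ∀ {m n} {b b′ : Subset m} {r r′ : Subset n} → b ++ r ⊆ b′ ++ r′ → r ⊆ r′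
++⁻ʳ-⊆ {b = b} h i∈r = ∈-++⁻ʳ (h (∈-++⁺ʳ {b = b} i∈r))

module _ {n k : ℕ} {b : Subset k} {r : Subset (n ℕ.* k)} where

  distinct-++ : (∀ i j → i ∈ b → j ∈ b → i ≡ j) → DistinctElements {n} {k} r → DistinctElements {suc n} {k} (b ++ r)
  distinct-++ db dr zero    i j i∈ j∈ = db i j (∈-++⁻ˡ i∈) (∈-++⁻ˡ j∈)
  distinct-++ db dr (suc x) i j i∈ j∈ = dr x i j (∈-++⁻ʳ {b = b} i∈) (∈-++⁻ʳ {b = b} j∈)

  distinct-++⁻ˡ : DistinctElements {suc n} {k} (b ++ r) → ∀ i j → i ∈ b → j ∈ b → i ≡ j
  distinct-++⁻ˡ d i j i∈ j∈ = d zero i j (∈-++⁺ˡ i∈) (∈-++⁺ˡ j∈)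

  distinct-++⁻ʳ : DistinctElements {suc n} {k} (b ++ r) → DistinctElements {n} {k} r
  distinct-++⁻ʳ d x i j i∈ j∈ = d (suc x) i j (∈-++⁺ʳ {b = b} i∈) (∈-++⁺ʳ {b = b} j∈)

  elements-++ : elements {suc n} {k} (b ++ r) ≡ does (Fin.any? (λ i → i ∈? b)) ∷ elements {n} {k} r
  elements-++ = cong₂ _∷_
    (does-⇔ (mk⇔ (λ (i , i∈) → i , ∈-++⁻ˡ i∈) (λ (i , i∈) → i , ∈-++⁺ˡ i∈))
      (Fin.any? (λ i → _∈′?_ {suc n} (zero , i) (b ++ r))) (Fin.any? (_∈? b)))
    (tabulate-cong λ x → does-⇔ (mk⇔ (λ (i , i∈) → i , ∈-++⁻ʳ {b = b} i∈) (λ (i , i∈) → i , ∈-++⁺ʳ {b = b} i∈))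
      (Fin.any? (λ i → _∈′?_ {suc n} (suc x , i) (b ++ r))) (Fin.any? (λ i → _∈′?_ {n} (x , i) r)))

⊥-unique : ∀ {k} → (i j : Fin k) → i ∈ ⊥ → j ∈ ⊥ → i ≡ j
⊥-unique i j i∈ _ = contradiction i∈ Sub.∉⊥

⁅⁆-unique : ∀ {k} (c i j : Fin k) → i ∈ ⁅ c ⁆ → j ∈ ⁅ c ⁆ → i ≡ j
⁅⁆-unique c i j i∈ j∈ = trans (Sub.x∈⁅y⁆⇒x≡y c i∈) (sym (Sub.x∈⁅y⁆⇒x≡y c j∈))

module _ {n k : ℕ} where

  elements-⊥++ : ∀ (r : Subset (n ℕ.* k)) → elements {suc n} {k} (⊥ ++ r) ≡ outside ∷ elements {n} {k} r
  elements-⊥++ r = trans (elements-++ {n} {k}) (cong (_∷ elements {n} {k} r) (dec-false (Fin.any? (_∈? ⊥ {k})) λ (i , i∈) → Sub.∉⊥ i∈))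

  elements-⁅⁆++ : ∀ c (r : Subset (n ℕ.* k)) → elements {suc n} {k} (⁅ c ⁆ ++ r) ≡ inside ∷ elements {n} {k} r
  elements-⁅⁆++ c r = trans (elements-++ {n} {k}) (cong (_∷ elements {n} {k} r) (dec-true (Fin.any? (_∈? ⁅ c ⁆)) (c , Sub.x∈⁅x⁆ c)))

distinct-size : ∀ {n k} (S : Subset (n ℕ.* k)) → DistinctElements {n} {k} S → ∣ S ∣ ≡ ∣ elements {n} {k} S ∣
distinct-size {zero} [] d = refl
distinct-size {suc n} {k} S d with Vec.splitAt k S
... | b , r , refl with row b
... | empty = trans (∣++∣ {k} ⊥ r) (trans (cong (ℕ._+ ∣ r ∣) (Sub.∣⊥∣≡0 k))
  (trans (distinct-size {n} {k} r (distinct-++⁻ʳ {n} d)) (cong ∣_∣ (sym (elements-⊥++ {n} r)))))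
... | single c = trans (∣++∣ ⁅ c ⁆ r) (trans (cong (ℕ._+ ∣ r ∣) (Sub.∣⁅x⁆∣≡1 c))
  (trans (cong suc (distinct-size {n} {k} r (distinct-++⁻ʳ {n} d))) (cong ∣_∣ (sym (elements-⁅⁆++ {n} c r)))))
... | many i j i≢j i∈b j∈b = contradiction (distinct-++⁻ˡ {n} d i j i∈b j∈b) i≢j

-- The law of the coloured random set as a product over the rows

-- x, y or 0 according to whether b has no, one or more elements.
rowWeight : ∀ {k} → ℚ → ℚ → Subset k → ℚ
rowWeight x y []            = x
rowWeight x y (outside ∷ b) = rowWeight x y b
rowWeight x y (inside ∷ b)  = rowWeight y 0ℚ b

rowWeight-⊥ : ∀ {k} x y → rowWeight {k} x y ⊥ ≡ x
rowWeight-⊥ {zero}  x y = refl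
rowWeight-⊥ {suc k} x y = rowWeight-⊥ {k} x y

rowWeight-⁅⁆ : ∀ {k} x y (i : Fin k) → rowWeight x y ⁅ i ⁆ ≡ y
rowWeight-⁅⁆ {suc k} x y zero    = rowWeight-⊥ {k} y 0ℚ
rowWeight-⁅⁆         x y (suc i) = rowWeight-⁅⁆ x y i

rowWeight-0 : ∀ {k} (b : Subset k) → rowWeight 0ℚ 0ℚ b ≡ 0ℚ
rowWeight-0 []            = refl
rowWeight-0 (outside ∷ b) = rowWeight-0 b
rowWeight-0 (inside ∷ b)  = rowWeight-0 b

rowWeight-∈ : ∀ {k x i} {b : Subset k} → i ∈ b → rowWeight x 0ℚ b ≡ 0ℚ
rowWeight-∈ {b = inside ∷ b}  Vec.here        = rowWeight-0 b
rowWeight-∈ {b = outside ∷ b} (Vec.there i∈b) = rowWeight-∈ i∈b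
rowWeight-∈ {b = inside ∷ b}  (Vec.there i∈b) = rowWeight-0 b

rowWeight-many : ∀ {k x y i j} {b : Subset k} → i ≢ j → i ∈ b → j ∈ b → rowWeight x y b ≡ 0ℚ
rowWeight-many                  i≢j Vec.here        Vec.here        = contradiction refl i≢j
rowWeight-many                  i≢j Vec.here        (Vec.there j∈b) = rowWeight-∈ j∈b
rowWeight-many                  i≢j (Vec.there i∈b) Vec.here        = rowWeight-∈ i∈b
rowWeight-many {b = outside ∷ _} i≢j (Vec.there i∈b) (Vec.there j∈b) = rowWeight-many (i≢j ∘ cong suc) i∈b j∈b
rowWeight-many {b = inside ∷ _}  i≢j (Vec.there i∈b) (Vec.there j∈b) = rowWeight-many (i≢j ∘ cong suc) i∈b j∈b

∑-rowWeight : ∀ {k} x y (h : Subset k → ℚ) → ∑ᵠ (λ b → rowWeight x y b * h b) ≡ x * h ⊥ + y * ∑ᶠ (λ i → h ⁅ i ⁆)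
∑-rowWeight {zero} x y h = trans (∑ʷ-zero _) (trans (solve 3 (λ x y z → x :* z := x :* z :+ y :* con 0ℚ) refl x y (h []))
  (cong (λ z → x * h [] + y * z) (sym (∑ᶠ-zero _))))
∑-rowWeight {suc k} x y h = begin
  ∑ᵠ (λ b → rowWeight x y b * h b)
    ≡⟨ ∑ᵠ-suc _ ⟩
  ∑ᵠ (λ b → rowWeight x y b * h (outside ∷ b)) + ∑ᵠ (λ b → rowWeight y 0ℚ b * h (inside ∷ b))
    ≡⟨ cong₂ _+_ (∑-rowWeight x y (λ b → h (outside ∷ b))) (∑-rowWeight y 0ℚ (λ b → h (inside ∷ b))) ⟩
  x * h ⊥ + y * s₀ + (y * h ⁅ zero ⁆ + 0ℚ * s₁)
    ≡⟨ solve 6 (λ x y a b c d → x :* a :+ y :* c :+ (y :* b :+ con 0ℚ :* d) := x :* a :+ y :* (b :+ c)) refl x y (h ⊥) (h ⁅ zero ⁆) s₀ s₁ ⟩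
  x * h ⊥ + y * (h ⁅ zero ⁆ + s₀)
    ≡⟨ cong (λ z → x * h ⊥ + y * z) (∑ᶠ-suc (λ i → h ⁅ i ⁆)) ⟨
  x * h ⊥ + y * ∑ᶠ (λ i → h ⁅ i ⁆) ∎
  where
  open ≡-Reasoning
  s₀ = ∑ᶠ (λ i → h (outside ∷ ⁅ i ⁆))
  s₁ = ∑ᶠ (λ i → h (inside ∷ ⁅ i ⁆))

𝔼-∈ : ∀ {k a} → 0ℚ ≤ᵠ a → a ≤ᵠ 1ℚ → ∀ (i : Fin k) → 𝔼 a (λ b → ⟦ i ∈? b ⟧) ≡ a
𝔼-∈ {suc k} {a} 0≤a a≤1 zero = trans (∑ʷ-suc _) (trans
  (cong₂ (λ x y → (1ℚ - a) * x + a * y) (zero-hom (𝔼-positive {k} 0≤a a≤1)) (𝔼-one {k} a))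
  (solve 1 (λ a → (con 1ℚ :- a) :* con 0ℚ :+ a :* con 1ℚ := a) refl a))
𝔼-∈ {suc k} {a} 0≤a a≤1 (suc i) = trans (∑ʷ-suc _) (trans
  (cong₂ (λ x y → (1ℚ - a) * x + a * y) (tail outside) (tail inside))
  (solve 1 (λ a → (con 1ℚ :- a) :* a :+ a :* a := a) refl a))
  where
  tail : ∀ s → 𝔼 a (λ b → ⟦ suc i ∈? s ∷ b ⟧) ≡ a
  tail s = trans (≗-cong (𝔼-positive 0≤a a≤1) λ b → ⟦⟧-cong (suc i ∈? s ∷ b) (i ∈? b) Sub.drop-there Vec.there)
    (𝔼-∈ 0≤a a≤1 i)

term≤∑ᶠ : ∀ {k} (f : Fin k → ℚ) → (∀ i → 0ℚ ≤ᵠ f i) → ∀ i → f i ≤ᵠ ∑ᶠ f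
term≤∑ᶠ f 0≤f zero    = ≤-respʳ (p≤p+q (nonneg ∑ᶠ-positive λ i → 0≤f (suc i))) (sym (∑ᶠ-suc f))
term≤∑ᶠ f 0≤f (suc i) = ≤-respʳ
  (ℚ.≤-trans (term≤∑ᶠ (λ i → f (suc i)) (λ i → 0≤f (suc i)) i) (q≤p+q (0≤f zero))) (sym (∑ᶠ-suc f))

module _ (k : ℕ) .{{_ : NonZero k}} (p : ℚ) where

  -- Law of one row of the coloured random set: void with probability 1 - p, otherwise one uniformly
  -- random colour. `𝕄` is the product of n such laws, and `∑-μᵠ` identifies it with the given law.
  𝔹 : (Subset k → ℚ) → ℚ
  𝔹 h = (1ℚ - p) * h ⊥ + p * 1/ k * ∑ᶠ (λ i → h ⁅ i ⁆)

  𝕄 : ∀ n → (Subset (n ℕ.* k) → ℚ) → ℚ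
  𝕄 zero    f = f []
  𝕄 (suc n) f = 𝔹 (λ b → 𝕄 n (λ r → f (b ++ r)))

  μᵠ : ∀ n → Subset (n ℕ.* k) → ℚ
  μᵠ n S = ⟦ distinctElements? {n} {k} S ⟧ * ((p * 1/ k) ^ ∣ S ∣ * (1ℚ - p) ^ (n ℕ.∸ ∣ S ∣))

  private
    a = p * 1/ k

    μᵠ-++ : ∀ n b (r : Subset (n ℕ.* k)) → μᵠ (suc n) (b ++ r) ≡ rowWeight (1ℚ - p) a b * μᵠ n r
    μᵠ-++ n b r with row b
    ... | empty = begin
      ⟦ distinctElements? {suc n} {k} (⊥ ++ r) ⟧ * (a ^ ∣ ⊥ {k} ++ r ∣ * (1ℚ - p) ^ (suc n ℕ.∸ ∣ ⊥ {k} ++ r ∣))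
        ≡⟨ cong₂ (λ x s → x * (a ^ s * (1ℚ - p) ^ (suc n ℕ.∸ s)))
             (⟦⟧-cong (distinctElements? {suc n} {k} (⊥ ++ r)) (distinctElements? {n} {k} r) (distinct-++⁻ʳ {n}) (distinct-++ {n} ⊥-unique))
             (trans (∣++∣ (⊥ {k}) r) (cong (ℕ._+ ∣ r ∣) (Sub.∣⊥∣≡0 k))) ⟩
      D * (a ^ ∣ r ∣ * (1ℚ - p) ^ (suc n ℕ.∸ ∣ r ∣))
        -- The truncated difference gains one factor only if ∣ r ∣ ≤ n, which holds when the
        -- elements of r are distinct; otherwise both sides are multiplied by 0.
        ≡⟨ ⟦⟧*-cong (distinctElements? {n} {k} r) (λ d → cong (λ e → a ^ ∣ r ∣ * (1ℚ - p) ^ e)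
             (ℕ.+-∸-assoc 1 (subst (_≤ n) (sym (distinct-size {n} {k} r d)) (Sub.∣p∣≤n (elements {n} {k} r))))) ⟩
      D * (a ^ ∣ r ∣ * ((1ℚ - p) * (1ℚ - p) ^ (n ℕ.∸ ∣ r ∣)))
        ≡⟨ solve 4 (λ d x y z → d :* (x :* (y :* z)) := y :* (d :* (x :* z))) refl D (a ^ ∣ r ∣) (1ℚ - p) ((1ℚ - p) ^ (n ℕ.∸ ∣ r ∣)) ⟩
      (1ℚ - p) * μᵠ n r
        ≡⟨ cong (_* μᵠ n r) (rowWeight-⊥ {k} (1ℚ - p) a) ⟨
      rowWeight {k} (1ℚ - p) a ⊥ * μᵠ n r ∎
      where
      open ≡-Reasoning
      D = ⟦ distinctElements? {n} {k} r ⟧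
    ... | single c = begin
      ⟦ distinctElements? {suc n} {k} (⁅ c ⁆ ++ r) ⟧ * (a ^ ∣ ⁅ c ⁆ ++ r ∣ * (1ℚ - p) ^ (suc n ℕ.∸ ∣ ⁅ c ⁆ ++ r ∣))
        ≡⟨ cong₂ (λ x s → x * (a ^ s * (1ℚ - p) ^ (suc n ℕ.∸ s)))
             (⟦⟧-cong (distinctElements? {suc n} {k} (⁅ c ⁆ ++ r)) (distinctElements? {n} {k} r) (distinct-++⁻ʳ {n}) (distinct-++ {n} (⁅⁆-unique c)))
             (trans (∣++∣ ⁅ c ⁆ r) (cong (ℕ._+ ∣ r ∣) (Sub.∣⁅x⁆∣≡1 c))) ⟩
      D * (a * a ^ ∣ r ∣ * (1ℚ - p) ^ (n ℕ.∸ ∣ r ∣))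
        ≡⟨ solve 4 (λ d x y z → d :* (y :* x :* z) := y :* (d :* (x :* z))) refl D (a ^ ∣ r ∣) a ((1ℚ - p) ^ (n ℕ.∸ ∣ r ∣)) ⟩
      a * μᵠ n r
        ≡⟨ cong (_* μᵠ n r) (rowWeight-⁅⁆ (1ℚ - p) a c) ⟨
      rowWeight (1ℚ - p) a ⁅ c ⁆ * μᵠ n r ∎
      where
      open ≡-Reasoning
      D = ⟦ distinctElements? {n} {k} r ⟧
    ... | many i j i≢j i∈b j∈b = trans
      (trans (cong (_* x) (⟦⟧-no (distinctElements? {suc n} {k} (b ++ r)) (λ d → i≢j (distinct-++⁻ˡ {n} d i j i∈b j∈b)))) (ℚ.*-zeroˡ x))
      (sym (trans (cong (_* μᵠ n r) (rowWeight-many i≢j i∈b j∈b)) (ℚ.*-zeroˡ (μᵠ n r))))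
      where x = a ^ ∣ b ++ r ∣ * (1ℚ - p) ^ (suc n ℕ.∸ ∣ b ++ r ∣)

  -- The weight of `b ++ r` splits off a row weight, and the sum over b retains only the void row
  -- and the singletons.
  ∑-μᵠ : ∀ n (f : Subset (n ℕ.* k) → ℚ) → ∑ᵠ (λ S → μᵠ n S * f S) ≡ 𝕄 n f
  ∑-μᵠ zero f = trans (∑ʷ-zero _) (trans
    (cong (λ x → x * (1ℚ * 1ℚ) * f []) (⟦⟧-yes (distinctElements? {0} {k} []) λ ()))
    (ℚ.*-identityˡ (f [])))
  ∑-μᵠ (suc n) f = begin
    ∑ᵠ (λ S → μᵠ (suc n) S * f S)
      ≡⟨ ∑ʷ-++ k (λ S → μᵠ (suc n) S * f S) ⟩
    ∑ᵠ {k} (λ b → ∑ᵠ (λ r → μᵠ (suc n) (b ++ r) * f (b ++ r)))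
      ≡⟨ ≗-cong ∑ᵠ-positive (λ b → trans (≗-cong ∑ᵠ-positive λ r →
           trans (cong (_* f (b ++ r)) (μᵠ-++ n b r)) (ℚ.*-assoc (rowWeight (1ℚ - p) a b) (μᵠ n r) (f (b ++ r))))
           (trans (*-hom ∑ᵠ-positive (rowWeight (1ℚ - p) a b) (λ r → μᵠ n r * f (b ++ r)))
             (cong (rowWeight (1ℚ - p) a b *_) (∑-μᵠ n (λ r → f (b ++ r)))))) ⟩
    ∑ᵠ (λ b → rowWeight (1ℚ - p) a b * 𝕄 n (λ r → f (b ++ r)))
      ≡⟨ ∑-rowWeight (1ℚ - p) a (λ b → 𝕄 n (λ r → f (b ++ r))) ⟩
    𝕄 (suc n) f ∎
    where open ≡-Reasoning

  module _ (0≤p : 0ℚ ≤ᵠ p) (p≤1 : p ≤ᵠ 1ℚ) where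

    private
      0≤a : 0ℚ ≤ᵠ a
      0≤a = *-nonneg 0≤p (1/k-nonneg k)
      a≤1 : a ≤ᵠ 1ℚ
      a≤1 = ℚ.≤-trans (p*q≤q p≤1 (1/k-nonneg k)) (1/k≤1 k)

    𝔹-positive : IsPositive 𝔹
    𝔹-positive = +-positive (*-positive (≤⇒0≤- p≤1) (eval-positive ⊥))
      (*-positive 0≤a (pullback-positive ⁅_⁆ ∑ᶠ-positive))

    𝕄-positive : ∀ n → IsPositive (𝕄 n)
    𝕄-positive zero    = eval-positive []
    𝕄-positive (suc n) = iterate-positive 𝔹-positive λ b → pullback-positive (b ++_) (𝕄-positive n)

    𝔹-const : ∀ c → 𝔹 (λ _ → c) ≡ c
    𝔹-const c = trans (cong (λ x → (1ℚ - p) * c + x) (begin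
      p * 1/ k * ∑ᶠ {k} (λ _ → c)  ≡⟨ cong (p * 1/ k *_) (∑ᶠ-const {k} c) ⟩
      p * 1/ k * k · c             ≡⟨ ℚ.*-assoc p (1/ k) (k · c) ⟩
      p * (1/ k * k · c)           ≡⟨ cong (p *_) (*-·-comm k (1/ k) c) ⟩
      p * k · (1/ k * c)           ≡⟨ cong (λ x → p * k · x) (ℚ.*-comm (1/ k) c) ⟩
      p * k · (c * 1/ k)           ≡⟨ cong (p *_) (*-·-comm k c (1/ k)) ⟨
      p * (c * k · 1/ k)           ≡⟨ cong (λ x → p * (c * x)) (k·1/k≡1 k) ⟩
      p * (c * 1ℚ)                 ∎))
      (solve 2 (λ p c → (con 1ℚ :- p) :* c :+ p :* (c :* con 1ℚ) := c) refl p c)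
      where open ≡-Reasoning

    -- If G holds at the void row, both sides are 1. Otherwise a single point of b brings G about,
    -- and both laws give each point the same probability a.
    row-dominated : ∀ {G : Pred (Subset k) 0ℓ} (G? : Decidable G) → (∀ b → G ⊥ → G b) →
      (∀ b → ¬ G ⊥ → G b → ∃[ i ] (i ∈ b × G ⁅ i ⁆)) → 𝔼 a (λ b → ⟦ G? b ⟧) ≤ᵠ 𝔹 (λ b → ⟦ G? b ⟧)
    row-dominated {G} G? up witness with G? ⊥
    ... | yes G⊥ = ℚ.≤-reflexive (trans (≗-cong (𝔼-positive 0≤a a≤1) all-one) (trans (𝔼-one {k} a) (sym
      (trans (cong (λ x → (1ℚ - p) * 1ℚ + p * 1/ k * x) (≗-cong ∑ᶠ-positive λ i → all-one ⁅ i ⁆)) (𝔹-const 1ℚ)))))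
      where
      all-one : ∀ b → ⟦ G? b ⟧ ≡ 1ℚ
      all-one b = ⟦⟧-yes (G? b) (up b G⊥)
    ... | no ¬G⊥ = begin
      𝔼 a (λ b → ⟦ G? b ⟧)
        ≤⟨ mono (𝔼-positive 0≤a a≤1) union-bound ⟩
      𝔼 a (λ b → ∑ᶠ (λ i → ⟦ i ∈? b ⟧ * c i))
        ≡⟨ ∑ᶠ-swap (𝔼-positive 0≤a a≤1) (λ i b → ⟦ i ∈? b ⟧ * c i) ⟩
      ∑ᶠ (λ i → 𝔼 a (λ b → ⟦ i ∈? b ⟧ * c i))
        ≡⟨ ≗-cong ∑ᶠ-positive (λ i → trans (*-homʳ (𝔼-positive 0≤a a≤1) (λ b → ⟦ i ∈? b ⟧) (c i)) (cong (_* c i) (𝔼-∈ 0≤a a≤1 i))) ⟩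
      ∑ᶠ (λ i → a * c i)
        ≡⟨ *-hom ∑ᶠ-positive a c ⟩
      a * ∑ᶠ c
        ≡⟨ solve 2 (λ p x → x := (con 1ℚ :- p) :* con 0ℚ :+ x) refl p (a * ∑ᶠ c) ⟩
      (1ℚ - p) * 0ℚ + a * ∑ᶠ c ∎
      where
      open ℚ.≤-Reasoning
      c : Fin k → ℚ
      c i = ⟦ G? ⁅ i ⁆ ⟧
      term-nonneg : ∀ b i → 0ℚ ≤ᵠ ⟦ i ∈? b ⟧ * c i
      term-nonneg b i = *-nonneg (⟦⟧-nonneg (i ∈? b)) (⟦⟧-nonneg (G? ⁅ i ⁆))
      union-bound : ∀ b → ⟦ G? b ⟧ ≤ᵠ ∑ᶠ (λ i → ⟦ i ∈? b ⟧ * c i)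
      union-bound b = ⟦⟧-≤ (G? b) (nonneg ∑ᶠ-positive (term-nonneg b)) λ Gb →
        let i , i∈b , Gi = witness b ¬G⊥ Gb
        in ≤-respˡ (sym (cong₂ _*_ (⟦⟧-yes (i ∈? b) i∈b) (⟦⟧-yes (G? ⁅ i ⁆) Gi)))
                   (term≤∑ᶠ (λ i → ⟦ i ∈? b ⟧ * c i) (term-nonneg b) i)

    -- Members of G use each row at most once, so the union bound over the points of a row applies;
    -- it is an equality for the law μ, which puts at most one point in each row.
    dominated : ∀ n {G : Family (n ℕ.* k)} (G? : Decidable G) → Increasing G →
      (∀ S → G S → ∃[ E ] (G E × DistinctElements {n} {k} E × E ⊆ S)) →
      𝔼 a (λ S → ⟦ G? S ⟧) ≤ᵠ 𝕄 n (λ S → ⟦ G? S ⟧)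
    dominated zero    G? inc wit = ℚ.≤-reflexive (∑ʷ-zero _)
    dominated (suc n) {G} G? inc wit = begin
      𝔼 a (λ S → ⟦ G? S ⟧)
        ≡⟨ ∑ʷ-++ k (λ S → ⟦ G? S ⟧) ⟩
      𝔼 a (λ b → 𝔼 a (λ r → ⟦ G? (b ++ r) ⟧))
        ≡⟨ ∑ʷ-swap (𝔼-positive {k} 0≤a a≤1) (λ r b → ⟦ G? (b ++ r) ⟧) ⟩
      𝔼 a (λ r → 𝔼 a (λ b → ⟦ G? (b ++ r) ⟧))
        -- The first row changes its law while the other rows keep the product law; after exchanging
        -- back, the other rows follow with the first row held fixed.
        ≤⟨ mono (𝔼-positive 0≤a a≤1) (λ r → row-dominated (λ b → G? (b ++ r))
             (λ b → inc (++⁺-⊆ {b = ⊥} {b} {r} {r} Sub.⊥⊆ id)) (row-witness r)) ⟩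
      𝔼 a (λ r → 𝔹 (λ b → ⟦ G? (b ++ r) ⟧))
        ≡⟨ ∑ʷ-swap 𝔹-positive (λ r b → ⟦ G? (b ++ r) ⟧) ⟨
      𝔹 (λ b → 𝔼 a (λ r → ⟦ G? (b ++ r) ⟧))
        ≤⟨ mono 𝔹-positive (λ b → dominated n (λ r → G? (b ++ r))
             (λ {A} {B} A⊆B → inc (++⁺-⊆ {b = b} {b} {A} {B} id A⊆B)) (rest-witness b)) ⟩
      𝔹 (λ b → 𝕄 n (λ r → ⟦ G? (b ++ r) ⟧)) ∎
      where
      open ℚ.≤-Reasoning
      rest-witness : ∀ b r → G (b ++ r) → ∃[ E ] (G (b ++ E) × DistinctElements {n} {k} E × E ⊆ r)
      rest-witness b r Gbr with wit (b ++ r) Gbr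
      ... | E , GE , d , E⊆ with Vec.splitAt k E
      ... | b′ , r′ , refl = r′ , inc (++⁺-⊆ {b = b′} {b} {r′} {r′} (++⁻ˡ-⊆ {b = b′} {b} {r′} {r} E⊆) id) GE , distinct-++⁻ʳ {n} d , ++⁻ʳ-⊆ {b = b′} {b} {r′} {r} E⊆
      row-witness : ∀ r b → ¬ G (⊥ ++ r) → G (b ++ r) → ∃[ i ] (i ∈ b × G (⁅ i ⁆ ++ r))
      row-witness r b ¬G⊥ Gbr with wit (b ++ r) Gbr
      ... | E , GE , d , E⊆ with Vec.splitAt k E
      ... | b′ , r′ , refl with row b′
      ... | empty = contradiction (inc (++⁺-⊆ {b = ⊥} {⊥} {r′} {r} id (++⁻ʳ-⊆ {b = ⊥} {b} {r′} {r} E⊆)) GE) ¬G⊥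
      ... | single i = i , ++⁻ˡ-⊆ {b = ⁅ i ⁆} {b} {r′} {r} E⊆ (Sub.x∈⁅x⁆ i) , inc (++⁺-⊆ {b = ⁅ i ⁆} {⁅ i ⁆} {r′} {r} id (++⁻ʳ-⊆ {b = ⁅ i ⁆} {b} {r′} {r} E⊆)) GE
      ... | many i j i≢j i∈ j∈ = contradiction (distinct-++⁻ˡ {n} d i j i∈ j∈) i≢j

    -- Forgetting the colours leaves a random subset of X that contains each point independently
    -- with probability p.
    marginal : ∀ n (S : Subset n) → 𝕄 n (λ R → ⟦ S ⊆? elements {n} {k} R ⟧) ≤ᵠ p ^ ∣ S ∣
    marginal zero    []            = ℚ.≤-refl
    marginal (suc n) (outside ∷ S) = begin
      𝔹 (λ b → 𝕄 n (λ r → ⟦ outside ∷ S ⊆? elements {suc n} {k} (b ++ r) ⟧))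
        ≤⟨ mono 𝔹-positive (λ b → mono (𝕄-positive n) λ r →
             ⟦⟧-mono (outside ∷ S ⊆? elements {suc n} {k} (b ++ r)) (S ⊆? elements {n} {k} r)
               (λ h → drop-∷-⊆ (subst (outside ∷ S ⊆_) (elements-++ {n} {k} {b}) h))) ⟩
      𝔹 (λ b → 𝕄 n (λ r → ⟦ S ⊆? elements {n} {k} r ⟧))
        ≡⟨ 𝔹-const _ ⟩
      𝕄 n (λ r → ⟦ S ⊆? elements {n} {k} r ⟧)
        ≤⟨ marginal n S ⟩
      p ^ ∣ S ∣ ∎
      where open ℚ.≤-Reasoning
    marginal (suc n) (inside ∷ S) = begin
      (1ℚ - p) * 𝕄 n (λ r → ⟦ inside ∷ S ⊆? elements {suc n} {k} (⊥ ++ r) ⟧) +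
      a * ∑ᶠ (λ i → 𝕄 n (λ r → ⟦ inside ∷ S ⊆? elements {suc n} {k} (⁅ i ⁆ ++ r) ⟧))
        ≤⟨ ℚ.+-mono-≤
             (ℚ.≤-reflexive (cong ((1ℚ - p) *_) (trans (≗-cong (𝕄-positive n) λ r →
               ⟦⟧-no (inside ∷ S ⊆? elements {suc n} {k} (⊥ ++ r))
                 (λ h → contradiction (subst (zero ∈_) (elements-⊥++ {n} r) (h Vec.here)) λ ())) (zero-hom (𝕄-positive n)))))
             (*-monoʳ-≤ 0≤a (mono ∑ᶠ-positive λ i → mono (𝕄-positive n) λ r →
               ⟦⟧-mono (inside ∷ S ⊆? elements {suc n} {k} (⁅ i ⁆ ++ r)) (S ⊆? elements {n} {k} r)
                 (λ h → drop-∷-⊆ (subst (inside ∷ S ⊆_) (elements-++ {n} {k} {⁅ i ⁆}) h)))) ⟩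
      (1ℚ - p) * 0ℚ + a * ∑ᶠ {k} (λ i → X)
        -- Adding and subtracting the contribution of the void row makes the first part the row
        -- average of a constant.
        ≡⟨ solve 3 (λ p y x → (con 1ℚ :- p) :* con 0ℚ :+ y := (con 1ℚ :- p) :* x :+ y :- (con 1ℚ :- p) :* x) refl p (a * ∑ᶠ {k} (λ i → X)) X ⟩
      𝔹 (λ b → X) - (1ℚ - p) * X
        ≡⟨ cong (_- (1ℚ - p) * X) (𝔹-const X) ⟩
      X - (1ℚ - p) * X
        ≡⟨ solve 2 (λ p x → x :- (con 1ℚ :- p) :* x := p :* x) refl p X ⟩
      p * X
        ≤⟨ *-monoʳ-≤ 0≤p (marginal n S) ⟩
      p * p ^ ∣ S ∣ ∎
      where
      open ℚ.≤-Reasoning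
      X = 𝕄 n (λ r → ⟦ S ⊆? elements {n} {k} r ⟧)

-- Random injective colourings

private
  variable
    A : Set

-- Sum over the ways of removing one entry of the list.
pick : List A → (A × List A → ℚ) → ℚ
pick []       f = 0ℚ
pick (x ∷ xs) f = f (x , xs) + pick xs (λ (y , ys) → f (y , x ∷ ys))

pick-positive : ∀ (U : List A) → IsPositive (pick U)
pick-positive []       = zero-positive
pick-positive (x ∷ xs) = +-positive (eval-positive (x , xs))
  (pullback-positive (λ (y , ys) → y , x ∷ ys) (pick-positive xs))

-- The comparison may use that x and R make up U; lengths and uniqueness pass to R through this
-- permutation.
pick-mono : ∀ (U : List A) {f g} → (∀ x R → x ∷ R ↭ U → f (x , R) ≤ᵠ g (x , R)) → pick U f ≤ᵠ pick U g
pick-mono []       f≤g = ℚ.≤-refl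
pick-mono (x ∷ xs) f≤g = ℚ.+-mono-≤ (f≤g x xs ↭-refl)
  (pick-mono xs λ y ys σ → f≤g y (x ∷ ys) (↭-trans (↭-swap y x ↭-refl) (↭-prep x σ)))

pick-cong : ∀ (U : List A) {f g} → (∀ x R → x ∷ R ↭ U → f (x , R) ≡ g (x , R)) → pick U f ≡ pick U g
pick-cong U f≡g = ℚ.≤-antisym (pick-mono U λ x R σ → ℚ.≤-reflexive (f≡g x R σ))
                              (pick-mono U λ x R σ → ℚ.≤-reflexive (sym (f≡g x R σ)))

pick-const : ∀ (U : List A) c → pick U (λ _ → c) ≡ length U · c
pick-const []       c = refl
pick-const (x ∷ xs) c = cong (c +_) (pick-const xs c)

-- Removing two entries in either order leaves the same list, so the double sum is symmetric in
-- them.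
pick-swap : ∀ (U : List A) (f : A → A → List A → ℚ) →
  pick U (λ (x , R) → pick R (λ (y , Q) → f x y Q)) ≡ pick U (λ (y , R) → pick R (λ (x , Q) → f x y Q))
pick-swap []       f = refl
pick-swap (x ∷ xs) f = begin
  pick xs (λ (y , Q) → f x y Q) + pick xs (λ (y , ys) → f y x ys + pick ys (λ (z , Q) → f y z (x ∷ Q)))
    ≡⟨ cong (pick xs (λ (y , Q) → f x y Q) +_) (+-hom (pick-positive xs) _ _) ⟩
  pick xs (λ (y , Q) → f x y Q) + (pick xs (λ (y , ys) → f y x ys) + pick xs (λ (y , ys) → pick ys (λ (z , Q) → f y z (x ∷ Q))))
    ≡⟨ cong (λ s → pick xs (λ (y , Q) → f x y Q) + (pick xs (λ (y , ys) → f y x ys) + s)) (pick-swap xs (λ y z Q → f y z (x ∷ Q))) ⟩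
  pick xs (λ (y , Q) → f x y Q) + (pick xs (λ (y , ys) → f y x ys) + pick xs (λ (y , ys) → pick ys (λ (z , Q) → f z y (x ∷ Q))))
    ≡⟨ solve 3 (λ a b c → a :+ (b :+ c) := b :+ (a :+ c)) refl (pick xs (λ (y , Q) → f x y Q)) (pick xs (λ (y , ys) → f y x ys))
         (pick xs (λ (y , ys) → pick ys (λ (z , Q) → f z y (x ∷ Q)))) ⟩
  pick xs (λ (y , Q) → f y x Q) + (pick xs (λ (y , ys) → f x y ys) + pick xs (λ (y , ys) → pick ys (λ (z , Q) → f z y (x ∷ Q))))
    ≡⟨ cong (pick xs (λ (y , Q) → f y x Q) +_) (+-hom (pick-positive xs) _ _) ⟨
  pick xs (λ (y , Q) → f y x Q) + pick xs (λ (y , ys) → f x y ys + pick ys (λ (z , Q) → f z y (x ∷ Q))) ∎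
  where open ≡-Reasoning

-- 1 / u, with the value 0 at u = 0.
inv : ℕ → ℚ
inv zero    = 0ℚ
inv (suc u) = 1/ (suc u)

inv-nonneg : ∀ u → 0ℚ ≤ᵠ inv u
inv-nonneg zero    = ℚ.≤-refl
inv-nonneg (suc u) = 1/k-nonneg (suc u)

avg : List A → (A × List A → ℚ) → ℚ
avg U f = inv (length U) * pick U f

avg-positive : ∀ (U : List A) → IsPositive (avg U)
avg-positive U = *-positive (inv-nonneg (length U)) (pick-positive U)

avg-mono : ∀ (U : List A) {f g} → (∀ x R → x ∷ R ↭ U → f (x , R) ≤ᵠ g (x , R)) → avg U f ≤ᵠ avg U g
avg-mono U f≤g = *-monoʳ-≤ (inv-nonneg (length U)) (pick-mono U f≤g)

avg-cong : ∀ (U : List A) {f g} → (∀ x R → x ∷ R ↭ U → f (x , R) ≡ g (x , R)) → avg U f ≡ avg U g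
avg-cong U f≡g = cong (inv (length U) *_) (pick-cong U f≡g)

avg-const : ∀ (U : List A) → 1 ≤ length U → ∀ c → avg U (λ _ → c) ≡ c
avg-const U@(_ ∷ R) _ c = begin
  inv u * pick U (λ _ → c)  ≡⟨ cong (inv u *_) (pick-const U c) ⟩
  inv u * u · c             ≡⟨ *-·-comm u (inv u) c ⟩
  u · (inv u * c)           ≡⟨ cong (u ·_) (ℚ.*-comm (inv u) c) ⟩
  u · (c * inv u)           ≡⟨ *-·-comm u c (inv u) ⟨
  c * u · inv u             ≡⟨ cong (c *_) (k·1/k≡1 u) ⟩
  c * 1ℚ                    ≡⟨ ℚ.*-identityʳ c ⟩
  c                         ∎
  where
  open ≡-Reasoning
  u = suc (length R)

avg-swap : ∀ (U : List A) (f : A → A → List A → ℚ) →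
  avg U (λ (x , R) → avg R (λ (y , Q) → f x y Q)) ≡ avg U (λ (y , R) → avg R (λ (x , Q) → f x y Q))
avg-swap U f = cong (inv (length U) *_) (begin
  pick U (λ (x , R) → avg R (λ (y , Q) → f x y Q))                         ≡⟨ factor (λ x R → pick R (λ (y , Q) → f x y Q)) ⟩
  inv (ℕ.pred (length U)) * pick U (λ (x , R) → pick R (λ (y , Q) → f x y Q)) ≡⟨ cong (inv (ℕ.pred (length U)) *_) (pick-swap U f) ⟩
  inv (ℕ.pred (length U)) * pick U (λ (y , R) → pick R (λ (x , Q) → f x y Q)) ≡⟨ factor (λ y R → pick R (λ (x , Q) → f x y Q)) ⟨
  pick U (λ (y , R) → avg R (λ (x , Q) → f x y Q))                         ∎)
  where
  open ≡-Reasoning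
  -- The inner normalisation depends only on the length of R, which is one less than that of U
  -- whichever entry is removed.
  factor : ∀ g → pick U (λ (x , R) → inv (length R) * g x R) ≡ inv (ℕ.pred (length U)) * pick U (λ (x , R) → g x R)
  factor g = trans (pick-cong U λ x R σ → cong (λ l → inv (ℕ.pred l) * g x R) (↭-length σ)) (*-hom (pick-positive U) (inv (ℕ.pred (length U))) (λ (x , R) → g x R))

Unique-pick : ∀ {x : A} {R U} → Unique U → x ∷ R ↭ U → Unique (x ∷ R)
Unique-pick {A} unique σ = Permutation.Unique-resp-↭ (setoid A) (↭⇒↭ₛ (↭-sym σ)) unique

Unique-rest : ∀ {x : A} {R U} → Unique U → x ∷ R ↭ U → Unique R
Unique-rest unique σ with Unique-pick unique σ
... | _ ∷ unique-R = unique-R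

module _ {k : ℕ} where

  -- Expectation over a uniformly random injective colouring of T with colours from U.
  𝔸 : ∀ {n} → Subset n → List (Fin k) → (Subset (n ℕ.* k) → ℚ) → ℚ
  𝔸 []            U h = h []
  𝔸 (outside ∷ T) U h = 𝔸 T U (λ r → h (⊥ ++ r))
  𝔸 (inside ∷ T)  U h = avg U (λ (c , R) → 𝔸 T R (λ r → h (⁅ c ⁆ ++ r)))

  𝔸-positive : ∀ {n} (T : Subset n) U → IsPositive (𝔸 T U)
  𝔸-positive []            U = eval-positive []
  𝔸-positive (outside ∷ T) U = pullback-positive (⊥ ++_) (𝔸-positive T U)
  𝔸-positive (inside ∷ T)  U = iterate-positive (avg-positive U)
    λ (c , R) → pullback-positive (⁅ c ⁆ ++_) (𝔸-positive T R)

  length-pick : ∀ {x : Fin k} {R U} {t} → x ∷ R ↭ U → suc t ≤ length U → t ≤ length R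
  length-pick σ t<U = ℕ.s≤s⁻¹ (subst (_ ≤_) (sym (↭-length σ)) t<U)

  𝔸-const : ∀ {n} (T : Subset n) U → ∣ T ∣ ≤ length U → ∀ c → 𝔸 T U (λ _ → c) ≡ c
  𝔸-const []            U T≤U c = refl
  𝔸-const (outside ∷ T) U T≤U c = 𝔸-const T U T≤U c
  𝔸-const (inside ∷ T)  U T≤U c = trans (avg-cong U λ x R σ → 𝔸-const T R (length-pick σ T≤U) c)
    (avg-const U (ℕ.≤-trans (ℕ.s≤s ℕ.z≤n) T≤U) c)

  -- Withholding a uniformly random colour does not change the distribution.
  𝔸-avg : ∀ {n} (T : Subset n) U h → ∣ T ∣ ℕ.< length U → avg U (λ (c , R) → 𝔸 T R h) ≡ 𝔸 T U h
  𝔸-avg []            U h T<U = avg-const U T<U (h [])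
  𝔸-avg (outside ∷ T) U h T<U = 𝔸-avg T U (λ r → h (⊥ ++ r)) T<U
  -- The withheld colour and the colour of the first point are exchangeable, so the withholding can
  -- be postponed to the remaining points.
  𝔸-avg (inside ∷ T)  U h T<U = trans (avg-swap U (λ c d Q → 𝔸 T Q (λ r → h (⁅ d ⁆ ++ r))))
    (avg-cong U λ d R σ → 𝔸-avg T R (λ r → h (⁅ d ⁆ ++ r)) (length-pick σ T<U))

  -- What holds for every colouring that `𝔸 T U` averages over. `colours∈` is the invariant that
  -- keeps a drawn colour from appearing again.
  record IsRainbowColouring {n} (T : Subset n) (U : List (Fin k)) (R : Subset (n ℕ.* k)) : Set where
    field
      distinctElements : DistinctElements {n} {k} R
      distinctColours  : DistinctColours {n} {k} R
      elements≡        : elements {n} {k} R ≡ T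
      colours∈         : ∀ x i → _∈′_ {n} {k} (x , i) R → i ∈ˡ U
  open IsRainbowColouring public

  colouring-⊥ : ∀ {n} {T : Subset n} {U r} → IsRainbowColouring T U r → IsRainbowColouring (outside ∷ T) U (⊥ ++ r)
  colouring-⊥ {n} {T} {U} {r} C = record
    { distinctElements = distinct-++ {n} ⊥-unique (distinctElements C)
    ; distinctColours  = distinct
    ; elements≡        = trans (elements-⊥++ {n} r) (cong (outside ∷_) (elements≡ C))
    ; colours∈         = λ where
        zero    i ∈r → contradiction (∈-++⁻ˡ ∈r) Sub.∉⊥
        (suc x) i ∈r → colours∈ C x i (∈-++⁻ʳ {b = ⊥ {k}} ∈r)
    }
    where
    distinct : DistinctColours {suc n} {k} (⊥ ++ r)
    distinct i zero    y       ∈₁ ∈₂ = contradiction (∈-++⁻ˡ ∈₁) Sub.∉⊥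
    distinct i (suc x) zero    ∈₁ ∈₂ = contradiction (∈-++⁻ˡ ∈₂) Sub.∉⊥
    distinct i (suc x) (suc y) ∈₁ ∈₂ = cong suc (distinctColours C i x y (∈-++⁻ʳ {b = ⊥ {k}} ∈₁) (∈-++⁻ʳ {b = ⊥ {k}} ∈₂))

  colouring-⁅⁆ : ∀ {n} {T : Subset n} {U R c r} → Unique U → c ∷ R ↭ U →
    IsRainbowColouring T R r → IsRainbowColouring (inside ∷ T) U (⁅ c ⁆ ++ r)
  colouring-⁅⁆ {n} {T} {U} {R} {c} {r} unique σ C = record
    { distinctElements = distinct-++ {n} (⁅⁆-unique c) (distinctElements C)
    ; distinctColours  = distinct
    ; elements≡        = trans (elements-⁅⁆++ {n} c r) (cong (inside ∷_) (elements≡ C))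
    ; colours∈         = λ where
        zero    i ∈r → ∈-resp-↭ σ (here (Sub.x∈⁅y⁆⇒x≡y c (∈-++⁻ˡ ∈r)))
        (suc x) i ∈r → ∈-resp-↭ σ (there (colours∈ C x i (∈-++⁻ʳ {b = ⁅ c ⁆} ∈r)))
    }
    where
    fresh : ∀ {i} → i ∈ ⁅ c ⁆ → ¬ i ∈ˡ R
    fresh i∈ i∈R with Unique-pick unique σ
    ... | c∉R ∷ _ = All-lookup c∉R i∈R (sym (Sub.x∈⁅y⁆⇒x≡y c i∈))
    distinct : DistinctColours {suc n} {k} (⁅ c ⁆ ++ r)
    distinct i zero    zero    ∈₁ ∈₂ = refl
    distinct i zero    (suc y) ∈₁ ∈₂ = contradiction (colours∈ C y i (∈-++⁻ʳ {b = ⁅ c ⁆} ∈₂)) (fresh (∈-++⁻ˡ ∈₁))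
    distinct i (suc x) zero    ∈₁ ∈₂ = contradiction (colours∈ C x i (∈-++⁻ʳ {b = ⁅ c ⁆} ∈₁)) (fresh (∈-++⁻ˡ ∈₂))
    distinct i (suc x) (suc y) ∈₁ ∈₂ = cong suc (distinctColours C i x y (∈-++⁻ʳ {b = ⁅ c ⁆} ∈₁) (∈-++⁻ʳ {b = ⁅ c ⁆} ∈₂))

  𝔸-mono : ∀ {n} (T : Subset n) U → Unique U → ∀ {h h′} → (∀ R → IsRainbowColouring T U R → h R ≤ᵠ h′ R) → 𝔸 T U h ≤ᵠ 𝔸 T U h′
  𝔸-mono []            U unique h≤ = h≤ [] (record
    { distinctElements = λ () ; distinctColours = λ _ () ; elements≡ = refl ; colours∈ = λ () })
  𝔸-mono (outside ∷ T) U unique h≤ = 𝔸-mono T U unique λ r C → h≤ (⊥ ++ r) (colouring-⊥ C)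
  𝔸-mono (inside ∷ T)  U unique h≤ = avg-mono U λ c R σ → 𝔸-mono T R (Unique-rest unique σ)
    λ r C → h≤ (⁅ c ⁆ ++ r) (colouring-⁅⁆ unique σ C)

  pick-≟ : ∀ c (U : List (Fin k)) → Unique U → pick U (λ (d , _) → ⟦ c Fin.≟ d ⟧) ≤ᵠ 1ℚ
  pick-≟ c []      unique         = 0≤1
  pick-≟ c (x ∷ U) (x∉U ∷ unique) with c Fin.≟ x
  ... | no _     = ≤-respˡ (ℚ.+-identityˡ _) (pick-≟ c U unique)
  ... | yes refl = ℚ.≤-reflexive (trans (cong (1ℚ +_) (trans
    (pick-cong U λ d R σ → ⟦⟧-no (c Fin.≟ d) (All-lookup x∉U (∈-resp-↭ σ (here refl)))) (zero-hom (pick-positive U))))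
    (ℚ.+-identityʳ 1ℚ))

-- (u - s)! / u!, and 0 for s > u.
w : ℕ → ℕ → ℚ
w u       zero    = 1ℚ
w zero    (suc s) = 0ℚ
w (suc u) (suc s) = 1/ (suc u) * w u s

w-nonneg : ∀ u s → 0ℚ ≤ᵠ w u s
w-nonneg u       zero    = 0≤1
w-nonneg zero    (suc s) = ℚ.≤-refl
w-nonneg (suc u) (suc s) = *-nonneg (1/k-nonneg (suc u)) (w-nonneg u s)

module _ {k : ℕ} where

  private
    ⊆-++ : ∀ {n} (b b′ : Subset k) (r r′ : Subset n) → ⟦ b ++ r ⊆? b′ ++ r′ ⟧ ≤ᵠ ⟦ r ⊆? r′ ⟧
    ⊆-++ b b′ r r′ = ⟦⟧-mono (b ++ r ⊆? b′ ++ r′) (r ⊆? r′) (++⁻ʳ-⊆ {b = b} {b′} {r} {r′})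

    ⊆-++-no : ∀ {n} (b b′ : Subset k) (r r′ : Subset n) → ¬ b ⊆ b′ → ⟦ b ++ r ⊆? b′ ++ r′ ⟧ ≡ 0ℚ
    ⊆-++-no b b′ r r′ b⊈b′ = ⟦⟧-no (b ++ r ⊆? b′ ++ r′) (λ h → b⊈b′ (++⁻ˡ-⊆ {b = b} {b′} {r} {r′} h))

  -- The points of S must receive prescribed colours, with probabilities 1/u, 1/(u - 1) and so on. A
  -- point of T outside S merely withholds a random colour, which by `𝔸-avg` has no effect.
  𝔸-⊆ : ∀ {n} (T : Subset n) (U : List (Fin k)) → Unique U → ∣ T ∣ ≤ length U →
    ∀ S → 𝔸 T U (λ R → ⟦ S ⊆? R ⟧) ≤ᵠ w (length U) ∣ S ∣
  𝔸-⊆ [] U unique T≤U [] = ℚ.≤-refl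
  𝔸-⊆ (outside ∷ T) U unique T≤U S with Vec.splitAt k S
  ... | b , r , refl with row b
  ... | empty = ≤-respʳ (ℚ.≤-trans (mono (𝔸-positive T U) λ R → ⊆-++ ⊥ ⊥ r R) (𝔸-⊆ T U unique T≤U r))
    (cong (w (length U)) (sym (trans (∣++∣ (⊥ {k}) r) (cong (ℕ._+ ∣ r ∣) (Sub.∣⊥∣≡0 k)))))
  ... | single c = ≤-respˡ (trans (≗-cong (𝔸-positive T U) λ R →
    ⊆-++-no ⁅ c ⁆ ⊥ r R (λ h → Sub.∉⊥ (h (Sub.x∈⁅x⁆ c)))) (zero-hom (𝔸-positive T U))) (w-nonneg (length U) ∣ ⁅ c ⁆ ++ r ∣)
  ... | many i j i≢j i∈b j∈b = ≤-respˡ (trans (≗-cong (𝔸-positive T U) λ R →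
    ⊆-++-no b ⊥ r R (λ h → Sub.∉⊥ (h i∈b))) (zero-hom (𝔸-positive T U))) (w-nonneg (length U) ∣ b ++ r ∣)
  𝔸-⊆ (inside ∷ T) U unique T≤U S with Vec.splitAt k S
  ... | b , r , refl with row b
  ... | empty = begin
    avg U (λ (c , R) → 𝔸 T R (λ R → ⟦ ⊥ ++ r ⊆? ⁅ c ⁆ ++ R ⟧))
      ≤⟨ mono (avg-positive U) (λ (c , R) → mono (𝔸-positive T R) λ R → ⊆-++ ⊥ ⁅ c ⁆ r R) ⟩
    avg U (λ (c , R) → 𝔸 T R (λ R → ⟦ r ⊆? R ⟧))
      ≡⟨ 𝔸-avg T U (λ R → ⟦ r ⊆? R ⟧) T≤U ⟩
    𝔸 T U (λ R → ⟦ r ⊆? R ⟧)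
      ≤⟨ 𝔸-⊆ T U unique (ℕ.≤-trans (ℕ.n≤1+n _) T≤U) r ⟩
    w (length U) ∣ r ∣
      ≡⟨ cong (w (length U)) (trans (∣++∣ (⊥ {k}) r) (cong (ℕ._+ ∣ r ∣) (Sub.∣⊥∣≡0 k))) ⟨
    w (length U) ∣ ⊥ {k} ++ r ∣ ∎
    where open ℚ.≤-Reasoning
  ... | many i j i≢j i∈b j∈b = ≤-respˡ
    (trans (≗-cong (avg-positive U) λ (c , R) → trans (≗-cong (𝔸-positive T R) λ R →
      ⊆-++-no b ⁅ c ⁆ r R (λ h → i≢j (⁅⁆-unique c i j (h i∈b) (h j∈b)))) (zero-hom (𝔸-positive T R)))
      (zero-hom (avg-positive U))) (w-nonneg (length U) ∣ b ++ r ∣)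
  𝔸-⊆ (inside ∷ T) U@(_ ∷ U′) unique T≤U S | b , r , refl | single c = begin
    avg U (λ (d , R) → 𝔸 T R (λ R → ⟦ ⁅ c ⁆ ++ r ⊆? ⁅ d ⁆ ++ R ⟧))
      ≤⟨ avg-mono U (λ d R σ → begin
           𝔸 T R (λ R → ⟦ ⁅ c ⁆ ++ r ⊆? ⁅ d ⁆ ++ R ⟧)
             ≤⟨ mono (𝔸-positive T R) (λ R → both d R) ⟩
           𝔸 T R (λ R → ⟦ c Fin.≟ d ⟧ * ⟦ r ⊆? R ⟧)
             ≡⟨ *-hom (𝔸-positive T R) ⟦ c Fin.≟ d ⟧ (λ R → ⟦ r ⊆? R ⟧) ⟩
           ⟦ c Fin.≟ d ⟧ * 𝔸 T R (λ R → ⟦ r ⊆? R ⟧)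
             ≤⟨ *-monoʳ-≤ (⟦⟧-nonneg (c Fin.≟ d)) (𝔸-⊆ T R (Unique-rest unique σ) (length-pick σ T≤U) r) ⟩
           ⟦ c Fin.≟ d ⟧ * w (length R) ∣ r ∣
             ≡⟨ cong (λ l → ⟦ c Fin.≟ d ⟧ * w l ∣ r ∣) (ℕ.suc-injective (↭-length σ)) ⟩
           ⟦ c Fin.≟ d ⟧ * w (length U′) ∣ r ∣ ∎) ⟩
    avg U (λ (d , R) → ⟦ c Fin.≟ d ⟧ * w (length U′) ∣ r ∣)
      ≡⟨ cong (1/ (length U) *_) (*-homʳ (pick-positive U) (λ (d , R) → ⟦ c Fin.≟ d ⟧) (w (length U′) ∣ r ∣)) ⟩
    1/ (length U) * (pick U (λ (d , R) → ⟦ c Fin.≟ d ⟧) * w (length U′) ∣ r ∣)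
      ≤⟨ *-monoʳ-≤ (1/k-nonneg (length U)) (p*q≤q (pick-≟ c U unique) (w-nonneg (length U′) ∣ r ∣)) ⟩
    w (length U) (suc ∣ r ∣)
      ≡⟨ cong (w (length U)) (trans (∣++∣ ⁅ c ⁆ r) (cong (ℕ._+ ∣ r ∣) (Sub.∣⁅x⁆∣≡1 c))) ⟨
    w (length U) ∣ ⁅ c ⁆ ++ r ∣ ∎
    where
    open ℚ.≤-Reasoning
    both : ∀ d R → ⟦ ⁅ c ⁆ ++ r ⊆? ⁅ d ⁆ ++ R ⟧ ≤ᵠ ⟦ c Fin.≟ d ⟧ * ⟦ r ⊆? R ⟧
    both d R = ⟦⟧-≤ (⁅ c ⁆ ++ r ⊆? ⁅ d ⁆ ++ R) (*-nonneg (⟦⟧-nonneg (c Fin.≟ d)) (⟦⟧-nonneg (r ⊆? R)))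
      λ h → ℚ.≤-reflexive (sym (cong₂ _*_
        (⟦⟧-yes (c Fin.≟ d) (Sub.x∈⁅y⁆⇒x≡y d (++⁻ˡ-⊆ {b = ⁅ c ⁆} {⁅ d ⁆} {r} {R} h (Sub.x∈⁅x⁆ c))))
        (⟦⟧-yes (r ⊆? R) (++⁻ʳ-⊆ {b = ⁅ c ⁆} {⁅ d ⁆} {r} {R} h))))

-- From falling factorials to powers of 4/k

·-distrib-+ : ∀ m n x → (m ℕ.+ n) · x ≡ m · x + n · x
·-distrib-+ zero    n x = sym (ℚ.+-identityˡ (n · x))
·-distrib-+ (suc m) n x = trans (cong (x +_) (·-distrib-+ m n x)) (sym (ℚ.+-assoc x (m · x) (n · x)))

·-monoˡ-≤ : ∀ {m n x} → 0ℚ ≤ᵠ x → m ≤ n → m · x ≤ᵠ n · x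
·-monoˡ-≤ {n = n} 0≤x ℕ.z≤n       = ·-nonneg n 0≤x
·-monoˡ-≤ {x = x} 0≤x (ℕ.s≤s m≤n) = ℚ.+-monoʳ-≤ x (·-monoˡ-≤ 0≤x m≤n)

bernoulli : ∀ {y} s → 0ℚ ≤ᵠ y → y ≤ᵠ 1ℚ → 1ℚ - s · y ≤ᵠ (1ℚ - y) ^ s
bernoulli     zero    0≤y y≤1 = ℚ.≤-refl
bernoulli {y} (suc s) 0≤y y≤1 = begin
  1ℚ - (y + s · y)                ≤⟨ p≤p+q (*-nonneg 0≤y (·-nonneg s 0≤y)) ⟩
  1ℚ - (y + s · y) + y * s · y    ≡⟨ solve 2 (λ y z → con 1ℚ :- (y :+ z) :+ y :* z := (con 1ℚ :- y) :* (con 1ℚ :- z)) refl y (s · y) ⟩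
  (1ℚ - y) * (1ℚ - s · y)         ≤⟨ *-monoʳ-≤ (≤⇒0≤- y≤1) (bernoulli s 0≤y y≤1) ⟩
  (1ℚ - y) * (1ℚ - y) ^ s         ∎
  where open ℚ.≤-Reasoning

-- Bernoulli's inequality is applied to the two halves of s.
¼≤[1-1/[1+u]]^s : ∀ u s → s ≤ u → ½ * ½ ≤ᵠ (1ℚ - 1/ (suc u)) ^ s
¼≤[1-1/[1+u]]^s u s s≤u = begin
  ½ * ½                                    ≤⟨ *-mono-≤ 0≤½ (ℚ.≤-trans 0≤½ h₂) h₁ h₂ ⟩
  (1ℚ - y) ^ ℕ.⌊ s /2⌋ * (1ℚ - y) ^ ℕ.⌈ s /2⌉  ≡⟨ ^-distribˡ-+ (1ℚ - y) ℕ.⌊ s /2⌋ ℕ.⌈ s /2⌉ ⟨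
  (1ℚ - y) ^ (ℕ.⌊ s /2⌋ ℕ.+ ℕ.⌈ s /2⌉)     ≡⟨ cong ((1ℚ - y) ^_) (ℕ.⌊n/2⌋+⌈n/2⌉≡n s) ⟩
  (1ℚ - y) ^ s                             ∎
  where
  open ℚ.≤-Reasoning
  y = 1/ (suc u)
  0≤y = 1/k-nonneg (suc u)
  half : ∀ j → j ℕ.+ j ≤ suc u → ½ ≤ᵠ (1ℚ - y) ^ j
  half j 2j≤ = ℚ.≤-trans (0≤-⇒≤ (≤-respʳ (*-nonneg 0≤½ (≤⇒0≤- 2jy≤1))
      (solve 1 (λ z → con ½ :* (con 1ℚ :- (z :+ z)) := con 1ℚ :- z :- con ½) refl (j · y))))
    (bernoulli j 0≤y (1/k≤1 (suc u)))
    where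
    2jy≤1 : j · y + j · y ≤ᵠ 1ℚ
    2jy≤1 = begin
      j · y + j · y  ≡⟨ ·-distrib-+ j j y ⟨
      (j ℕ.+ j) · y  ≤⟨ ·-monoˡ-≤ 0≤y 2j≤ ⟩
      suc u · y      ≡⟨ k·1/k≡1 (suc u) ⟩
      1ℚ             ∎
  h₁ : ½ ≤ᵠ (1ℚ - y) ^ ℕ.⌊ s /2⌋
  h₁ = half ℕ.⌊ s /2⌋ (ℕ.≤-trans (ℕ.+-monoʳ-≤ ℕ.⌊ s /2⌋ (ℕ.⌊n/2⌋≤⌈n/2⌉ s))
    (ℕ.≤-trans (ℕ.≤-reflexive (ℕ.⌊n/2⌋+⌈n/2⌉≡n s)) (ℕ.≤-trans s≤u (ℕ.n≤1+n u))))
  h₂ : ½ ≤ᵠ (1ℚ - y) ^ ℕ.⌈ s /2⌉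
  h₂ = half ℕ.⌈ s /2⌉ (ℕ.≤-trans (ℕ.+-monoʳ-≤ ℕ.⌈ s /2⌉ (ℕ.⌊n/2⌋≤⌈n/2⌉ (suc s)))
    (ℕ.≤-trans (ℕ.≤-reflexive (ℕ.⌊n/2⌋+⌈n/2⌉≡n (suc s))) (ℕ.s≤s s≤u)))

-- Converts 1/u into 1/(1 + u) at the price of a factor 1 - 1/(1 + u); in `w≤` there are s such
-- factors, bounded together by `¼≤[1-1/[1+u]]^s`.
1/[1+u]≡ : ∀ u .{{_ : NonZero u}} → 1/ (suc u) ≡ (1ℚ - 1/ (suc u)) * 1/ u
1/[1+u]≡ u = sym (begin
  (1ℚ - y) * z           ≡⟨ cong (λ x → (x - y) * z) (k·1/k≡1 (suc u)) ⟨
  (y + u · y - y) * z    ≡⟨ solve 3 (λ y x z → (y :+ x :- y) :* z := z :* x) refl y (u · y) z ⟩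
  z * u · y              ≡⟨ *-·-comm u z y ⟩
  u · (z * y)            ≡⟨ cong (u ·_) (ℚ.*-comm z y) ⟩
  u · (y * z)            ≡⟨ *-·-comm u y z ⟨
  y * u · z              ≡⟨ cong (y *_) (k·1/k≡1 u) ⟩
  y * 1ℚ                 ≡⟨ ℚ.*-identityʳ y ⟩
  y                      ∎)
  where
  open ≡-Reasoning
  y = 1/ (suc u)
  z = 1/ u

w-zero : ∀ {u s} → u ℕ.< s → w u s ≡ 0ℚ
w-zero {zero}  {suc s} _           = refl
w-zero {suc u} {suc s} (ℕ.s≤s u<s) = trans (cong (1/ (suc u) *_) (w-zero u<s)) (ℚ.*-zeroʳ (1/ (suc u)))

-- The induction lowers k along with s, so (4/u)^s must be compared with (4/(1 + u))^s. The loss is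
-- at most a factor 4, which the additional point supplies.
w≤ : ∀ k .{{_ : NonZero k}} s → w k s ≤ᵠ (4 · 1/ k) ^ s
w≤ k       zero    = ℚ.≤-refl
w≤ (suc u) (suc s) with s ℕ.≤? u
... | no s≰u = ≤-respˡ (w-zero (ℕ.s≤s (ℕ.≰⇒> s≰u))) (^-nonneg (suc s) (·-nonneg 4 (1/k-nonneg (suc u))))
w≤ (suc zero)       (suc zero)    | yes s≤u = *-monoˡ-≤ 0≤1 (p≤p+q {1/ 1} {3 · 1/ 1} (·-nonneg 3 (1/k-nonneg 1)))
w≤ (suc zero)       (suc (suc s)) | yes ()
w≤ (suc u@(suc v)) (suc s)        | yes s≤u = begin
  y * w u s
    ≤⟨ *-monoʳ-≤ 0≤y (w≤ u s) ⟩
  y * (4 · z) ^ s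
    ≡⟨ cong (λ x → y * x ^ s) (4·≡ z) ⟩
  y * (4 · 1ℚ * z) ^ s
    ≡⟨ cong (y *_) (^-distribʳ-* (4 · 1ℚ) z s) ⟩
  y * ((4 · 1ℚ) ^ s * z ^ s)
    ≡⟨ solve 3 (λ y f z → y :* (f :* z) := y :* (con (4 · 1ℚ) :* f) :* (con (½ * ½) :* z)) refl y ((4 · 1ℚ) ^ s) (z ^ s) ⟩
  y * (4 · 1ℚ) ^ suc s * (½ * ½ * z ^ s)
    ≤⟨ *-monoʳ-≤ (*-nonneg 0≤y (^-nonneg (suc s) (·-nonneg 4 0≤1)))
         (*-monoˡ-≤ (^-nonneg s (1/k-nonneg u)) (¼≤[1-1/[1+u]]^s u s s≤u)) ⟩
  y * (4 · 1ℚ) ^ suc s * ((1ℚ - y) ^ s * z ^ s)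
    ≡⟨ cong (y * (4 · 1ℚ) ^ suc s *_) (trans (sym (^-distribʳ-* (1ℚ - y) z s)) (cong (_^ s) (sym (1/[1+u]≡ u)))) ⟩
  y * (4 · 1ℚ) ^ suc s * y ^ s
    ≡⟨ solve 3 (λ y f z → y :* f :* z := f :* (y :* z)) refl y ((4 · 1ℚ) ^ suc s) (y ^ s) ⟩
  (4 · 1ℚ) ^ suc s * y ^ suc s
    ≡⟨ ^-distribʳ-* (4 · 1ℚ) y (suc s) ⟨
  (4 · 1ℚ * y) ^ suc s
    ≡⟨ cong (_^ suc s) (4·≡ y) ⟨
  (4 · y) ^ suc s ∎
  where
  open ℚ.≤-Reasoning
  y = 1/ (suc u)
  z = 1/ u
  0≤y = 1/k-nonneg (suc u)
  4·≡ : ∀ x → 4 · x ≡ 4 · 1ℚ * x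
  4·≡ x = solve 1 (λ x → x :+ (x :+ (x :+ (x :+ con 0ℚ))) := con (4 · 1ℚ) :* x) refl x

-- Projecting the cover from X × [k] to X

module _ {n k : ℕ} where

  ∈elements⁺ : ∀ {x i} {S : Subset (n ℕ.* k)} → _∈′_ {n} {k} (x , i) S → x ∈ elements {n} {k} S
  ∈elements⁺ {x} {i} {S} ∈S = lookup⇒[]= x _ (trans (lookup∘tabulate _ x) (dec-true (Fin.any? (λ i → _∈′?_ {n} {k} (x , i) S)) (i , ∈S)))

  ∈elements⁻ : ∀ {x} {S : Subset (n ℕ.* k)} → x ∈ elements {n} {k} S → ∃[ i ] _∈′_ {n} {k} (x , i) S
  ∈elements⁻ {x} {S} x∈ with Fin.any? (λ i → _∈′?_ {n} {k} (x , i) S) | trans (sym (lookup∘tabulate (λ x → does (Fin.any? (λ i → _∈′?_ {n} {k} (x , i) S))) x)) ([]=⇒lookup x∈)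
  ... | yes found | _  = found
  ... | no _      | ()

  elements-mono : ∀ {S R : Subset (n ℕ.* k)} → S ⊆ R → elements {n} {k} S ⊆ elements {n} {k} R
  elements-mono S⊆R x∈ = let i , ∈S = ∈elements⁻ x∈ in ∈elements⁺ (S⊆R ∈S)

_≟ˢ_ : ∀ {n} (S T : Subset n) → Dec (S ≡ T)
_≟ˢ_ = ≡-dec _≟ᵇ_

∑-≟ : ∀ {n} (e : Subset n) → ∑ᵠ (λ S → ⟦ e ≟ˢ S ⟧) ≤ᵠ 1ℚ
∑-≟ [] = ℚ.≤-reflexive (∑ʷ-zero _)
∑-≟ {suc n} (outside ∷ e) = ≤-respˡ (∑ᵠ-suc _) (≤-respʳ (ℚ.+-mono-≤
  (ℚ.≤-trans (mono ∑ᵠ-positive λ S → ⟦⟧-mono ((outside ∷ e) ≟ˢ (outside ∷ S)) (e ≟ˢ S) (cong Vec.tail)) (∑-≟ e))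
  (ℚ.≤-reflexive (trans (≗-cong ∑ᵠ-positive λ S → ⟦⟧-no ((outside ∷ e) ≟ˢ (inside ∷ S)) λ ()) (zero-hom (∑ᵠ-positive {n})))))
  (ℚ.+-identityʳ 1ℚ))
∑-≟ {suc n} (inside ∷ e) = ≤-respˡ (∑ᵠ-suc _) (≤-respʳ (ℚ.+-mono-≤
  (ℚ.≤-reflexive (trans (≗-cong ∑ᵠ-positive λ S → ⟦⟧-no ((inside ∷ e) ≟ˢ (outside ∷ S)) λ ()) (zero-hom (∑ᵠ-positive {n}))))
  (ℚ.≤-trans (mono ∑ᵠ-positive λ S → ⟦⟧-mono ((inside ∷ e) ≟ˢ (inside ∷ S)) (e ≟ˢ S) (cong Vec.tail)) (∑-≟ e)))
  (ℚ.+-identityˡ 1ℚ))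

avoids-antitone : ∀ {n} {H : Family n} (H? : Decidable H) → Antitone (avoids H?)
avoids-antitone H? {A} {B} A⊆B = ⟦⟧-mono (¬? (contains? H? B)) (¬? (contains? H? A))
  λ ¬HB (S , HS , S⊆A) → ¬HB (S , HS , λ x∈S → A⊆B (S⊆A x∈S))

⟦¬⟧ : ∀ {P : Set} (P? : Dec P) → ⟦ ¬? P? ⟧ ≡ 1ℚ - ⟦ P? ⟧
⟦¬⟧ (yes _) = refl
⟦¬⟧ (no _)  = refl

module _ {n : ℕ} (k : ℕ) .{{_ : NonZero k}} {F : Family n} (F? : Decidable F)
  (m : ℕ) .{{_ : NonZero m}} (small : ∀ A → ℋ F A → ∣ A ∣ ℕ.< 2 ℕ.^ m) (≤k : ∀ A → ℋ F A → ∣ A ∣ ≤ k)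
  {p : ℚ} (0≤p : 0ℚ ≤ᵠ p) (p≤1 : p ≤ᵠ 1ℚ)
  -- 3/4 instead of 1/2, because late terms of the threshold sequence reach 1/2 only up to an error.
  (fails : 𝕄 k p n (λ S → ⟦ rainbow? k F? S ⟧) ≤ᵠ 1ℚ - ½ ^ 2) where

  private
    a = p * 1/ k * 1/ m
    c = 4 · 1/ k
    -- Chosen so that c * q = a * ½ ^ 6, the density at which the cover of the rainbow edges is
    -- cheap; k cancels here.
    q = p * 1/ m * ½ ^ 8

    0≤p/k : 0ℚ ≤ᵠ p * 1/ k
    0≤p/k = *-nonneg 0≤p (1/k-nonneg k)
    p/k≤1 : p * 1/ k ≤ᵠ 1ℚ
    p/k≤1 = ℚ.≤-trans (p*q≤q p≤1 (1/k-nonneg k)) (1/k≤1 k)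
    0≤a : 0ℚ ≤ᵠ a
    0≤a = *-nonneg 0≤p/k (1/k-nonneg m)
    a≤1 : a ≤ᵠ 1ℚ
    a≤1 = ℚ.≤-trans (p*q≤q p/k≤1 (1/k-nonneg m)) (1/k≤1 m)
    m·a≡ : m · a ≡ p * 1/ k
    m·a≡ = trans (sym (*-·-comm m (p * 1/ k) (1/ m))) (trans (cong (p * 1/ k *_) (k·1/k≡1 m)) (ℚ.*-identityʳ (p * 1/ k)))
    0≤c : 0ℚ ≤ᵠ c
    0≤c = ·-nonneg 4 (1/k-nonneg k)
    c*q≡ : c * q ≡ a * ½ ^ 6
    c*q≡ = solve 3 (λ p x y → (x :+ (x :+ (x :+ (x :+ con 0ℚ)))) :* (p :* y :* con (½ ^ 8)) := p :* x :* y :* con (½ ^ 6)) refl p (1/ k) (1/ m)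

    H? : Decidable (RainbowEdge k F)
    H? E = distinctElements? {n} {k} E ×-dec (ℋ? F? (elements {n} {k} E) ×-dec distinctColours? {n} {k} E)

    S′⁺ : IsPositive (∑ᵠ {n ℕ.* k})
    S′⁺ = ∑ᵠ-positive
    S⁺ : IsPositive (∑ᵠ {n})
    S⁺ = ∑ᵠ-positive

    cover = fractional-cover 0≤a a≤1 m H? λ E (d , hE , _) →
      subst (ℕ._< 2 ℕ.^ m) (sym (distinct-size {n} {k} E d)) (small (elements {n} {k} E) hE)
    g′ : Subset (n ℕ.* k) → ℚ
    g′ = proj₁ cover
    g′-nonneg : ∀ R → 0ℚ ≤ᵠ g′ R
    g′-nonneg = proj₁ (proj₂ cover)

    open ℚ.≤-Reasoning

    -- Failure has probability at least 1/4 for the coloured set, hence for the product law by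
    -- `dominated`, hence for the rounds by `𝔼≤rounds`.
    ¼≤rounds : ½ ^ 2 ≤ᵠ rounds 0≤a a≤1 m (avoids H?) ⊥
    ¼≤rounds = begin
      ½ ^ 2
        ≡⟨⟩
      1ℚ - (1ℚ - ½ ^ 2)
        ≤⟨ ℚ.+-monoʳ-≤ 1ℚ (ℚ.neg-antimono-≤ (ℚ.≤-trans rainbow≤ fails)) ⟩
      1ℚ - 𝔼 (p * 1/ k) (λ S → ⟦ rainbow? k F? S ⟧)
        ≡⟨ cong₂ (λ x y → x + y) (sym (𝔼-one {n ℕ.* k} (p * 1/ k))) (neg-𝔼 (λ S → ⟦ rainbow? k F? S ⟧)) ⟩
      𝔼 (p * 1/ k) (λ _ → 1ℚ) + 𝔼 (p * 1/ k) (λ S → - ⟦ rainbow? k F? S ⟧)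
        ≡⟨ +-hom E⁺ (λ _ → 1ℚ) (λ S → - ⟦ rainbow? k F? S ⟧) ⟨
      𝔼 (p * 1/ k) (λ S → 1ℚ - ⟦ rainbow? k F? S ⟧)
        ≡⟨ ≗-cong E⁺ (λ S → trans (sym (⟦¬⟧ (rainbow? k F? S))) (cong (avoids H?) (sym (Sub.∪-identityˡ S)))) ⟩
      𝔼 (p * 1/ k) (λ S → avoids H? (⊥ ∪ S))
        ≡⟨ cong (λ x → 𝔼 x (λ S → avoids H? (⊥ ∪ S))) m·a≡ ⟨
      𝔼 (m · a) (λ S → avoids H? (⊥ ∪ S))
        ≤⟨ 𝔼≤rounds 0≤a a≤1 m (≤-respˡ m·a≡ p/k≤1) (avoids H?) (avoids-antitone H?) ⊥ ⟩
      rounds 0≤a a≤1 m (avoids H?) ⊥ ∎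
      where
      E⁺ : IsPositive (𝔼 {n ℕ.* k} (p * 1/ k))
      E⁺ = 𝔼-positive 0≤p/k p/k≤1
      neg-𝔼 : ∀ f → - 𝔼 (p * 1/ k) f ≡ 𝔼 (p * 1/ k) (λ S → - f S)
      neg-𝔼 f = trans (solve 1 (λ x → :- x := con (- 1ℚ) :* x) refl (𝔼 (p * 1/ k) f))
        (trans (sym (*-hom E⁺ (- 1ℚ) f)) (≗-cong E⁺ λ S → solve 1 (λ x → con (- 1ℚ) :* x := :- x) refl (f S)))
      rainbow≤ : 𝔼 (p * 1/ k) (λ S → ⟦ rainbow? k F? S ⟧) ≤ᵠ 𝕄 k p n (λ S → ⟦ rainbow? k F? S ⟧)
      rainbow≤ = dominated k p 0≤p p≤1 n (rainbow? k F?)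
        (λ A⊆B (E , hE , E⊆A) → E , hE , λ x∈E → A⊆B (E⊆A x∈E))
        (λ S (E , hE , E⊆S) → E , (E , hE , id) , proj₁ hE , E⊆S)

    -- The weight of R after averaging: `c ^ ∣ R ∣` bounds the probability that a random injective
    -- colouring contains R.
    v : Subset (n ℕ.* k) → ℚ
    v R = g′ R * c ^ ∣ R ∣
    v-nonneg : ∀ R → 0ℚ ≤ᵠ v R
    v-nonneg R = *-nonneg (g′-nonneg R) (^-nonneg ∣ R ∣ 0≤c)

    Over : Subset n → Subset (n ℕ.* k) → Set
    Over S R = DistinctElements {n} {k} R × elements {n} {k} R ≡ S
    over? : ∀ S R → Dec (Over S R)
    over? S R = distinctElements? {n} {k} R ×-dec (elements {n} {k} R ≟ˢ S)
    Within : Subset n → Subset (n ℕ.* k) → Set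
    Within T R = DistinctElements {n} {k} R × elements {n} {k} R ⊆ T
    within? : ∀ T R → Dec (Within T R)
    within? T R = distinctElements? {n} {k} R ×-dec (elements {n} {k} R ⊆? T)

  -- Collects the averaged weights of all coloured sets over S; the factor 4 makes up for a coloured
  -- cover that reaches only 1/4.
  projected-cover : Subset n → ℚ
  projected-cover S = 4 · 1ℚ * ∑ᵠ (λ R → ⟦ over? S R ⟧ * v R)

  projected-nonneg : ∀ S → 0ℚ ≤ᵠ projected-cover S
  projected-nonneg S = *-nonneg (·-nonneg 4 0≤1) (nonneg S′⁺ λ R → *-nonneg (⟦⟧-nonneg (over? S R)) (v-nonneg R))

  private
    colouring-probability : ∀ {T T₀} → T₀ ⊆ T → ∣ T₀ ∣ ≤ k → ∀ S →
      𝔸 T₀ (allFin k) (λ R → ⟦ S ⊆? R ⟧) ≤ᵠ ⟦ within? T S ⟧ * c ^ ∣ S ∣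
    colouring-probability {T} {T₀} T₀⊆T T₀≤k S = begin
      𝔸 T₀ (allFin k) (λ R → ⟦ S ⊆? R ⟧)
        ≤⟨ 𝔸-mono T₀ (allFin k) (allFin⁺ k) (λ R C → ⟦⟧-≤ (S ⊆? R) (*-nonneg (⟦⟧-nonneg (within? T S)) (⟦⟧-nonneg (S ⊆? R))) λ S⊆R →
             ℚ.≤-reflexive (sym (cong₂ _*_ (⟦⟧-yes (within? T S) (within R C S⊆R)) (⟦⟧-yes (S ⊆? R) S⊆R)))) ⟩
      𝔸 T₀ (allFin k) (λ R → ⟦ within? T S ⟧ * ⟦ S ⊆? R ⟧)
        ≡⟨ *-hom (𝔸-positive T₀ (allFin k)) ⟦ within? T S ⟧ (λ R → ⟦ S ⊆? R ⟧) ⟩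
      ⟦ within? T S ⟧ * 𝔸 T₀ (allFin k) (λ R → ⟦ S ⊆? R ⟧)
        ≤⟨ *-monoʳ-≤ (⟦⟧-nonneg (within? T S)) (𝔸-⊆ T₀ (allFin k) (allFin⁺ k) (subst (∣ T₀ ∣ ≤_) (sym length≡k) T₀≤k) S) ⟩
      ⟦ within? T S ⟧ * w (length (allFin k)) ∣ S ∣
        ≡⟨ cong (λ l → ⟦ within? T S ⟧ * w l ∣ S ∣) length≡k ⟩
      ⟦ within? T S ⟧ * w k ∣ S ∣
        ≤⟨ *-monoʳ-≤ (⟦⟧-nonneg (within? T S)) (w≤ k ∣ S ∣) ⟩
      ⟦ within? T S ⟧ * c ^ ∣ S ∣ ∎
      where
      length≡k : length (allFin k) ≡ k
      length≡k = List.length-tabulate {n = k} id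
      within : ∀ R → IsRainbowColouring T₀ (allFin k) R → S ⊆ R → Within T S
      within R C S⊆R = (λ x i j i∈ j∈ → distinctElements C x i j (S⊆R i∈) (S⊆R j∈)) ,
        λ x∈ → T₀⊆T (subst (_ ∈_) (elements≡ C) (elements-mono {n} {k} S⊆R x∈))

    -- Every injective colouring of a minimal T₀ inside T is a rainbow edge, hence covered to the
    -- extent 1/4; averaging turns each indicator of S ⊆ R into at most `c ^ ∣ S ∣`. Such colourings
    -- exist because ∣ T₀ ∣ ≤ k.
    mass : ∀ T → F T → ½ ^ 2 ≤ᵠ ∑ᵠ (λ R → ⟦ within? T R ⟧ * v R)
    mass T FT with minimal-below F? T FT
    ... | T₀ , hT₀ , T₀⊆T = begin
      ½ ^ 2
        ≡⟨ 𝔸-const T₀ (allFin k) (subst (∣ T₀ ∣ ≤_) (sym (List.length-tabulate {n = k} id)) (≤k T₀ hT₀)) (½ ^ 2) ⟨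
      𝔸 T₀ (allFin k) (λ R → ½ ^ 2)
        ≤⟨ 𝔸-mono T₀ (allFin k) (allFin⁺ k) (λ R C → ℚ.≤-trans ¼≤rounds (proj₁ (proj₂ (proj₂ cover)) R
             (distinctElements C , subst (ℋ F) (sym (elements≡ C)) hT₀ , distinctColours C))) ⟩
      𝔸 T₀ (allFin k) (λ R → ∑ᵠ (λ S → ⟦ S ⊆? R ⟧ * g′ S))
        ≡⟨ ∑ʷ-swap (𝔸-positive T₀ (allFin k)) (λ S R → ⟦ S ⊆? R ⟧ * g′ S) ⟩
      ∑ᵠ (λ S → 𝔸 T₀ (allFin k) (λ R → ⟦ S ⊆? R ⟧ * g′ S))
        ≤⟨ mono S′⁺ (λ S → begin
             𝔸 T₀ (allFin k) (λ R → ⟦ S ⊆? R ⟧ * g′ S)   ≡⟨ *-homʳ (𝔸-positive T₀ (allFin k)) (λ R → ⟦ S ⊆? R ⟧) (g′ S) ⟩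
             𝔸 T₀ (allFin k) (λ R → ⟦ S ⊆? R ⟧) * g′ S   ≤⟨ *-monoˡ-≤ (g′-nonneg S) (colouring-probability T₀⊆T (≤k T₀ hT₀) S) ⟩
             ⟦ within? T S ⟧ * c ^ ∣ S ∣ * g′ S           ≡⟨ solve 3 (λ x y z → x :* y :* z := x :* (z :* y)) refl ⟦ within? T S ⟧ (c ^ ∣ S ∣) (g′ S) ⟩
             ⟦ within? T S ⟧ * v S                        ∎) ⟩
      ∑ᵠ (λ S → ⟦ within? T S ⟧ * v S) ∎

  projected-covers : ∀ T → F T → 1ℚ ≤ᵠ ∑ᵠ (λ S → ⟦ S ⊆? T ⟧ * projected-cover S)
  projected-covers T FT = begin
    4 · 1ℚ * ½ ^ 2
      ≤⟨ *-monoʳ-≤ (·-nonneg 4 0≤1) (mass T FT) ⟩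
    4 · 1ℚ * ∑ᵠ (λ R → ⟦ within? T R ⟧ * v R)
      ≤⟨ *-monoʳ-≤ (·-nonneg 4 0≤1) (mono S′⁺ λ R → ⟦⟧*-≤ (within? T R) (nonneg S⁺ λ S → term-nonneg S R) λ (d , R⊆T) →
           ≤-respˡ (sym (trans (cong₂ (λ x y → x * (y * v R)) (⟦⟧-yes (elements {n} {k} R ⊆? T) R⊆T) (⟦⟧-yes (over? (elements {n} {k} R) R) (d , refl)))
             (trans (ℚ.*-identityˡ (1ℚ * v R)) (ℚ.*-identityˡ (v R)))))
             (term≤∑ᵠ (λ S → ⟦ S ⊆? T ⟧ * (⟦ over? S R ⟧ * v R)) (λ S → term-nonneg S R) (elements {n} {k} R))) ⟩
    4 · 1ℚ * ∑ᵠ (λ R → ∑ᵠ (λ S → ⟦ S ⊆? T ⟧ * (⟦ over? S R ⟧ * v R)))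
      ≡⟨ cong (4 · 1ℚ *_) (∑ʷ-swap S′⁺ (λ S R → ⟦ S ⊆? T ⟧ * (⟦ over? S R ⟧ * v R))) ⟩
    4 · 1ℚ * ∑ᵠ (λ S → ∑ᵠ (λ R → ⟦ S ⊆? T ⟧ * (⟦ over? S R ⟧ * v R)))
      ≡⟨ *-hom S⁺ (4 · 1ℚ) (λ S → ∑ᵠ (λ R → ⟦ S ⊆? T ⟧ * (⟦ over? S R ⟧ * v R))) ⟨
    ∑ᵠ (λ S → 4 · 1ℚ * ∑ᵠ (λ R → ⟦ S ⊆? T ⟧ * (⟦ over? S R ⟧ * v R)))
      ≡⟨ ≗-cong S⁺ (λ S → trans (cong (4 · 1ℚ *_) (*-hom S′⁺ ⟦ S ⊆? T ⟧ (λ R → ⟦ over? S R ⟧ * v R)))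
           (solve 3 (λ x y z → x :* (y :* z) := y :* (x :* z)) refl (4 · 1ℚ) ⟦ S ⊆? T ⟧ (∑ᵠ (λ R → ⟦ over? S R ⟧ * v R)))) ⟩
    ∑ᵠ (λ S → ⟦ S ⊆? T ⟧ * projected-cover S) ∎
    where
    term-nonneg : ∀ S R → 0ℚ ≤ᵠ ⟦ S ⊆? T ⟧ * (⟦ over? S R ⟧ * v R)
    term-nonneg S R = *-nonneg (⟦⟧-nonneg (S ⊆? T)) (*-nonneg (⟦⟧-nonneg (over? S R)) (v-nonneg R))

  -- Each R lies over a single S of the same size, so it is counted at most once, with the factor
  -- c^|R| q^|R| = (a ½^6)^|R|. This is the cost of the coloured cover, at most 1/8, times 4.
  projected-cost : ∑ᵠ (λ S → projected-cover S * q ^ ∣ S ∣) ≤ᵠ ½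
  projected-cost = begin
    ∑ᵠ (λ S → 4 · 1ℚ * ∑ᵠ (λ R → ⟦ over? S R ⟧ * v R) * q ^ ∣ S ∣)
      ≡⟨ ≗-cong S⁺ (λ S → trans (ℚ.*-assoc (4 · 1ℚ) (∑ᵠ (λ R → ⟦ over? S R ⟧ * v R)) (q ^ ∣ S ∣)) (cong (4 · 1ℚ *_) (sym (*-homʳ S′⁺ (λ R → ⟦ over? S R ⟧ * v R) (q ^ ∣ S ∣))))) ⟩
    ∑ᵠ (λ S → 4 · 1ℚ * ∑ᵠ (λ R → ⟦ over? S R ⟧ * v R * q ^ ∣ S ∣))
      ≡⟨ *-hom S⁺ (4 · 1ℚ) (λ S → ∑ᵠ (λ R → ⟦ over? S R ⟧ * v R * q ^ ∣ S ∣)) ⟩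
    4 · 1ℚ * ∑ᵠ (λ S → ∑ᵠ (λ R → ⟦ over? S R ⟧ * v R * q ^ ∣ S ∣))
      ≤⟨ *-monoʳ-≤ (·-nonneg 4 0≤1) (mono S⁺ λ S → mono S′⁺ λ R → pointwise S R) ⟩
    4 · 1ℚ * ∑ᵠ (λ S → ∑ᵠ (λ R → ⟦ elements {n} {k} R ≟ˢ S ⟧ * x R))
      ≡⟨ cong (4 · 1ℚ *_) (∑ʷ-swap S′⁺ (λ S R → ⟦ elements {n} {k} R ≟ˢ S ⟧ * x R)) ⟨
    4 · 1ℚ * ∑ᵠ (λ R → ∑ᵠ (λ S → ⟦ elements {n} {k} R ≟ˢ S ⟧ * x R))
      ≤⟨ *-monoʳ-≤ (·-nonneg 4 0≤1) (mono S′⁺ λ R → ≤-respˡ (*-homʳ S⁺ (λ S → ⟦ elements {n} {k} R ≟ˢ S ⟧) (x R))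
           (p*q≤q (∑-≟ (elements {n} {k} R)) (x-nonneg R))) ⟩
    4 · 1ℚ * ∑ᵠ x
      ≤⟨ *-monoʳ-≤ (·-nonneg 4 0≤1) (proj₂ (proj₂ (proj₂ cover))) ⟩
    4 · 1ℚ * (½ ^ 3 * (1ℚ - ½ ^ m))
      ≤⟨ *-monoʳ-≤ (·-nonneg 4 0≤1) (*-monoʳ-≤ (^-nonneg 3 0≤½) (ℚ.+-monoʳ-≤ 1ℚ (ℚ.neg-antimono-≤ (^-nonneg m 0≤½)))) ⟩
    ½ ∎
    where
    x : Subset (n ℕ.* k) → ℚ
    x R = g′ R * (a * ½ ^ 6) ^ ∣ R ∣
    x-nonneg : ∀ R → 0ℚ ≤ᵠ x R
    x-nonneg R = *-nonneg (g′-nonneg R) (^-nonneg ∣ R ∣ (*-nonneg 0≤a (^-nonneg 6 0≤½)))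
    pointwise : ∀ S R → ⟦ over? S R ⟧ * v R * q ^ ∣ S ∣ ≤ᵠ ⟦ elements {n} {k} R ≟ˢ S ⟧ * x R
    pointwise S R = ≤-respˡ (ℚ.*-assoc ⟦ over? S R ⟧ (v R) (q ^ ∣ S ∣)) (⟦⟧*-≤ (over? S R)
      (*-nonneg (⟦⟧-nonneg (elements {n} {k} R ≟ˢ S)) (x-nonneg R)) λ (d , eq) → ℚ.≤-reflexive (begin-equality
        g′ R * c ^ ∣ R ∣ * q ^ ∣ S ∣                      ≡⟨ cong (λ s → g′ R * c ^ ∣ R ∣ * q ^ s) (trans (cong ∣_∣ (sym eq)) (sym (distinct-size {n} {k} R d))) ⟩
        g′ R * c ^ ∣ R ∣ * q ^ ∣ R ∣                      ≡⟨ ℚ.*-assoc (g′ R) (c ^ ∣ R ∣) (q ^ ∣ R ∣) ⟩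
        g′ R * (c ^ ∣ R ∣ * q ^ ∣ R ∣)                    ≡⟨ cong (g′ R *_) (trans (sym (^-distribʳ-* c q ∣ R ∣)) (cong (_^ ∣ R ∣) c*q≡)) ⟩
        x R                                               ≡⟨ ℚ.*-identityˡ (x R) ⟨
        1ℚ * x R                                          ≡⟨ cong (_* x R) (⟦⟧-yes (elements {n} {k} R ≟ˢ S) eq) ⟨
        ⟦ elements {n} {k} R ≟ˢ S ⟧ * x R                 ∎))

-- The lower bound over the rationals

^-superadditive : ∀ {p d} t → 0ℚ ≤ᵠ p → 0ℚ ≤ᵠ d → p ^ suc t + d ^ suc t ≤ᵠ (p + d) ^ suc t
^-superadditive {p} {d} zero 0≤p 0≤d = ℚ.≤-reflexive (sym (ℚ.*-distribʳ-+ 1ℚ p d))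
^-superadditive {p} {d} (suc t) 0≤p 0≤d = begin
  p * p ^ suc t + d * d ^ suc t
    ≤⟨ p≤p+q (+-nonneg (*-nonneg 0≤p (^-nonneg (suc t) 0≤d)) (*-nonneg 0≤d (^-nonneg (suc t) 0≤p))) ⟩
  p * p ^ suc t + d * d ^ suc t + (p * d ^ suc t + d * p ^ suc t)
    ≡⟨ solve 4 (λ p d x y → p :* x :+ d :* y :+ (p :* y :+ d :* x) := (p :+ d) :* (x :+ y)) refl p d (p ^ suc t) (d ^ suc t) ⟩
  (p + d) * (p ^ suc t + d ^ suc t)
    ≤⟨ *-monoʳ-≤ (+-nonneg 0≤p 0≤d) (^-superadditive t 0≤p 0≤d) ⟩
  (p + d) * (p + d) ^ suc t ∎
  where open ℚ.≤-Reasoning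

^-pos : ∀ {d} n → 0ℚ <ᵠ d → 0ℚ <ᵠ d ^ n
^-pos     zero    0<d = ℚ.positive⁻¹ 1ℚ
^-pos {d} (suc n) 0<d = ℚ.≤-<-trans (ℚ.≤-reflexive (sym (ℚ.*-zeroʳ d)))
  (ℚ.*-monoʳ-<-pos d {{ℚ.positive 0<d}} (^-pos n 0<d))

-- A gap d between p and q lowers the cost by d ^ n times the mass of g on nonempty sets,
-- and this mass is almost 1/2, since g ⊥ is at most the cost.
module _ {n : ℕ} (k : ℕ) .{{_ : NonZero k}} {F : Family n} (F? : Decidable F) (inc : Increasing F) {T₀} (FT₀ : F T₀)
  {p q d : ℚ} (0≤p : 0ℚ ≤ᵠ p) (q≤1 : q ≤ᵠ 1ℚ) (0<d : 0ℚ <ᵠ d) (p+d≤q : p + d ≤ᵠ q)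
  (g : Subset n → ℚ) (0≤g : ∀ S → 0ℚ ≤ᵠ g S) where

  private
    e = d ^ n
    -- Small against the gain: the hypotheses of `no-gap` are off by ε, and the gain is about e / 2
    -- = 8 ε.
    ε = e * ½ ^ 4
    0≤d = ℚ.<⇒≤ 0<d
    p≤q = ℚ.≤-trans (p≤p+q {p} 0≤d) p+d≤q
    p≤1 = ℚ.≤-trans p≤q q≤1
    0≤q = ℚ.≤-trans 0≤p p≤q
    d≤1 = ℚ.≤-trans (q≤p+q 0≤p) (ℚ.≤-trans p+d≤q q≤1)
    0<ε : 0ℚ <ᵠ ε
    0<ε = ℚ.*-monoˡ-<-pos (½ ^ 4) (^-pos n 0<d)
    0≤ε = ℚ.<⇒≤ 0<ε
    ε≤ : ε ≤ᵠ ½ ^ 4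
    ε≤ = p*q≤q (^-≤1 n 0≤d d≤1) (^-nonneg 4 0≤½)
    ε≤1 : ε ≤ᵠ 1ℚ
    ε≤1 = ℚ.≤-trans ε≤ (^-≤1 4 0≤½ ½≤1)

    S⁺ : IsPositive (∑ᵠ {n})
    S⁺ = ∑ᵠ-positive
    M⁺ : IsPositive (𝕄 k p n)
    M⁺ = 𝕄-positive k p 0≤p p≤1 n

    N = ∑ᵠ (λ S → ⟦ 1 ℕ.≤? ∣ S ∣ ⟧ * g S)
    P = ∑ᵠ (λ S → g S * p ^ ∣ S ∣)
    Q = ∑ᵠ (λ S → g S * q ^ ∣ S ∣)
    open ℚ.≤-Reasoning

    -- A nonempty S gains at least d^|S| between p and q, and d^|S| ≥ d^n because d ≤ 1.
    gap : P + e * N ≤ᵠ Q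
    gap = ≤-respˡ (sym (trans (+-hom S⁺ (λ S → g S * p ^ ∣ S ∣) (λ S → e * (⟦ 1 ℕ.≤? ∣ S ∣ ⟧ * g S)))
        (cong (P +_) (*-hom S⁺ e (λ S → ⟦ 1 ℕ.≤? ∣ S ∣ ⟧ * g S)))))
      (mono S⁺ λ S → pointwise S ∣ S ∣ (Sub.∣p∣≤n S))
      where
      pointwise : ∀ S t → t ≤ n → g S * p ^ t + e * (⟦ 1 ℕ.≤? t ⟧ * g S) ≤ᵠ g S * q ^ t
      pointwise S zero    _   = ℚ.≤-reflexive (solve 2 (λ e x → x :* con 1ℚ :+ e :* (con 0ℚ :* x) := x :* con 1ℚ) refl e (g S))
      pointwise S (suc t) t≤n = begin
        g S * p ^ suc t + e * (1ℚ * g S)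
          ≡⟨ solve 3 (λ e x y → x :* y :+ e :* (con 1ℚ :* x) := x :* (y :+ e)) refl e (g S) (p ^ suc t) ⟩
        g S * (p ^ suc t + e)
          ≤⟨ *-monoʳ-≤ (0≤g S) (ℚ.+-monoʳ-≤ (p ^ suc t) (^-antitone 0≤d d≤1 t≤n)) ⟩
        g S * (p ^ suc t + d ^ suc t)
          ≤⟨ *-monoʳ-≤ (0≤g S) (ℚ.≤-trans (^-superadditive t 0≤p 0≤d) (^-monoˡ-≤ (suc t) (+-nonneg 0≤p 0≤d) p+d≤q)) ⟩
        g S * q ^ suc t ∎

    -- The empty set is accounted for by its term in the cost Q, where q^0 = 1, and every other set
    -- by N.
    total : ∑ᵠ (λ S → ⟦ S ⊆? T₀ ⟧ * g S) ≤ᵠ N + Q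
    total = ≤-respʳ (mono S⁺ λ S → ℚ.≤-trans (p*q≤q (⟦⟧≤1 (S ⊆? T₀)) (0≤g S)) (pointwise S ∣ S ∣))
      (+-hom S⁺ (λ S → ⟦ 1 ℕ.≤? ∣ S ∣ ⟧ * g S) (λ S → g S * q ^ ∣ S ∣))
      where
      pointwise : ∀ S t → g S ≤ᵠ ⟦ 1 ℕ.≤? t ⟧ * g S + g S * q ^ t
      pointwise S zero    = ℚ.≤-reflexive (solve 1 (λ x → x := con 0ℚ :* x :+ x :* con 1ℚ) refl (g S))
      pointwise S (suc t) = ≤-respˡ (sym (ℚ.*-identityˡ (g S))) (p≤p+q (*-nonneg (0≤g S) (^-nonneg (suc t) 0≤q)))

  -- First moment method: a rainbow edge in R puts `elements R` into F, where g has mass at least 1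
  -- - ε; by `marginal` the expected mass of g inside `elements R` is at most P.
  rainbow-mass≤ : (∀ T → F T → 1ℚ - ε ≤ᵠ ∑ᵠ (λ S → ⟦ S ⊆? T ⟧ * g S)) →
    (1ℚ - ε) * 𝕄 k p n (λ R → ⟦ rainbow? k F? R ⟧) ≤ᵠ P
  rainbow-mass≤ covers = begin
    (1ℚ - ε) * 𝕄 k p n (λ R → ⟦ rainbow? k F? R ⟧)
      ≡⟨ *-hom M⁺ (1ℚ - ε) (λ R → ⟦ rainbow? k F? R ⟧) ⟨
    𝕄 k p n (λ R → (1ℚ - ε) * ⟦ rainbow? k F? R ⟧)
      ≤⟨ mono M⁺ (λ R → ≤-respˡ (ℚ.*-comm (1ℚ - ε) ⟦ rainbow? k F? R ⟧) (⟦⟧*-≤ (rainbow? k F? R)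
           (nonneg S⁺ λ S → *-nonneg (⟦⟧-nonneg (S ⊆? elements {n} {k} R)) (0≤g S))
           λ (E , (_ , (FE , _) , _) , E⊆R) → covers (elements {n} {k} R) (inc (elements-mono {n} {k} E⊆R) FE))) ⟩
    𝕄 k p n (λ R → ∑ᵠ (λ S → ⟦ S ⊆? elements {n} {k} R ⟧ * g S))
      ≡⟨ ∑ʷ-swap M⁺ (λ S R → ⟦ S ⊆? elements {n} {k} R ⟧ * g S) ⟩
    ∑ᵠ (λ S → 𝕄 k p n (λ R → ⟦ S ⊆? elements {n} {k} R ⟧ * g S))
      ≤⟨ mono S⁺ (λ S → ≤-respˡ (trans (*-homʳ M⁺ (λ R → ⟦ S ⊆? elements {n} {k} R ⟧) (g S)) (ℚ.*-comm _ (g S)))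
           (*-monoʳ-≤ (0≤g S) (marginal k p 0≤p p≤1 n S))) ⟩
    ∑ᵠ (λ S → g S * p ^ ∣ S ∣) ∎

  no-gap : (∀ T → F T → 1ℚ - ε ≤ᵠ ∑ᵠ (λ S → ⟦ S ⊆? T ⟧ * g S)) → ∑ᵠ (λ S → g S * q ^ ∣ S ∣) ≤ᵠ ½ + ε →
    ½ - ε ≤ᵠ 𝕄 k p n (λ R → ⟦ rainbow? k F? R ⟧) → Empty.⊥
  no-gap covers cost mass = ℚ.<-irrefl refl (ℚ.<-≤-trans 0<ε (0≤-⇒≤ (begin
    0ℚ
      ≤⟨ +-nonneg (+-nonneg (≤⇒0≤- (ℚ.≤-trans (*-monoʳ-≤ (≤⇒0≤- ε≤1) mass) (rainbow-mass≤ covers))) (≤⇒0≤- gap)) (≤⇒0≤- cost) ⟩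
    (P - (1ℚ - ε) * (½ - ε)) + (Q - (P + e * N)) + (½ + ε - Q)
      ≤⟨ p≤p+q (*-nonneg (^-nonneg n 0≤d) (≤⇒0≤- N≥)) ⟩
    (P - (1ℚ - ε) * (½ - ε)) + (Q - (P + e * N)) + (½ + ε - Q) + e * (N - (½ - ε - ε))
      -- With e = 16 ε all terms in P, Q and N cancel. The gain 8 ε exceeds the errors 5/2 ε by 5½
      -- ε, and the quadratic terms add up to 31 ε².
      ≡⟨ solve 4 (λ e P Q N → let ε = e :* con (½ ^ 4) in
           (P :- (con 1ℚ :- ε) :* (con ½ :- ε)) :+ (Q :- (P :+ e :* N)) :+ (con ½ :+ ε :- Q) :+ e :* (N :- (con ½ :- ε :- ε))
             := con 31ℚ :* (ε :* ε) :- con 5½ :* ε) refl e P Q N ⟩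
    31ℚ * (ε * ε) - 5½ * ε
      ≤⟨ ℚ.+-monoˡ-≤ (- (5½ * ε)) (*-monoʳ-≤ (ℚ.nonNegative⁻¹ 31ℚ) (*-monoˡ-≤ 0≤ε ε≤)) ⟩
    31ℚ * (½ ^ 4 * ε) - 5½ * ε
      ≤⟨ p≤p+q (*-nonneg (ℚ.nonNegative⁻¹ r) 0≤ε) ⟩
    31ℚ * (½ ^ 4 * ε) - 5½ * ε + r * ε
      ≡⟨ solve 1 (λ x → con 31ℚ :* (con (½ ^ 4) :* x) :- con 5½ :* x :+ con r :* x := con 0ℚ :- x) refl ε ⟩
    0ℚ - ε ∎)))
    where
    31ℚ = 31 · 1ℚ
    5½ = 5 · 1ℚ + ½
    -- As ε ≤ 1/16, the quadratic term is at most 31/16 ε. Taking this and one more ε from 5½ ε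
    -- leaves r ε with r ≥ 0, and the spare ε contradicts 0 < ε.
    r = 5½ - 1ℚ - 31ℚ * ½ ^ 4
    N≥ : ½ - ε - ε ≤ᵠ N
    N≥ = 0≤-⇒≤ (≤-respʳ (+-nonneg (≤⇒0≤- (ℚ.≤-trans (covers T₀ FT₀) total)) (≤⇒0≤- cost))
      (solve 3 (λ ε N Q → (N :+ Q :- (con 1ℚ :- ε)) :+ (con ½ :+ ε :- Q) := N :- (con ½ :- ε :- ε)) refl ε N Q))

-- Sequences up to vanishing differences

Eventually : (ℕ → Set) → Set
Eventually P = ∃[ N ] (∀ n → N ≤ n → P n)

eventually-∧ : ∀ {P Q : ℕ → Set} → Eventually P → Eventually Q → Eventually (λ n → P n × Q n)
eventually-∧ (N₁ , p) (N₂ , q) = N₁ ℕ.⊔ N₂ , λ n N≤n →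
  p n (ℕ.m⊔n≤o⇒m≤o N₁ N₂ N≤n) , q n (ℕ.m⊔n≤o⇒n≤o N₁ N₂ N≤n)

eventually-map : ∀ {P Q : ℕ → Set} → (∀ n → P n → Q n) → Eventually P → Eventually Q
eventually-map f (N , p) = N , λ n N≤n → f n (p n N≤n)

eventually-∀ : ∀ {n} {P : Subset n → ℕ → Set} → (∀ S → Eventually (P S)) → Eventually (λ j → ∀ S → P S j)
eventually-∀ {zero}  h = eventually-map (λ { j p [] → p }) (h [])
eventually-∀ {suc n} h = eventually-map (λ { j (p , q) (outside ∷ S) → p S ; j (p , q) (inside ∷ S) → q S })
  (eventually-∧ (eventually-∀ (λ S → h (outside ∷ S))) (eventually-∀ (λ S → h (inside ∷ S))))

∣-∣≤⇒≤+ : ∀ {x y ε} → ℚ.∣ x - y ∣ ≤ᵠ ε → x ≤ᵠ y + ε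
∣-∣≤⇒≤+ {x} {y} {ε} h = begin
  x                  ≡⟨ solve 2 (λ x y → x := y :+ (x :- y)) refl x y ⟩
  y + (x - y)        ≤⟨ ℚ.+-monoʳ-≤ y (p≤∣p∣ (x - y)) ⟩
  y + ℚ.∣ x - y ∣    ≤⟨ ℚ.+-monoʳ-≤ y h ⟩
  y + ε              ∎
  where
  open ℚ.≤-Reasoning
  p≤∣p∣ : ∀ p → p ≤ᵠ ℚ.∣ p ∣
  p≤∣p∣ p with ℚ.≤-total 0ℚ p
  ... | inj₁ 0≤p = ℚ.≤-reflexive (sym (ℚ.0≤p⇒∣p∣≡p 0≤p))
  ... | inj₂ p≤0 = ℚ.≤-trans p≤0 (ℚ.0≤∣p∣ p)

∣-∣-sym : ∀ x y → ℚ.∣ x - y ∣ ≡ ℚ.∣ y - x ∣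
∣-∣-sym x y = trans (sym (ℚ.∣-p∣≡∣p∣ (x - y))) (cong ℚ.∣_∣ (solve 2 (λ x y → :- (x :- y) := y :- x) refl x y))

infix 4 _≈_

-- Equality of real numbers at the level of sequences; it allows replacing a sequence by one whose
-- terms obey exact bounds.
record _≈_ (x y : ℕ → ℚ) : Set where
  constructor close
  field
    closeness : ∀ ε → 0ℚ <ᵠ ε → Eventually (λ n → ℚ.∣ x n - y n ∣ ≤ᵠ ε)
open _≈_

≈-refl : ∀ {x} → x ≈ x
≈-refl {x} = close λ ε 0<ε → 0 , λ n _ → ≤-respˡ (cong ℚ.∣_∣ (ℚ.+-inverseʳ (x n))) (ℚ.<⇒≤ 0<ε)

≈-sym : ∀ {x y} → x ≈ y → y ≈ x
≈-sym {x} {y} x≈y = close λ ε 0<ε → eventually-map (λ n → ≤-respˡ (∣-∣-sym (y n) (x n))) (closeness x≈y ε 0<ε)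

≈⇒≤ℝ : ∀ {x y} → seq x ≈ seq y → x ≤ℝ y
≈⇒≤ℝ x≈y ε 0<ε = eventually-map (λ n → ∣-∣≤⇒≤+) (closeness x≈y ε 0<ε)

≤ℝ-trans : ∀ {x y z} → x ≤ℝ y → y ≤ℝ z → x ≤ℝ z
≤ℝ-trans {x} {y} {z} x≤y y≤z ε 0<ε = eventually-map
  (λ n (x≤ , y≤) → begin
    seq x n                          ≤⟨ x≤ ⟩
    seq y n + ½ * ε                  ≤⟨ ℚ.+-monoˡ-≤ (½ * ε) y≤ ⟩
    seq z n + ½ * ε + ½ * ε          ≡⟨ ℚ.+-assoc (seq z n) (½ * ε) (½ * ε) ⟩
    seq z n + (½ * ε + ½ * ε)        ≡⟨ cong (seq z n +_) (half+half ε) ⟩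
    seq z n + ε                      ∎)
  (eventually-∧ (x≤y (½ * ε) (half-pos 0<ε)) (y≤z (½ * ε) (half-pos 0<ε)))
  where open ℚ.≤-Reasoning

pointwise⇒≤ℝ : ∀ {x y} → (∀ n → seq x n ≤ᵠ seq y n) → x ≤ℝ y
pointwise⇒≤ℝ h ε 0<ε = 0 , λ n _ → ℚ.≤-trans (h n) (p≤p+q (ℚ.<⇒≤ 0<ε))

+-≈ : ∀ {x x′ y y′} → x ≈ x′ → y ≈ y′ → (λ n → x n + y n) ≈ (λ n → x′ n + y′ n)
+-≈ {x} {x′} {y} {y′} x≈ y≈ = close λ ε 0<ε → eventually-map
  (λ n (hx , hy) → begin
    ℚ.∣ x n + y n - (x′ n + y′ n) ∣            ≡⟨ cong ℚ.∣_∣ (solve 4 (λ a b c d → a :+ b :- (c :+ d) := (a :- c) :+ (b :- d)) refl (x n) (y n) (x′ n) (y′ n)) ⟩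
    ℚ.∣ (x n - x′ n) + (y n - y′ n) ∣          ≤⟨ ℚ.∣p+q∣≤∣p∣+∣q∣ (x n - x′ n) (y n - y′ n) ⟩
    ℚ.∣ x n - x′ n ∣ + ℚ.∣ y n - y′ n ∣        ≤⟨ ℚ.+-mono-≤ hx hy ⟩
    ½ * ε + ½ * ε                              ≡⟨ half+half ε ⟩
    ε                                          ∎)
  (eventually-∧ (closeness x≈ (½ * ε) (half-pos 0<ε)) (closeness y≈ (½ * ε) (half-pos 0<ε)))
  where open ℚ.≤-Reasoning

neg-≈ : ∀ {x x′} → x ≈ x′ → (λ n → - x n) ≈ (λ n → - x′ n)
neg-≈ {x} {x′} x≈ = close λ ε 0<ε → eventually-map (λ n → ≤-respˡ (trans
  (cong ℚ.∣_∣ (solve 2 (λ a b → (:- a) :- (:- b) := b :- a) refl (x n) (x′ n))) (∣-∣-sym (x′ n) (x n)))) (closeness x≈ ε 0<ε)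

*-≈ : ∀ x x′ y y′ → seq x ≈ seq x′ → seq y ≈ seq y′ → seq (x *ℝ y) ≈ seq (x′ *ℝ y′)
*-≈ x x′ y y′ x≈ y≈ = close λ ε 0<ε →
  let A , 0<A , N₁ , bx = tail-bound (seq x) (cauchy x)
      B , 0<B , N₂ , by = tail-bound (seq y′) (cauchy y′)
      δ , 0<δ , Aδ      = share A ε 0<A 0<ε
      η , 0<η , Bη      = share B ε 0<B 0<ε
  in eventually-map
    (λ n ((hx , hy) , (hδ , hη)) → *-close (seq x n) (seq y n) (seq x′ n) (seq y′ n) (ℚ.<⇒≤ 0<δ) (ℚ.<⇒≤ 0<η) Aδ Bη hx hy hδ hη)
    (eventually-∧ (eventually-∧ (N₁ , bx) (N₂ , by)) (eventually-∧ (closeness y≈ δ 0<δ) (closeness x≈ η 0<η)))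

^-≈ : ∀ x x′ t → seq x ≈ seq x′ → seq (x ^ℝ t) ≈ seq (x′ ^ℝ t)
^-≈ x x′ zero    x≈ = ≈-refl
^-≈ x x′ (suc t) x≈ = *-≈ x x′ (x ^ℝ t) (x′ ^ℝ t) x≈ (^-≈ x x′ t x≈)

∑-≈ : ∀ {n} {f f′ : Subset n → ℝ} → (∀ S → seq (f S) ≈ seq (f′ S)) → seq (∑ f) ≈ seq (∑ f′)
∑-≈ {zero}  h = h []
∑-≈ {suc n} {f} {f′} h = +-≈ (∑-≈ {f = λ S → f (outside ∷ S)} {λ S → f′ (outside ∷ S)} (λ S → h (outside ∷ S)))
                            (∑-≈ {f = λ S → f (inside ∷ S)} {λ S → f′ (inside ∷ S)} (λ S → h (inside ∷ S)))

if-≈ : ∀ b {x x′} → seq x ≈ seq x′ → seq (if b then x else 0ℝ) ≈ seq (if b then x′ else 0ℝ)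
if-≈ true  h = h
if-≈ false h = ≈-refl

≈-cauchy : ∀ {x y} → IsCauchy x → x ≈ y → IsCauchy y
≈-cauchy {x} {y} cx x≈y ε 0<ε =
  let N₁ , c = cx (½ * ε) (half-pos 0<ε)
      N₂ , h = closeness x≈y (½ * (½ * ε)) (half-pos (half-pos 0<ε))
  in N₁ ℕ.⊔ N₂ , λ m n N≤m N≤n → begin
    ℚ.∣ y m - y n ∣
      ≡⟨ cong ℚ.∣_∣ (solve 4 (λ a b c d → a :- b := (a :- c) :+ ((c :- d) :+ (d :- b))) refl (y m) (y n) (x m) (x n)) ⟩
    ℚ.∣ (y m - x m) + ((x m - x n) + (x n - y n)) ∣
      ≤⟨ ℚ.≤-trans (ℚ.∣p+q∣≤∣p∣+∣q∣ (y m - x m) ((x m - x n) + (x n - y n))) (ℚ.+-monoʳ-≤ ℚ.∣ y m - x m ∣ (ℚ.∣p+q∣≤∣p∣+∣q∣ (x m - x n) (x n - y n))) ⟩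
    ℚ.∣ y m - x m ∣ + (ℚ.∣ x m - x n ∣ + ℚ.∣ x n - y n ∣)
      ≤⟨ ℚ.+-mono-≤ (≤-respˡ (∣-∣-sym (y m) (x m)) (h m (ℕ.m⊔n≤o⇒n≤o N₁ N₂ N≤m)))
           (ℚ.+-mono-≤ (c m n (ℕ.m⊔n≤o⇒m≤o N₁ N₂ N≤m) (ℕ.m⊔n≤o⇒m≤o N₁ N₂ N≤n)) (h n (ℕ.m⊔n≤o⇒n≤o N₁ N₂ N≤n))) ⟩
    ½ * (½ * ε) + (½ * ε + ½ * (½ * ε))
      ≡⟨ solve 1 (λ e → con ½ :* (con ½ :* e) :+ (con ½ :* e :+ con ½ :* (con ½ :* e)) := e) refl ε ⟩
    ε ∎
  where open ℚ.≤-Reasoning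

opaque

  -- A nonnegative real may have negative terms. Clamping them at 0 changes the sequence by a null
  -- sequence, and the rational estimates then apply to every term.
  nonneg-representative : ∀ x → 0ℝ ≤ℝ x → ∃[ x′ ] (seq x ≈ seq x′ × (∀ n → 0ℚ ≤ᵠ seq x′ n))
  nonneg-representative x 0≤x = mkℝ y (≈-cauchy (cauchy x) x≈y) , x≈y , λ n → ℚ.p≤p⊔q 0ℚ (seq x n)
    where
    y : ℕ → ℚ
    y n = 0ℚ ℚ.⊔ seq x n
    x≈y : seq x ≈ y
    x≈y = close λ ε 0<ε → eventually-map (λ n 0≤x+ε → ∣p-q∣≤ε (ℚ.≤-trans (ℚ.p≤q⊔p 0ℚ (seq x n)) (p≤p+q {y n} (ℚ.<⇒≤ 0<ε)))
      (ℚ.⊔-lub {seq x n + ε} {0ℚ} {seq x n} 0≤x+ε (p≤p+q {seq x n} (ℚ.<⇒≤ 0<ε)))) (0≤x ε 0<ε)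

  unit-representative : ∀ x → IsProbability x → ∃[ x′ ] (seq x ≈ seq x′ × (∀ n → 0ℚ ≤ᵠ seq x′ n) × (∀ n → seq x′ n ≤ᵠ 1ℚ))
  unit-representative x (0≤x , x≤1) = mkℝ y (≈-cauchy (cauchy x) x≈y) , x≈y ,
    (λ n → ℚ.⊓-glb (ℚ.p≤p⊔q 0ℚ (seq x n)) 0≤1) , λ n → ℚ.p⊓q≤q (0ℚ ℚ.⊔ seq x n) 1ℚ
    where
    y : ℕ → ℚ
    y n = (0ℚ ℚ.⊔ seq x n) ℚ.⊓ 1ℚ
    x≈y : seq x ≈ y
    x≈y = close λ ε 0<ε → let 0≤ε = ℚ.<⇒≤ 0<ε in eventually-map (λ n (0≤x+ε , x≤1+ε) → ∣p-q∣≤ε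
        (≤-respˡ (solve 2 (λ x e → x := x :- e :+ e) refl (seq x n) ε) (ℚ.+-monoˡ-≤ ε (ℚ.⊓-glb
          (ℚ.≤-trans (p-q≤p (seq x n) 0≤ε) (ℚ.p≤q⊔p 0ℚ (seq x n)))
          (≤-respʳ (ℚ.+-monoˡ-≤ (- ε) x≤1+ε) (solve 1 (λ e → con 1ℚ :+ e :- e := con 1ℚ) refl ε)))))
        (ℚ.≤-trans (ℚ.p⊓q≤p (0ℚ ℚ.⊔ seq x n) 1ℚ) (ℚ.⊔-lub {seq x n + ε} {0ℚ} {seq x n} 0≤x+ε (p≤p+q {seq x n} 0≤ε))))
      (eventually-∧ (0≤x ε 0<ε) (x≤1 ε 0<ε))
      where
      p-q≤p : ∀ p {q} → 0ℚ ≤ᵠ q → p - q ≤ᵠ p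
      p-q≤p p 0≤q = ≤-respʳ (ℚ.+-monoʳ-≤ p (ℚ.neg-antimono-≤ 0≤q)) (ℚ.+-identityʳ p)

-- Terms of the defining sequences

seq-^ : ∀ x t j → seq (x ^ℝ t) j ≡ seq x j ^ t
seq-^ x zero    j = refl
seq-^ x (suc t) j = cong (seq x j *_) (seq-^ x t j)

seq-∑ : ∀ {n} (f : Subset n → ℝ) j → seq (∑ f) j ≡ ∑ᵠ (λ S → seq (f S) j)
seq-∑ {zero}  f j = sym (∑ʷ-zero _)
seq-∑ {suc n} f j = trans (cong₂ _+_ (seq-∑ (λ S → f (outside ∷ S)) j) (seq-∑ (λ S → f (inside ∷ S)) j))
  (sym (∑ᵠ-suc (λ S → seq (f S) j)))

seq-if : ∀ {P : Set} (P? : Dec P) x j → seq (if does P? then x else 0ℝ) j ≡ ⟦ P? ⟧ * seq x j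
seq-if (yes _) x j = sym (ℚ.*-identityˡ (seq x j))
seq-if (no _)  x j = sym (ℚ.*-zeroˡ (seq x j))

seq-∑-over : ∀ {n} {F : Family n} (F? : Decidable F) g j → seq (∑-over F? g) j ≡ ∑ᵠ (λ S → ⟦ F? S ⟧ * seq (g S) j)
seq-∑-over F? g j = trans (seq-∑ (λ S → if does (F? S) then g S else 0ℝ) j) (≗-cong ∑ᵠ-positive λ S → seq-if (F? S) (g S) j)

seq-cost : ∀ {n} (g : Subset n → ℝ) p j → seq (∑ (λ S → g S *ℝ p ^ℝ ∣ S ∣)) j ≡ ∑ᵠ (λ S → seq (g S) j * seq p j ^ ∣ S ∣)
seq-cost g p j = trans (seq-∑ (λ S → g S *ℝ p ^ℝ ∣ S ∣) j) (≗-cong ∑ᵠ-positive λ S → cong (seq (g S) j *_) (seq-^ p ∣ S ∣ j))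

∑-over-≈ : ∀ {n} {F : Family n} (F? : Decidable F) {g g′} → (∀ S → seq (g S) ≈ seq (g′ S)) →
  seq (∑-over F? g) ≈ seq (∑-over F? g′)
∑-over-≈ F? {g} {g′} g≈ = ∑-≈ {f = λ S → if does (F? S) then g S else 0ℝ} {λ S → if does (F? S) then g′ S else 0ℝ}
  λ S → if-≈ (does (F? S)) {g S} {g′ S} (g≈ S)

module _ {n k : ℕ} where

  opaque

    weight : ℝ → ℝ → Subset (n ℕ.* k) → ℝ
    weight y p S = y ^ℝ ∣ S ∣ *ℝ (1ℝ -ℝ p) ^ℝ (n ℕ.∸ ∣ S ∣)

    weight≡ : ∀ y p S → y ^ℝ ∣ S ∣ *ℝ (1ℝ -ℝ p) ^ℝ (n ℕ.∸ ∣ S ∣) ≡ weight y p S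
    weight≡ y p S = refl

    seq-weight : ∀ y p S j → seq (weight y p S) j ≡ seq y j ^ ∣ S ∣ * (1ℚ - seq p j) ^ (n ℕ.∸ ∣ S ∣)
    seq-weight y p S j = cong₂ _*_ (seq-^ y ∣ S ∣ j) (seq-^ (1ℝ -ℝ p) (n ℕ.∸ ∣ S ∣) j)

    weight-≈ : ∀ {y y′ p p′} → seq y ≈ seq y′ → seq p ≈ seq p′ → ∀ S → seq (weight y p S) ≈ seq (weight y′ p′ S)
    weight-≈ {y} {y′} {p} {p′} y≈ p≈ S = *-≈ (y ^ℝ ∣ S ∣) (y′ ^ℝ ∣ S ∣) ((1ℝ -ℝ p) ^ℝ (n ℕ.∸ ∣ S ∣)) ((1ℝ -ℝ p′) ^ℝ (n ℕ.∸ ∣ S ∣))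
      (^-≈ y y′ ∣ S ∣ y≈)
      (^-≈ (1ℝ -ℝ p) (1ℝ -ℝ p′) (n ℕ.∸ ∣ S ∣) (+-≈ {x = λ _ → 1ℚ} ≈-refl (neg-≈ p≈)))

  law : ℝ → ℝ → Subset (n ℕ.* k) → ℝ
  law y p S = if does (distinctElements? {n} {k} S) then weight y p S else 0ℝ

  seq-law : ∀ y p S j →
    seq (law y p S) j ≡ ⟦ distinctElements? {n} {k} S ⟧ * (seq y j ^ ∣ S ∣ * (1ℚ - seq p j) ^ (n ℕ.∸ ∣ S ∣))
  seq-law y p S j = trans (seq-if (distinctElements? {n} {k} S) (weight y p S) j)
    (cong (⟦ distinctElements? {n} {k} S ⟧ *_) (seq-weight y p S j))

  law-≈ : ∀ {y y′ p p′} → seq y ≈ seq y′ → seq p ≈ seq p′ → ∀ S → seq (law y p S) ≈ seq (law y′ p′ S)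
  law-≈ {y} {y′} {p} {p′} y≈ p≈ S = if-≈ (does (distinctElements? {n} {k} S)) {weight y p S} {weight y′ p′ S} (weight-≈ y≈ p≈ S)

module _ {n : ℕ} (k : ℕ) .{{nz : NonZero k}} where

  μ≡law : ∀ p S → μ {n} k {{nz}} p S ≡ law {n} {k} (_/ℝ_ p k {{nz}}) p S
  μ≡law p S = cong (λ x → if does (distinctElements? {n} {k} S) then x else 0ℝ) (weight≡ {n} {k} (_/ℝ_ p k {{nz}}) p S)

  seq-/ : ∀ p j → seq (_/ℝ_ p k {{nz}}) j ≡ seq p j * 1/ k
  seq-/ p j = cong (seq p j *_) (sym (1/≡ k))

  /-≈ : ∀ {p p′} → seq p ≈ seq p′ → seq (_/ℝ_ p k {{nz}}) ≈ seq (_/ℝ_ p′ k {{nz}})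
  /-≈ {p} {p′} p≈ = *-≈ p p′ (fromℚ (ℤ.+ 1 ℚ./ k)) (fromℚ (ℤ.+ 1 ℚ./ k)) p≈ ≈-refl

  seq-μ : ∀ p S j → seq (μ {n} k {{nz}} p S) j ≡ μᵠ k (seq p j) n S
  seq-μ p S j = trans (cong (λ x → seq x j) (μ≡law p S)) (trans (seq-law {n} {k} (_/ℝ_ p k {{nz}}) p S j)
    (cong (λ y → ⟦ distinctElements? {n} {k} S ⟧ * (y ^ ∣ S ∣ * (1ℚ - seq p j) ^ (n ℕ.∸ ∣ S ∣))) (seq-/ p j)))

  μ-≈ : ∀ {p p′} → seq p ≈ seq p′ → ∀ S → seq (μ {n} k {{nz}} p S) ≈ seq (μ {n} k {{nz}} p′ S)
  μ-≈ {p} {p′} p≈ S = subst₂ (λ x y → seq x ≈ seq y) (sym (μ≡law p S)) (sym (μ≡law p′ S)) (law-≈ {n} {k} (/-≈ {p} {p′} p≈) p≈ S)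

  -- The terms of the real probability are exactly the rational probabilities at the terms of p, so
  -- the rational results transfer without a further error.
  seq-μ-family : ∀ p {F′ : Family (n ℕ.* k)} (F′? : Decidable F′) j →
    seq (μ-family {n} k {{nz}} p F′?) j ≡ 𝕄 k (seq p j) n (λ S → ⟦ F′? S ⟧)
  seq-μ-family p F′? j = trans (seq-∑-over F′? (μ {n} k {{nz}} p) j) (trans
    (≗-cong ∑ᵠ-positive λ S → trans (cong (⟦ F′? S ⟧ *_) (seq-μ p S j)) (ℚ.*-comm ⟦ F′? S ⟧ (μᵠ k (seq p j) n S)))
    (∑-μᵠ k (seq p j) n (λ S → ⟦ F′? S ⟧)))

  μ-family≡ : ∀ p {F′ : Family (n ℕ.* k)} (F′? : Decidable F′) → μ-family {n} k {{nz}} p F′? ≡ ∑-over F′? (μ {n} k {{nz}} p)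
  μ-family≡ p F′? = refl

  μ-family-≈ : ∀ {p p′} {F′ : Family (n ℕ.* k)} (F′? : Decidable F′) →
    seq p ≈ seq p′ → seq (μ-family {n} k {{nz}} p F′?) ≈ seq (μ-family {n} k {{nz}} p′ F′?)
  μ-family-≈ {p} {p′} F′? p≈ = subst₂ (λ x y → seq x ≈ seq y) (sym (μ-family≡ p F′?)) (sym (μ-family≡ p′ F′?))
    (∑-over-≈ F′? {μ {n} k {{nz}} p} {μ {n} k {{nz}} p′} (μ-≈ {p} {p′} p≈))

cost-≈ : ∀ {n} {g g′ : Subset n → ℝ} {p p′} → (∀ S → seq (g S) ≈ seq (g′ S)) → seq p ≈ seq p′ →
  seq (∑ (λ S → g S *ℝ p ^ℝ ∣ S ∣)) ≈ seq (∑ (λ S → g′ S *ℝ p′ ^ℝ ∣ S ∣))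
cost-≈ {n} {g} {g′} {p} {p′} g≈ p≈ = ∑-≈ {f = λ S → g S *ℝ p ^ℝ ∣ S ∣} {λ S → g′ S *ℝ p′ ^ℝ ∣ S ∣}
  λ S → *-≈ (g S) (g′ S) (p ^ℝ ∣ S ∣) (p′ ^ℝ ∣ S ∣) (g≈ S) (^-≈ p p′ ∣ S ∣ p≈)

-- Late terms of the real hypotheses, and the lower bound

≤ℝ-≈ : ∀ {x y z} → x ≤ℝ y → seq y ≈ seq z → x ≤ℝ z
≤ℝ-≈ {x} {y} {z} x≤y y≈z = ≤ℝ-trans {x} {y} {z} x≤y (≈⇒≤ℝ {y} {z} y≈z)

≈-≤ℝ : ∀ {x y z} → seq x ≈ seq y → x ≤ℝ z → y ≤ℝ z
≈-≤ℝ {x} {y} {z} x≈y x≤z = ≤ℝ-trans {y} {x} {z} (≈⇒≤ℝ {y} {x} (≈-sym x≈y)) x≤z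

≤+⇒-≤ : ∀ {x y ε} → x ≤ᵠ y + ε → x - ε ≤ᵠ y
≤+⇒-≤ {x} {y} {ε} h = ≤-respʳ (ℚ.+-monoˡ-≤ (- ε) h) (solve 2 (λ y e → y :+ e :- e := y) refl y ε)

-- A gap at one late index persists along both sequences.
≤ℝ-by-contradiction : ∀ x y → (∀ d → 0ℚ <ᵠ d → Eventually (λ n → seq y n + d ≤ᵠ seq x n) → Empty.⊥) → x ≤ℝ y
≤ℝ-by-contradiction x y no-gap ε 0<ε = decide (seq x N ℚ.≤? seq y N + (η + η))
  where
  -- A quarter of ε: 2 η for the comparison at N, and η for moving each of the two sequences away
  -- from N.
  η = ½ * (½ * ε)
  0<η = half-pos (half-pos 0<ε)
  cx = cauchy x η 0<η
  cy = cauchy y η 0<η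
  N = proj₁ cx ℕ.⊔ proj₁ cy
  Nx≤N = ℕ.m≤m⊔n (proj₁ cx) (proj₁ cy)
  Ny≤N = ℕ.m≤n⊔m (proj₁ cx) (proj₁ cy)
  open ℚ.≤-Reasoning
  xn≤ : ∀ m n → N ≤ m → N ≤ n → seq x m ≤ᵠ seq x n + η
  xn≤ m n N≤m N≤n = ∣-∣≤⇒≤+ (proj₂ cx m n (ℕ.≤-trans Nx≤N N≤m) (ℕ.≤-trans Nx≤N N≤n))
  yn≤ : ∀ m n → N ≤ m → N ≤ n → seq y m ≤ᵠ seq y n + η
  yn≤ m n N≤m N≤n = ∣-∣≤⇒≤+ (proj₂ cy m n (ℕ.≤-trans Ny≤N N≤m) (ℕ.≤-trans Ny≤N N≤n))
  decide : Dec (seq x N ≤ᵠ seq y N + (η + η)) → Eventually (λ n → seq x n ≤ᵠ seq y n + ε)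
  decide (yes xN≤) = N , λ n N≤n → begin
    seq x n                      ≤⟨ xn≤ n N N≤n ℕ.≤-refl ⟩
    seq x N + η                  ≤⟨ ℚ.+-monoˡ-≤ η xN≤ ⟩
    seq y N + (η + η) + η        ≤⟨ ℚ.+-monoˡ-≤ η (ℚ.+-monoˡ-≤ (η + η) (yn≤ N n ℕ.≤-refl N≤n)) ⟩
    seq y n + η + (η + η) + η    ≡⟨ solve 2 (λ y e → let η = con ½ :* (con ½ :* e) in y :+ η :+ (η :+ η) :+ η := y :+ e) refl (seq y n) ε ⟩
    seq y n + ε                  ∎
  decide (no xN≰) = Empty.⊥-elim (no-gap d 0<d (N , λ n N≤n → begin
    seq y n + d                                        ≤⟨ ℚ.+-monoˡ-≤ d (yn≤ n N N≤n ℕ.≤-refl) ⟩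
    seq y N + η + (seq x N - (seq y N + (η + η)))      ≡⟨ solve 3 (λ x y η → y :+ η :+ (x :- (y :+ (η :+ η))) := x :- η) refl (seq x N) (seq y N) η ⟩
    seq x N - η                                        ≤⟨ ≤+⇒-≤ (xn≤ N n ℕ.≤-refl N≤n) ⟩
    seq x n                                            ∎))
    where
    d = seq x N - (seq y N + (η + η))
    0<d : 0ℚ <ᵠ d
    0<d = ℚ.≤-<-trans (ℚ.≤-reflexive (sym (ℚ.+-inverseʳ (seq y N + (η + η))))) (ℚ.+-monoˡ-< (- (seq y N + (η + η))) (ℚ.≰⇒> xN≰))

module _ {n : ℕ} {F : Family n} (F? : Decidable F) (k : ℕ) .{{nz : NonZero k}} {p p′ : ℝ} (p≈ : seq p ≈ seq p′) where

  private
    M : ℚ → ℚ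
    M r = 𝕄 k {{nz}} r n (λ R → ⟦ rainbow? k F? R ⟧)
    ν : ℝ → ℝ
    ν p = μ-family {n} k {{nz}} p (rainbow? k F?)
    ν≈ : seq (ν p) ≈ seq (ν p′)
    ν≈ = μ-family-≈ {n} k {{nz}} {p} {p′} (rainbow? k F?) p≈
    seq-ν : ∀ j → seq (ν p′) j ≡ M (seq p′ j)
    seq-ν = seq-μ-family {n} k {{nz}} p′ (rainbow? k F?)

  threshold-≥½ : ½ℝ ≤ℝ ν p → ∀ ε → 0ℚ <ᵠ ε → Eventually (λ j → ½ - ε ≤ᵠ M (seq p′ j))
  threshold-≥½ h ε 0<ε = eventually-map (λ j h → ≤+⇒-≤ (≤-respʳ h (cong (_+ ε) (seq-ν j))))
    (≤ℝ-≈ {½ℝ} {ν p} {ν p′} h ν≈ ε 0<ε)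

  threshold-≤½ : ν p ≤ℝ ½ℝ → ∀ ε → 0ℚ <ᵠ ε → Eventually (λ j → M (seq p′ j) ≤ᵠ ½ + ε)
  threshold-≤½ h ε 0<ε = eventually-map (λ j → ≤-respˡ (sym (seq-ν j)))
    (≈-≤ℝ {ν p} {ν p′} {½ℝ} ν≈ h ε 0<ε)

module _ {n : ℕ} {g g′ : Subset n → ℝ} (g≈ : ∀ S → seq (g S) ≈ seq (g′ S)) where

  covers-eventually : ∀ T → 1ℝ ≤ℝ ∑-over (_⊆? T) g → ∀ ε → 0ℚ <ᵠ ε → Eventually (λ j → 1ℚ - ε ≤ᵠ ∑ᵠ (λ S → ⟦ S ⊆? T ⟧ * seq (g′ S) j))
  covers-eventually T h ε 0<ε = eventually-map (λ j h → ≤+⇒-≤ (≤-respʳ h (cong (_+ ε) (seq-∑-over (_⊆? T) g′ j))))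
        (≤ℝ-≈ {1ℝ} {∑-over (_⊆? T) g} {∑-over (_⊆? T) g′} h (∑-over-≈ (_⊆? T) {g} {g′} g≈) ε 0<ε)

  cost-eventually : ∀ {q q′} → seq q ≈ seq q′ → ∑ (λ S → g S *ℝ q ^ℝ ∣ S ∣) ≤ℝ ½ℝ → ∀ ε → 0ℚ <ᵠ ε → Eventually (λ j → ∑ᵠ (λ S → seq (g′ S) j * seq q′ j ^ ∣ S ∣) ≤ᵠ ½ + ε)
  cost-eventually {q} {q′} q≈ h ε 0<ε = eventually-map (λ j → ≤-respˡ (sym (seq-cost g′ q′ j)))
        (≈-≤ℝ {∑ (λ S → g S *ℝ q ^ℝ ∣ S ∣)} {∑ (λ S → g′ S *ℝ q′ ^ℝ ∣ S ∣)} {½ℝ} (cost-≈ {g = g} {g′} {q} {q′} g≈ q≈) h ε 0<ε)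

module _ {n : ℕ} {F : Family n} (F? : Decidable F) (inc : Increasing F) {T₀} (FT₀ : F T₀) (k : ℕ) .{{nz : NonZero k}} 
  {g′ : Subset n → ℝ} {p′ q′} (0≤p : ∀ j → 0ℚ ≤ᵠ seq p′ j) (q≤1 : ∀ j → seq q′ j ≤ᵠ 1ℚ) (0≤g : ∀ S j → 0ℚ ≤ᵠ seq (g′ S) j)
  (covers : ∀ T → F T → ∀ ε → 0ℚ <ᵠ ε → Eventually (λ j → 1ℚ - ε ≤ᵠ ∑ᵠ (λ S → ⟦ S ⊆? T ⟧ * seq (g′ S) j)))
  (cost : ∀ ε → 0ℚ <ᵠ ε → Eventually (λ j → ∑ᵠ (λ S → seq (g′ S) j * seq q′ j ^ ∣ S ∣) ≤ᵠ ½ + ε))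
  (mass : ∀ ε → 0ℚ <ᵠ ε → Eventually (λ j → ½ - ε ≤ᵠ 𝕄 k {{nz}} (seq p′ j) n (λ R → ⟦ rainbow? k F? R ⟧))) where

  lower-bound-representatives : q′ ≤ℝ p′
  lower-bound-representatives = ≤ℝ-by-contradiction q′ p′ contra
    where
    contra : ∀ d → 0ℚ <ᵠ d → Eventually (λ j → seq p′ j + d ≤ᵠ seq q′ j) → Empty.⊥
    contra d 0<d gap =
      let N , all = eventually-∧ (eventually-∧ gap (eventually-∀ covers′)) (eventually-∧ (cost ε 0<ε) (mass ε 0<ε))
          (p+d≤q , cov) , (cst , mss) = all N ℕ.≤-refl
      in no-gap k F? inc FT₀ (0≤p N) (q≤1 N) 0<d p+d≤q (λ S → seq (g′ S) N) (λ S → 0≤g S N) cov cst mss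
      where
      -- The accuracy demanded by `no-gap` depends on d and n only, so it is fixed before a common
      -- index is chosen.
      ε = d ^ n * ½ ^ 4
      0<ε : 0ℚ <ᵠ ε
      0<ε = ℚ.*-monoˡ-<-pos (½ ^ 4) (^-pos n 0<d)
      -- Deciding F T first extends the condition to all subsets, so that `eventually-∀` yields one
      -- index for all of them.
      covers′ : ∀ T → Eventually (λ j → F T → 1ℚ - ε ≤ᵠ ∑ᵠ (λ S → ⟦ S ⊆? T ⟧ * seq (g′ S) j))
      covers′ T with F? T
      ... | no ¬FT = 0 , λ _ _ FT → contradiction FT ¬FT
      ... | yes FT = eventually-map (λ j h _ → h) (covers T FT ε 0<ε)

module _ {n : ℕ} {F : Family n} (F? : Decidable F) (inc : Increasing F) where

  lower-bound : ∀ {T₀} → F T₀ → ∀ (k : ℕ) .{{nz : NonZero k}} q → IsProbability q → WeaklySmall F q →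
    ∀ p → IsRainbowThreshold k {{nz}} F? p → q ≤ℝ p
  lower-bound FT₀ k {{nz}} q q-prob (g , 0≤g , covers , cost) p (p-prob , _ , ½≤μ) =
    let p′ , p≈ , 0≤p′ , _ = unit-representative p p-prob
        q′ , q≈ , _ , q′≤1 = unit-representative q q-prob
        g′                 = λ S → proj₁ (nonneg-representative (g S) (0≤g S))
        g≈                 = λ S → proj₁ (proj₂ (nonneg-representative (g S) (0≤g S)))
    in ≈-≤ℝ {q′} {q} {p} (≈-sym q≈) (≤ℝ-≈ {q′} {p′} {p}
      (lower-bound-representatives F? inc FT₀ k {{nz}} {g′} {p′} {q′} 0≤p′ q′≤1
        (λ S → proj₂ (proj₂ (nonneg-representative (g S) (0≤g S))))
        (λ T FT → covers-eventually {g = g} {g′} g≈ T (covers T FT))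
        (cost-eventually {g = g} {g′} g≈ {q} {q′} q≈ cost)
        (threshold-≥½ F? k {{nz}} {p} {p′} p≈ ½≤μ))
      (≈-sym p≈))

-- The upper bound for real numbers

2ℚ : ℚ
2ℚ = 1ℚ + 1ℚ

t·1≡t/1 : ∀ t → t · 1ℚ ≡ ℤ.+ t ℚ./ 1
t·1≡t/1 zero    = refl
t·1≡t/1 (suc t) = trans (cong (1ℚ +_) (t·1≡t/1 t)) (trans (ℚ.+-comm 1ℚ (ℤ.+ t ℚ./ 1)) (sym (frac-suc t 0)))

module _ {n : ℕ} {F : Family n} (F? : Decidable F) where

  weaklySmall : ∀ (k : ℕ) .{{_ : NonZero k}} (m : ℕ) .{{_ : NonZero m}} →
    (∀ A → ℋ F A → ∣ A ∣ ℕ.< 2 ℕ.^ m) → (∀ A → ℋ F A → ∣ A ∣ ≤ k) →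
    ∀ {p} → 0ℚ ≤ᵠ p → p ≤ᵠ 1ℚ → 𝕄 k p n (λ S → ⟦ rainbow? k F? S ⟧) ≤ᵠ 1ℚ - ½ ^ 2 →
    WeaklySmall F (fromℚ (p * 1/ m * ½ ^ 8))
  weaklySmall k m small ≤k {p} 0≤p p≤1 fails = (λ S → fromℚ (g S)) ,
    (λ S → pointwise⇒≤ℝ {0ℝ} {fromℚ (g S)} λ _ → projected-nonneg k F? m small ≤k 0≤p p≤1 fails S) ,
    (λ T FT → pointwise⇒≤ℝ {1ℝ} {∑-over (_⊆? T) (λ S → fromℚ (g S))} λ j → ≤-respʳ (projected-covers k F? m small ≤k 0≤p p≤1 fails T FT)
      (sym (seq-∑-over (_⊆? T) (λ S → fromℚ (g S)) j))) ,
    pointwise⇒≤ℝ {∑ (λ S → fromℚ (g S) *ℝ fromℚ (p * 1/ m * ½ ^ 8) ^ℝ ∣ S ∣)} {½ℝ} λ j →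
      ≤-respˡ (seq-cost (λ S → fromℚ (g S)) (fromℚ (p * 1/ m * ½ ^ 8)) j) (projected-cost k F? m small ≤k 0≤p p≤1 fails)
    where
    g : Subset n → ℚ
    g = projected-cover k F? m small ≤k 0≤p p≤1 fails

fromℚ-isProbability : ∀ {x} → 0ℚ ≤ᵠ x → x ≤ᵠ 1ℚ → IsProbability (fromℚ x)
fromℚ-isProbability {x} 0≤x x≤1 = pointwise⇒≤ℝ {0ℝ} {fromℚ x} (λ _ → 0≤x) , pointwise⇒≤ℝ {fromℚ x} {1ℝ} (λ _ → x≤1)

module _ {n : ℕ} {F : Family n} (F? : Decidable F) (k : ℕ) .{{nz : NonZero k}} (m : ℕ) .{{mz : NonZero m}}
  (small : ∀ A → ℋ F A → ∣ A ∣ ℕ.< 2 ℕ.^ m) (≤k : ∀ A → ℋ F A → ∣ A ∣ ≤ k)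
  {q} (q-threshold : IsFracExpectationThreshold F q) where

  private
    -- Inverse of the scaling by `1/ m * ½ ^ 8` that the projected cover requires.
    c : ℚ
    c = m · 1ℚ * 2ℚ ^ 8
    open ℚ.≤-Reasoning

    c*≡ : ∀ r → c * (r * 1/ m * ½ ^ 8) ≡ r
    c*≡ r = begin-equality
      m · 1ℚ * 2ℚ ^ 8 * (r * 1/ m * ½ ^ 8)  ≡⟨ solve 3 (λ x r y → x :* con (2ℚ ^ 8) :* (r :* y :* con (½ ^ 8)) := r :* (y :* x)) refl (m · 1ℚ) r (1/ m) ⟩
      r * (1/ m * m · 1ℚ)                   ≡⟨ cong (r *_) (*-·-comm m (1/ m) 1ℚ) ⟩
      r * m · (1/ m * 1ℚ)                   ≡⟨ cong (λ x → r * m · x) (ℚ.*-identityʳ (1/ m)) ⟩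
      r * m · 1/ m                          ≡⟨ cong (r *_) (k·1/k≡1 m) ⟩
      r * 1ℚ                                ≡⟨ ℚ.*-identityʳ r ⟩
      r                                     ∎

    0<c : 0ℚ <ᵠ c
    0<c = ℚ.*-monoˡ-<-pos (2ℚ ^ 8) (ℚ.<-≤-trans (ℚ.positive⁻¹ 1ℚ) (·-monoˡ-≤ {1} {m} 0≤1 (ℕ.>-nonZero⁻¹ m)))

  -- Maximality of q, applied to a single rational r at which failure is still likely: the projected
  -- cover witnesses that the scaled r is weakly small.
  rational-bound : ∀ {r} → 0ℚ ≤ᵠ r → r ≤ᵠ 1ℚ → 𝕄 k {{nz}} r n (λ S → ⟦ rainbow? k F? S ⟧) ≤ᵠ 1ℚ - ½ ^ 2 →
    fromℚ (r * 1/ m * ½ ^ 8) ≤ℝ q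
  rational-bound {r} 0≤r r≤1 fails = proj₂ q-threshold (fromℚ (r * 1/ m * ½ ^ 8)) (
    fromℚ-isProbability (*-nonneg (*-nonneg 0≤r (1/k-nonneg m)) (^-nonneg 8 0≤½))
      (ℚ.≤-trans (p*q≤q (ℚ.≤-trans (p*q≤q r≤1 (1/k-nonneg m)) (1/k≤1 m)) (^-nonneg 8 0≤½)) (^-≤1 8 0≤½ ½≤1)) ,
    weaklySmall F? k {{nz}} m {{mz}} small ≤k {r} 0≤r r≤1 fails)

  module _ {p′ q′ : ℝ} (0≤p′ : ∀ j → 0ℚ ≤ᵠ seq p′ j) (p′≤1 : ∀ j → seq p′ j ≤ᵠ 1ℚ)
    (fails : Eventually (λ j → 𝕄 k {{nz}} (seq p′ j) n (λ S → ⟦ rainbow? k F? S ⟧) ≤ᵠ 1ℚ - ½ ^ 2)) (q≈ : seq q ≈ seq q′) where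

    -- One term of p′ is enough, taken so late that it satisfies `fails` and differs from all later
    -- terms by at most ε / 2; covers are built at rational densities only.
    threshold≤c*q : p′ ≤ℝ fromℚ c *ℝ q′
    threshold≤c*q ε 0<ε =
      let N₁ , cp       = cauchy p′ (½ * ε) (half-pos 0<ε)
          N₂ , f        = fails
          N             = N₁ ℕ.⊔ N₂
          δ , 0<δ , cδ  = share c ε 0<c 0<ε
          q₀            = seq p′ N * 1/ m * ½ ^ 8
      in eventually-map (λ j (N≤j , h) → begin
        seq p′ j                             ≤⟨ ∣-∣≤⇒≤+ (cp j N (ℕ.m⊔n≤o⇒m≤o N₁ N₂ N≤j) (ℕ.m≤m⊔n N₁ N₂)) ⟩
        seq p′ N + ½ * ε                     ≡⟨ cong (_+ ½ * ε) (c*≡ (seq p′ N)) ⟨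
        c * q₀ + ½ * ε                       ≤⟨ ℚ.+-monoˡ-≤ (½ * ε) (*-monoʳ-≤ (ℚ.<⇒≤ 0<c) h) ⟩
        c * (seq q′ j + δ) + ½ * ε           ≡⟨ cong (_+ ½ * ε) (trans (ℚ.*-distribˡ-+ c (seq q′ j) δ) (cong (c * seq q′ j +_) cδ)) ⟩
        c * seq q′ j + ½ * ε + ½ * ε         ≡⟨ ℚ.+-assoc (c * seq q′ j) (½ * ε) (½ * ε) ⟩
        c * seq q′ j + (½ * ε + ½ * ε)       ≡⟨ cong (c * seq q′ j +_) (half+half ε) ⟩
        c * seq q′ j + ε                     ∎)
        (eventually-∧ {P = λ j → N ≤ j} (N , λ _ N≤j → N≤j)
          (≤ℝ-≈ {fromℚ q₀} {q} {q′} (rational-bound (0≤p′ N) (p′≤1 N) (f N (ℕ.m≤n⊔m N₁ N₂))) q≈ δ 0<δ))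

-- For t = ⌊log₂ ℓ⌋ the number of rounds is suc t.
rounds-bound : ∀ t → 1 ≤ t → suc t · 1ℚ * 2ℚ ^ 8 ≤ᵠ 2ℚ ^ 9 * t · 1ℚ
rounds-bound t 1≤t = begin
  -- The hypothesis 1 ≤ t absorbs the additional round into a factor 2, which turns 2^8 into 2^9.
  (1ℚ + t · 1ℚ) * 2ℚ ^ 8          ≤⟨ *-monoˡ-≤ (^-nonneg 8 (ℚ.nonNegative⁻¹ 2ℚ)) (ℚ.+-monoˡ-≤ (t · 1ℚ) (·-monoˡ-≤ {1} {t} 0≤1 1≤t)) ⟩
  (t · 1ℚ + t · 1ℚ) * 2ℚ ^ 8      ≡⟨ solve 1 (λ x → (x :+ x) :* con (2ℚ ^ 8) := con (2ℚ ^ 9) :* x) refl (t · 1ℚ) ⟩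
  2ℚ ^ 9 * t · 1ℚ                 ∎
  where open ℚ.≤-Reasoning

module _ {q′ : ℝ} (0≤q′ : ∀ j → 0ℚ ≤ᵠ seq q′ j) (q′≤1 : ∀ j → seq q′ j ≤ᵠ 1ℚ) {L : ℝ} {t} (t≤L : fromℚ (ℤ.+ t ℚ./ 1) ≤ℝ L)
  {c K : ℚ} (0<K : 0ℚ <ᵠ K) (c≤ : c ≤ᵠ K * t · 1ℚ) where

  c*q≤K*q*L : fromℚ c *ℝ q′ ≤ℝ fromℚ K *ℝ q′ *ℝ L
  c*q≤K*q*L ε 0<ε =
    let δ , 0<δ , Kδ = share K ε 0<K 0<ε
    in eventually-map (λ j h → begin
      c * seq q′ j
        ≤⟨ *-monoˡ-≤ (0≤q′ j) c≤ ⟩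
      K * t · 1ℚ * seq q′ j
        ≤⟨ *-monoˡ-≤ (0≤q′ j) (*-monoʳ-≤ (ℚ.<⇒≤ 0<K) (≤-respˡ (t·1≡t/1 t) h)) ⟩
      K * (seq L j + δ) * seq q′ j
        ≡⟨ solve 4 (λ k l d q → k :* (l :+ d) :* q := k :* q :* l :+ q :* (k :* d)) refl K (seq L j) δ (seq q′ j) ⟩
      K * seq q′ j * seq L j + seq q′ j * (K * δ)
        ≡⟨ cong (λ x → K * seq q′ j * seq L j + seq q′ j * x) Kδ ⟩
      K * seq q′ j * seq L j + seq q′ j * (½ * ε)
        ≤⟨ ℚ.+-monoʳ-≤ (K * seq q′ j * seq L j) (ℚ.≤-trans (p*q≤q (q′≤1 j) (ℚ.<⇒≤ (half-pos 0<ε))) (p*q≤q ½≤1 (ℚ.<⇒≤ 0<ε))) ⟩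
      K * seq q′ j * seq L j + ε ∎)
      (t≤L δ 0<δ)
    where open ℚ.≤-Reasoning

⌊log₂⌋≤log₂ : ∀ {ℓ} → 2 ≤ ℓ → fromℚ (ℤ.+ ⌊log₂ ℓ ⌋ ℚ./ 1) ≤ℝ log₂ ℓ
⌊log₂⌋≤log₂ {ℓ} 2≤ℓ = log₂-lower ℓ {{ℓ≢0}} ⌊log₂ ℓ ⌋ 0 (ℕ.≤-trans (2^⌊log₂n⌋≤n ℓ {{ℓ≢0}}) (ℕ.≤-reflexive (sym (ℕ.^-identityʳ ℓ))))
  where ℓ≢0 = ℕ.>-nonZero (ℕ.≤-trans (ℕ.s≤s ℕ.z≤n) 2≤ℓ)

module _ {n : ℕ} {F : Family n} (F? : Decidable F) (k : ℕ) .{{nz : NonZero k}} {t} (1≤t : 1 ≤ t) {L : ℝ} (t≤L : fromℚ (ℤ.+ t ℚ./ 1) ≤ℝ L)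
  (small : ∀ A → ℋ F A → ∣ A ∣ ℕ.< 2 ℕ.^ suc t) (≤k : ∀ A → ℋ F A → ∣ A ∣ ≤ k)
  {q} (q-threshold : IsFracExpectationThreshold F q) where

  upper-bound : ∀ p → IsRainbowThreshold k {{nz}} F? p → p ≤ℝ fromℚ (2ℚ ^ 9) *ℝ q *ℝ L
  upper-bound p (p-prob , μ≤½ , _) =
    let p′ , p≈ , 0≤p′ , p′≤1 = unit-representative p p-prob
        q′ , q≈ , 0≤q′ , q′≤1 = unit-representative q (proj₁ (proj₁ q-threshold))
        K                     = fromℚ (2ℚ ^ 9)
        c                     = suc t · 1ℚ * 2ℚ ^ 8
        -- The error 1/4 is chosen because 1/2 + 1/4 = 1 - 1/4 is the bound on success used for the
        -- cover.
        fails                 = threshold-≤½ F? k {{nz}} {p} {p′} p≈ μ≤½ (½ ^ 2) (^-pos 2 (ℚ.positive⁻¹ ½))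
    in ≈-≤ℝ {p′} {p} {K *ℝ q *ℝ L} (≈-sym p≈)
      (≤ℝ-trans {p′} {fromℚ c *ℝ q′} {K *ℝ q *ℝ L} (threshold≤c*q F? k {{nz}} (suc t) small ≤k {q} q-threshold {p′} {q′} 0≤p′ p′≤1 fails q≈)
        (≤ℝ-≈ {fromℚ c *ℝ q′} {K *ℝ q′ *ℝ L} {K *ℝ q *ℝ L}
          (c*q≤K*q*L {q′} 0≤q′ q′≤1 {L} {t} t≤L {c} {2ℚ ^ 9} (^-pos 9 (ℚ.positive⁻¹ 2ℚ)) (rounds-bound t 1≤t))
          (*-≈ (K *ℝ q′) (K *ℝ q) L L (*-≈ K K q′ q ≈-refl (≈-sym q≈)) ≈-refl)))

theorem2 :
    Σ[ K′ ∈ ℝ ]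
      (∀ (n : ℕ) (F : Family n) (F? : Decidable F) → Increasing F →
       ∀ (ℓ : ℕ) → IsMaxMinimalSize F ℓ →
       ∀ (k : ℕ) .{{_ : NonZero k}} → ℓ ≤ k →
       ∀ (q : ℝ) → IsFracExpectationThreshold F q →
       ∀ (p : ℝ) → IsRainbowThreshold k F? p →
       q ≤ℝ p × (2 ≤ ℓ → p ≤ℝ K′ *ℝ q *ℝ log₂ ℓ))
theorem2 = fromℚ (2ℚ ^ 9) , λ n F F? inc ℓ max k {{nz}} ℓ≤k q q-threshold p p-threshold →
  -- ℓ is attained by a minimal member, which supplies the member of F that `lower-bound` asks for.
  let ((_ , (FA , _) , _) , ≤ℓ) = max
      ((q-prob , q-small) , _)  = q-threshold
  in lower-bound F? inc FA k {{nz}} q q-prob q-small p p-threshold ,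
     λ 2≤ℓ → upper-bound F? k {{nz}} {⌊log₂ ℓ ⌋} (⌊log₂⌋-mono-≤ 2≤ℓ) {log₂ ℓ} (⌊log₂⌋≤log₂ 2≤ℓ)
       -- The strict bound ℓ < 2^(1 + ⌊log₂ ℓ⌋) is the reason for one round more than ⌊log₂ ℓ⌋.
       (λ A hA → ℕ.≤-<-trans (≤ℓ ∣ A ∣ (A , hA , refl)) (n<2^[1+⌊log₂n⌋] ℓ))
       (λ A hA → ℕ.≤-trans (≤ℓ ∣ A ∣ (A , hA , refl)) ℓ≤k) {q} q-threshold p p-threshold
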